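{- Let $G=(V,E)$ be a graph such that $|V|$ is even, and let $\mathbf{M}(G):=\{\chi_M: M \text{ a perfect matching of } G\}\subseteq\{0,1\}^E$. Then $\mathbf{M}(G)$ is a dyadic generating set for a cone.
   Context: A perfect matching is a subset $M\subseteq E$ such that every vertex is incident with exactly one edge of $M$; $\chi_M$ is its incidence vector. A dyadic rational is a number of the form $a/2^k$ with $a,k$ integers and $k\geq 0$. A finite set $S$ of integral vectors is a dyadic generating set for a cone if every integral vector in the conic hull of $S$ can be written as a conic combination of the vectors of $S$ with dyadic nonnegative coefficients.
   Formalization: The conic hull of the perfect matching vectors is taken with nonnegative rational rather than real coefficients; for integral vectors the two hulls have the same members. -}

module Defs where

open import Data.Nat using (ℕ; _^_)
open import Data.Nat.Properties using (m^n≢0)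
open import Data.Fin using (Fin)
open import Data.Bool using (Bool; true; false; T)
open import Data.Integer using (ℤ; +_)
open import Data.Rational using (ℚ; _/_; 0ℚ; 1ℚ; _+_; _*_; _≤_)
open import Data.List using (List; []; _∷_; foldr)
open import Data.Product using (Σ; _×_; _,_; proj₁; proj₂)
open import Data.Sum using (_⊎_)
open import Relation.Binary.PropositionalEquality using (_≡_; _≢_)

-- A (finite, loopless, possibly with parallel edges) graph with vertex set
-- Fin n and edge set Fin m; edge e has endpoints (end₁ e) and (end₂ e).
record Graph : Set where
  field
    n    : ℕ
    m    : ℕ
    end₁ : Fin m → Fin n
    end₂ : Fin m → Fin n
    loopless : ∀ e → end₁ e ≢ end₂ e

open Graph public

Incident : (G : Graph) → Fin (m G) → Fin (n G) → Set
Incident G e w = (end₁ G e ≡ w) ⊎ (end₂ G e ≡ w)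

IsPerfectMatching : (G : Graph) → (Fin (m G) → Bool) → Set
IsPerfectMatching G M =
  ∀ (w : Fin (n G)) →
    Σ (Fin (m G)) (λ e → T (M e) × Incident G e w)
    × (∀ e e′ → T (M e) → Incident G e w → T (M e′) → Incident G e′ w → e ≡ e′)

PerfectMatching : Graph → Set
PerfectMatching G = Σ (Fin (m G) → Bool) (IsPerfectMatching G)

χ : (G : Graph) → PerfectMatching G → Fin (m G) → ℚ
χ G (M , _) e with M e
... | true  = 1ℚ
... | false = 0ℚ

Combination : Graph → Set
Combination G = List (PerfectMatching G × ℚ)

evalComb : (G : Graph) → Combination G → Fin (m G) → ℚ
evalComb G cs e = foldr (λ p acc → proj₂ p * χ G (proj₁ p) e + acc) 0ℚ cs

AllCoeffs : (G : Graph) → (ℚ → Set) → Combination G → Set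
AllCoeffs G P [] = Data.Unit.⊤ where import Data.Unit
AllCoeffs G P (p ∷ cs) = P (proj₂ p) × AllCoeffs G P cs

Dyadic : ℚ → Set
Dyadic q = Σ ℤ (λ a → Σ ℕ (λ k → q ≡ (_/_ a (2 ^ k) {{m^n≢0 2 k}})))

NonNeg : ℚ → Set
NonNeg q = 0ℚ ≤ q

toℚ : (G : Graph) → (Fin (m G) → ℤ) → Fin (m G) → ℚ
toℚ G x e = x e / 1

InConicHull : (G : Graph) → (Fin (m G) → ℚ) → Set
InConicHull G x =
  Σ (Combination G) (λ cs → AllCoeffs G NonNeg cs × (∀ e → evalComb G cs e ≡ x e))

DyadicConicComb : (G : Graph) → (Fin (m G) → ℚ) → Set
DyadicConicComb G x =
  Σ (Combination G)
    (λ cs → AllCoeffs G (λ q → NonNeg q × Dyadic q) cs × (∀ e → evalComb G cs e ≡ x e))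

IsDyadicGeneratingSet : Graph → Set
IsDyadicGeneratingSet G =
  ∀ (x : Fin (m G) → ℤ) → InConicHull G (toℚ G x) → DyadicConicComb G (toℚ G x)

EvenOrder : Graph → Set
EvenOrder G = Σ ℕ (λ k → n G ≡ k Data.Nat.+ k)

module Submission where

-- A vector in the cone of the perfect matchings satisfies x ≥ 0, x(δ(v)) = r for all
-- vertices v and x(δ(U)) ≥ r for all odd U.  Conversely every integral x with these
-- properties is a dyadic combination of perfect matchings, by induction on the number of
-- vertices and on the support of x.  If a nontrivial odd cut is tight, contract either side
-- of it; the matchings of both contractions use one edge of the cut each, so that dyadic
-- decompositions of the two images of x can be merged.  Otherwise start from x in the
-- direction -M for a perfect matching M in the support.  On leaving the cone either an edge
-- vanishes, and x minus a multiple of M has smaller support, or a cut U becomes tight; then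
-- the exit point is integral after multiplication by |M ∩ δ(U)| - 1, which is harmless if
-- this is a power of 2.  The crux is that as soon as some M crosses U more than once, some
-- M′ crosses it in 3 or 5 edges: the matchings saturating one side of U trace on M ∩ δ(U)
-- the members of a family with the exchange property of even delta-matroids, and two such
-- families that contain all singletons and cover all pairs share a set of 3 or 5 elements.
-- A perfect matching M exists because a vertex with at most two neighbours would give a
-- tight cut, so that there are more edges than vertices, and x can be moved along a kernel
-- vector of the incidence matrix to the boundary, where induction applies.

open import Defs

open import Data.Bool.Base using (Bool; true; false; not; T; _∧_; _∨_; _xor_; if_then_else_)
open import Data.Bool.Properties using (¬-not)
import Data.Bool.Properties as Boolₚ
open import Data.Empty using (⊥; ⊥-elim)
open import Data.Fin.Base using (Fin; zero; suc)
open import Data.Fin.Properties using (_≟_; any?; all?)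
open import Data.Integer.Base as ℤ using (ℤ; +_; -[1+_]; _+_; _*_; _-_; -_; _≤_; _<_; 0ℤ; 1ℤ)
import Data.Integer.Properties as ℤₚ
open import Data.Integer.Tactic.RingSolver using (solve-∀)
open import Data.List.Base using (List; []; _∷_; _++_; map; length; filter; allFin)
import Data.List.Properties as Listₚ
open import Data.List.Membership.Propositional using (_∈_; _∉_; find; lose)
open import Data.List.Membership.Propositional.Properties using (∈-map⁺; ∈-map⁻; ∈-++⁺ˡ; ∈-++⁺ʳ; ∈-++⁻; ∈-allFin; ∈-∃++; ∈-filter⁺; ∈-filter⁻)
open import Data.List.Relation.Unary.Any using (Any; here; there)
import Data.List.Relation.Unary.Any as Any
open import Data.List.Relation.Unary.All using (All; []; _∷_)
import Data.List.Relation.Unary.All as All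
open import Data.Nat.Base as ℕ using (ℕ; zero; suc; _^_)
import Data.Nat.Properties as ℕₚ
open import Data.Product.Base using (Σ; _×_; _,_; proj₁; proj₂)
open import Data.Sum.Base using (_⊎_; inj₁; inj₂; [_,_]′)
open import Data.Unit.Base using (⊤; tt)
open import Data.Vec.Base using (Vec; []; _∷_; lookup; tabulate)
open import Data.Vec.Properties using (lookup∘tabulate)
open import Function.Base using (_∘_; case_of_)
open import Relation.Binary.PropositionalEquality
open import Relation.Nullary using (¬_; Dec; yes; no; does)
open import Relation.Nullary.Decidable using (dec-true; dec-false; decidable-stable; _×-dec_; _⊎-dec_; _→-dec_; ¬?; map′)

open import Data.List.Relation.Binary.Permutation.Propositional using (_↭_; ↭-refl; ↭-sym; ↭-trans; prep; swap)
open import Relation.Binary.Definitions using (tri<; tri≈; tri>)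
open import Data.List.Relation.Binary.Permutation.Propositional.Properties using (∈-resp-↭)
open import Data.List.Relation.Unary.Unique.Propositional using (Unique)
open import Data.List.Relation.Unary.AllPairs using ([]; _∷_)
open import Data.Nat.DivMod using (m%n<n; m*n/n≡m; /-monoˡ-≤; m≡m%n+[m/n]*n)
open import Data.List.Membership.DecPropositional using (_∈?_)
open import Data.Rational.Base as ℚ using (ℚ; mkℚ; 0ℚ; toℚᵘ)
import Data.Rational.Properties as ℚₚ
open import Data.Rational.Unnormalised.Base as ℚᵘ using (mkℚᵘ; _≃_; *≡*)
import Data.Rational.Unnormalised.Properties as ℚᵘₚ

-- Sums and counting

-- A ray in the direction -M′, for a matching M′ with 3 or 5 edges in the cut U, would settle w at
-- once if it were stopped by U; but another cut with a bad crossing number may stop it earlier.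
-- Hence the exit point b of the first ray is kept, together with an equation k w = b + S for a
-- dyadic S. Since b is tight, b is dyadic, and so is k w. The second ray starts from N b + w, with
-- N so large that only cuts tight at b can stop it. If U stops it, then N b + w is dyadic, because
-- the excess 3 - 1 or 5 - 1 is a power of 2; adding N S shows that (N k + 1) w is dyadic, and N k +
-- 1 is prime to k. If another cut is strictly first, then U is loose at the new exit point and no
-- loose cut has become tight, so only finitely many repetitions are possible. Coprimality has to be
-- used with nonnegative multipliers, as only a cone is available; a large power of 2 is such a
-- combination of k and N k + 1.

opaque
  ∑ : ∀ {n} → (Fin n → ℤ) → ℤ
  ∑ {zero}  f = 0ℤ
  ∑ {suc n} f = f zero + ∑ (f ∘ suc)

opaque
  ⨁ : ∀ {n} → (Fin n → Bool) → Bool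
  ⨁ {zero}  f = false
  ⨁ {suc n} f = f zero xor ⨁ (f ∘ suc)

⟦_⟧ : Bool → ℤ
⟦ true  ⟧ = 1ℤ
⟦ false ⟧ = 0ℤ

infix 7 _==_
_==_ : ∀ {n} → Fin n → Fin n → Bool
i == j = does (i ≟ j)

==-refl : ∀ {n} (i : Fin n) → i == i ≡ true
==-refl i = dec-true (i ≟ i) refl

==⇒≡ : ∀ {n} {i j : Fin n} → i == j ≡ true → i ≡ j
==⇒≡ {i = i} {j} p with i ≟ j
... | yes q = q

≢⇒== : ∀ {n} {i j : Fin n} → i ≢ j → i == j ≡ false
≢⇒== {i = i} {j} = dec-false (i ≟ j)

true≢false : {b : Bool} → b ≡ true → b ≡ false → ⊥
true≢false refl ()

bool-cases : (b : Bool) → b ≡ true ⊎ b ≡ false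
bool-cases true  = inj₁ refl
bool-cases false = inj₂ refl

-- Inequalities between integers are proved by exhibiting the difference as a
-- sum of products of nonnegative quantities and leaving the identity to the
-- ring solver.
0≤+ : ∀ {a b} → 0ℤ ≤ a → 0ℤ ≤ b → 0ℤ ≤ a + b
0≤+ = ℤₚ.+-mono-≤

0≤* : ∀ {a b} → 0ℤ ≤ a → 0ℤ ≤ b → 0ℤ ≤ a * b
0≤* {a} {b} p q = subst (_≤ a * b) (ℤₚ.*-zeroʳ a)
  (ℤₚ.*-monoˡ-≤-nonNeg a {{ℤ.nonNegative p}} q)

0<* : ∀ {a b} → 0ℤ < a → 0ℤ < b → 0ℤ < a * b
0<* {a} {b} p q = subst (_< a * b) (ℤₚ.*-zeroʳ a)
  (ℤₚ.*-monoˡ-<-pos a {{ℤ.positive p}} q)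

diff : ∀ {a b} → 0ℤ ≤ b - a → a ≤ b
diff = ℤₚ.0≤i-j⇒j≤i

undiff : ∀ {a b} → a ≤ b → 0ℤ ≤ b - a
undiff = ℤₚ.i≤j⇒0≤j-i

<⇒1≤ : ∀ {a b} → a < b → 0ℤ ≤ b - a - 1ℤ
<⇒1≤ {a} {b} p = subst (0ℤ ≤_) (lem a b) (undiff (ℤₚ.i<j⇒suc[i]≤j p))
  where
  lem : ∀ a b → b - (1ℤ + a) ≡ b - a - 1ℤ
  lem = solve-∀

1≤⇒< : ∀ {a b} → 0ℤ ≤ b - a - 1ℤ → a < b
1≤⇒< {a} {b} p = ℤₚ.suc[i]≤j⇒i<j (diff (subst (0ℤ ≤_) (lem a b) p))
  where
  lem : ∀ a b → b - a - 1ℤ ≡ b - (1ℤ + a)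
  lem = solve-∀

0<- : ∀ {a b} → a < b → 0ℤ < b - a
0<- {a} {b} p = 1≤⇒< (subst (0ℤ ≤_) (lem a b) (<⇒1≤ p))
  where
  lem : ∀ a b → b - a - 1ℤ ≡ b - a - 0ℤ - 1ℤ
  lem = solve-∀

0≤⟦⟧ : ∀ b → 0ℤ ≤ ⟦ b ⟧
0≤⟦⟧ true  = ℤ.+≤+ ℕ.z≤n
0≤⟦⟧ false = ℤ.+≤+ ℕ.z≤n

⟦⟧-pos : ∀ {b} → 0ℤ < ⟦ b ⟧ → b ≡ true
⟦⟧-pos {true}  _ = refl
⟦⟧-pos {false} (ℤ.+<+ ())

opaque
  unfolding ∑

  ∑-cong : ∀ {n} {f g : Fin n → ℤ} → (∀ i → f i ≡ g i) → ∑ f ≡ ∑ g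
  ∑-cong {zero}  p = refl
  ∑-cong {suc n} p = cong₂ _+_ (p zero) (∑-cong (p ∘ suc))

opaque
  unfolding ∑

  ∑-+ : ∀ {n} (f g : Fin n → ℤ) → ∑ (λ i → f i + g i) ≡ ∑ f + ∑ g
  ∑-+ {zero}  f g = refl
  ∑-+ {suc n} f g = trans (cong (λ s → f zero + g zero + s) (∑-+ (f ∘ suc) (g ∘ suc)))
                          (lem (f zero) (g zero) (∑ (f ∘ suc)) (∑ (g ∘ suc)))
    where
    lem : ∀ a b c d → a + b + (c + d) ≡ (a + c) + (b + d)
    lem = solve-∀

opaque
  unfolding ∑

  ∑-* : ∀ {n} a (f : Fin n → ℤ) → ∑ (λ i → a * f i) ≡ a * ∑ f
  ∑-* {zero}  a f = sym (ℤₚ.*-zeroʳ a)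
  ∑-* {suc n} a f = trans (cong (λ s → a * f zero + s) (∑-* a (f ∘ suc))) (sym (ℤₚ.*-distribˡ-+ a _ _))

opaque
  unfolding ∑

  ∑-0 : ∀ {n} {f : Fin n → ℤ} → (∀ i → f i ≡ 0ℤ) → ∑ f ≡ 0ℤ
  ∑-0 {zero}  p = refl
  ∑-0 {suc n} p = cong₂ _+_ (p zero) (∑-0 (p ∘ suc))

opaque
  unfolding ∑

  ∑-swap : ∀ {n k} (f : Fin n → Fin k → ℤ) → ∑ (λ i → ∑ (f i)) ≡ ∑ (λ j → ∑ (λ i → f i j))
  ∑-swap {zero} {k} f = sym (∑-0 {k} (λ _ → refl))
  ∑-swap {suc n} f = trans (cong (λ s → ∑ (f zero) + s) (∑-swap (f ∘ suc)))
                           (sym (∑-+ (f zero) (λ j → ∑ (λ i → f (suc i) j))))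

∑-lincomb : ∀ {n} a c (f g : Fin n → ℤ) → ∑ (λ i → a * f i - c * g i) ≡ a * ∑ f - c * ∑ g
∑-lincomb a c f g = begin
  ∑ (λ i → a * f i - c * g i)               ≡⟨ ∑-cong (λ i → lem a c (f i) (g i)) ⟩
  ∑ (λ i → a * f i + (- c) * g i)           ≡⟨ ∑-+ (λ i → a * f i) (λ i → (- c) * g i) ⟩
  ∑ (λ i → a * f i) + ∑ (λ i → (- c) * g i) ≡⟨ cong₂ _+_ (∑-* a f) (∑-* (- c) g) ⟩
  a * ∑ f + (- c) * ∑ g                     ≡⟨ lem a c (∑ f) (∑ g) ⟨
  a * ∑ f - c * ∑ g                         ∎
  where
  open ≡-Reasoning
  lem : ∀ a c x y → a * x - c * y ≡ a * x + (- c) * y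
  lem = solve-∀

opaque
  unfolding ∑

  ∑-mono : ∀ {n} {f g : Fin n → ℤ} → (∀ i → f i ≤ g i) → ∑ f ≤ ∑ g
  ∑-mono {zero}  p = ℤₚ.≤-refl
  ∑-mono {suc n} p = ℤₚ.+-mono-≤ (p zero) (∑-mono (p ∘ suc))

opaque
  unfolding ∑

  ∑-nonneg : ∀ {n} {f : Fin n → ℤ} → (∀ i → 0ℤ ≤ f i) → 0ℤ ≤ ∑ f
  ∑-nonneg {zero}  p = ℤₚ.≤-refl
  ∑-nonneg {suc n} p = 0≤+ (p zero) (∑-nonneg (p ∘ suc))

opaque
  unfolding ∑

  ∑-delta : ∀ {n} (j : Fin n) (f : Fin n → ℤ) → ∑ (λ i → ⟦ i == j ⟧ * f i) ≡ f j
  ∑-delta {suc n} zero f =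
    trans (cong₂ _+_ (ℤₚ.*-identityˡ (f zero)) (∑-0 (λ i → ℤₚ.*-zeroˡ (f (suc i))))) (ℤₚ.+-identityʳ _)
  ∑-delta {suc n} (suc j) f =
    trans (cong₂ _+_ (ℤₚ.*-zeroˡ (f zero))
            (trans (∑-cong (λ i → cong (λ b → ⟦ b ⟧ * f (suc i)) (lem i))) (∑-delta j (f ∘ suc))))
          (ℤₚ.+-identityˡ _)
    where
    lem : ∀ i → suc i == suc j ≡ i == j
    lem i with i ≟ j
    ... | yes refl = refl
    ... | no _     = refl

∑-delta₁ : ∀ {n} (j : Fin n) → ∑ (λ i → ⟦ i == j ⟧) ≡ 1ℤ
∑-delta₁ j = trans (∑-cong (λ i → sym (ℤₚ.*-identityʳ _))) (∑-delta j (λ _ → 1ℤ))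

term≤∑ : ∀ {n} {f : Fin n → ℤ} → (∀ i → 0ℤ ≤ f i) → ∀ j → f j ≤ ∑ f
term≤∑ {f = f} p j = subst (_≤ ∑ f) (∑-delta j f) (∑-mono lem)
  where
  lem : ∀ i → ⟦ i == j ⟧ * f i ≤ f i
  lem i with i == j
  ... | true  = ℤₚ.≤-reflexive (ℤₚ.*-identityˡ (f i))
  ... | false = p i

opaque
  unfolding ∑

  ∑-pos : ∀ {n} (f : Fin n → ℤ) → 0ℤ < ∑ f → Σ (Fin n) λ i → 0ℤ < f i
  ∑-pos {zero}  f (ℤ.+<+ ())
  ∑-pos {suc n} f p with 0ℤ ℤₚ.<? f zero
  ... | yes q = zero , q
  ... | no ¬q = let i , r = ∑-pos (f ∘ suc) (ℤₚ.<-≤-trans p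
                              (subst (f zero + ∑ (f ∘ suc) ≤_) (ℤₚ.+-identityˡ _)
                                (ℤₚ.+-monoˡ-≤ (∑ (f ∘ suc)) (ℤₚ.≮⇒≥ ¬q))))
                in suc i , r

count : ∀ {n} → (Fin n → Bool) → ℕ
count {zero}  p = 0
count {suc n} p = (if p zero then 1 else 0) ℕ.+ count (p ∘ suc)

opaque
  unfolding ∑

  ∑-count : ∀ {n} (p : Fin n → Bool) → ∑ (λ i → ⟦ p i ⟧) ≡ + count p
  ∑-count {zero}  p = refl
  ∑-count {suc n} p with p zero
  ... | true  = cong (λ s → 1ℤ + s) (∑-count (p ∘ suc))
  ... | false = trans (ℤₚ.+-identityˡ _) (∑-count (p ∘ suc))

count-mono : ∀ {n} {p q : Fin n → Bool} → (∀ i → p i ≡ true → q i ≡ true) → count p ℕ.≤ count q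
count-mono {zero}  h = ℕ.z≤n
count-mono {suc n} {p} {q} h = ℕₚ.+-mono-≤ (lem (p zero) (q zero) (h zero)) (count-mono (h ∘ suc))
  where
  lem : ∀ a b → (a ≡ true → b ≡ true) → (if a then 1 else 0) ℕ.≤ (if b then 1 else 0)
  lem true  b     h = subst (λ b → 1 ℕ.≤ (if b then 1 else 0)) (sym (h refl)) ℕₚ.≤-refl
  lem false b     h = ℕ.z≤n

count-strict : ∀ {n} {p q : Fin n → Bool} → (∀ i → p i ≡ true → q i ≡ true) →
               ∀ j → p j ≡ false → q j ≡ true → count p ℕ.< count q
count-strict {suc n} {p} {q} h zero a b rewrite a | b = ℕ.s≤s (count-mono (h ∘ suc))
count-strict {suc n} {p} {q} h (suc j) a b =
  ℕₚ.≤-trans (ℕₚ.≤-reflexive (sym (ℕₚ.+-suc _ _)))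
    (ℕₚ.+-mono-≤ (lem (p zero) (q zero) (h zero)) (count-strict (h ∘ suc) j a b))
  where
  lem : ∀ a b → (a ≡ true → b ≡ true) → (if a then 1 else 0) ℕ.≤ (if b then 1 else 0)
  lem true  b     h = subst (λ b → 1 ℕ.≤ (if b then 1 else 0)) (sym (h refl)) ℕₚ.≤-refl
  lem false b     h = ℕ.z≤n

ExactlyOne : ∀ {n} → (Fin n → Bool) → Set
ExactlyOne {n} p = Σ (Fin n) (λ i → p i ≡ true) × (∀ i j → p i ≡ true → p j ≡ true → i ≡ j)

unique⇒∑ : ∀ {n} {p : Fin n → Bool} → ExactlyOne p → ∑ (λ i → ⟦ p i ⟧) ≡ 1ℤ
unique⇒∑ {p = p} ((j , pj) , u) = trans (∑-cong (λ i → cong ⟦_⟧ (lem i))) (∑-delta₁ j)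
  where
  lem : ∀ i → p i ≡ i == j
  lem i with i ≟ j
  ... | yes refl = pj
  ... | no i≢j   = ¬-not (λ pi → i≢j (u i j pi pj))

∑⇒unique : ∀ {n} {p : Fin n → Bool} → ∑ (λ i → ⟦ p i ⟧) ≡ 1ℤ → ExactlyOne p
∑⇒unique {p = p} s = (i₀ , ⟦⟧-pos pi₀) , u
  where
  ex = ∑-pos (λ i → ⟦ p i ⟧) (subst (0ℤ <_) (sym s) (ℤ.+<+ (ℕ.s≤s ℕ.z≤n)))
  i₀ = proj₁ ex
  pi₀ = proj₂ ex
  u : ∀ i j → p i ≡ true → p j ≡ true → i ≡ j
  u i j pi pj with i ≟ j
  ... | yes q = q
  ... | no i≢j = ⊥-elim (absurd (subst₂ _≤_
            (trans (∑-+ (λ k → ⟦ k == i ⟧) (λ k → ⟦ k == j ⟧)) (cong₂ _+_ (∑-delta₁ i) (∑-delta₁ j))) s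
            (∑-mono lem)))
    where
    absurd : 1ℤ + 1ℤ ≤ 1ℤ → ⊥
    absurd (ℤ.+≤+ (ℕ.s≤s ()))
    lem : ∀ k → ⟦ k == i ⟧ + ⟦ k == j ⟧ ≤ ⟦ p k ⟧
    lem k with k ≟ i | k ≟ j
    ... | yes refl | yes refl = ⊥-elim (i≢j refl)
    ... | yes refl | no _     rewrite pi = ℤₚ.≤-refl
    ... | no _     | yes refl rewrite pj = ℤₚ.≤-refl
    ... | no _     | no _     = 0≤⟦⟧ (p k)

opaque
  unfolding ⨁

  ⨁-cong : ∀ {n} {f g : Fin n → Bool} → (∀ i → f i ≡ g i) → ⨁ f ≡ ⨁ g
  ⨁-cong {zero}  p = refl
  ⨁-cong {suc n} p = cong₂ _xor_ (p zero) (⨁-cong (p ∘ suc))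

opaque
  unfolding ⨁

  ⨁-false : ∀ {n} {f : Fin n → Bool} → (∀ i → f i ≡ false) → ⨁ f ≡ false
  ⨁-false {zero}  p = refl
  ⨁-false {suc n} p = cong₂ _xor_ (p zero) (⨁-false (p ∘ suc))

xor-interchange : ∀ a b c d → (a xor b) xor (c xor d) ≡ (a xor c) xor (b xor d)
xor-interchange true  true  c d = sym (Boolₚ.xor-annihilates-not c d)
xor-interchange true  false c d = Boolₚ.not-distribˡ-xor c d
xor-interchange false true  c d = Boolₚ.not-distribʳ-xor c d
xor-interchange false false c d = refl

opaque
  unfolding ⨁

  ⨁-xor : ∀ {n} (f g : Fin n → Bool) → ⨁ (λ i → f i xor g i) ≡ ⨁ f xor ⨁ g
  ⨁-xor {zero}  f g = refl
  ⨁-xor {suc n} f g = trans (cong ((f zero xor g zero) xor_) (⨁-xor (f ∘ suc) (g ∘ suc)))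
                            (xor-interchange (f zero) (g zero) (⨁ (f ∘ suc)) (⨁ (g ∘ suc)))

opaque
  unfolding ⨁

  ⨁-swap : ∀ {n k} (f : Fin n → Fin k → Bool) → ⨁ (λ i → ⨁ (f i)) ≡ ⨁ (λ j → ⨁ (λ i → f i j))
  ⨁-swap {zero} {k} f = sym (⨁-false {k} (λ _ → refl))
  ⨁-swap {suc n} f = trans (cong (⨁ (f zero) xor_) (⨁-swap (f ∘ suc)))
                           (sym (⨁-xor (f zero) (λ j → ⨁ (λ i → f (suc i) j))))

⨁-∧ : ∀ {n} b (f : Fin n → Bool) → ⨁ (λ i → b ∧ f i) ≡ b ∧ ⨁ f
⨁-∧ true  f = refl
⨁-∧ false f = ⨁-false (λ _ → refl)

opaque
  unfolding ⨁

  ⨁-delta : ∀ {n} (j : Fin n) (f : Fin n → Bool) → ⨁ (λ i → (i == j) ∧ f i) ≡ f j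
  ⨁-delta {suc n} zero f = trans (cong (f zero xor_) (⨁-false {n} (λ _ → refl))) (Boolₚ.xor-identityʳ _)
  ⨁-delta {suc n} (suc j) f = trans (⨁-cong (λ i → cong (_∧ f (suc i)) (lem i))) (⨁-delta j (f ∘ suc))
    where
    lem : ∀ i → suc i == suc j ≡ i == j
    lem i with i ≟ j
    ... | yes refl = refl
    ... | no _     = refl

opaque
  unfolding ⨁

  ⨁-true : ∀ {n} (f : Fin n → Bool) → ⨁ f ≡ true → Σ (Fin n) λ i → f i ≡ true
  ⨁-true {suc n} f p with f zero in eq
  ... | true  = zero , eq
  ... | false = let i , q = ⨁-true (f ∘ suc) p in suc i , q

∑-parity : ∀ {n} (p : Fin n → Bool) → ∑ (λ i → ⟦ p i ⟧) ≡ 1ℤ → ⨁ p ≡ true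
∑-parity p s with ∑⇒unique {p = p} s
... | (j , pj) , u = trans (⨁-cong lem) (trans (⨁-delta j (λ _ → true)) refl)
  where
  lem : ∀ i → p i ≡ (i == j) ∧ true
  lem i with i ≟ j
  ... | yes refl = pj
  ... | no i≢j   = ¬-not (λ pi → i≢j (u i j pi pj))

-- Cuts and perfect matchings

==-comm : ∀ {n} (i j : Fin n) → i == j ≡ j == i
==-comm i j with i ≟ j
... | yes refl = sym (==-refl i)
... | no i≢j   = sym (≢⇒== (i≢j ∘ sym))

-- A graph on the vertices v with alive v ≡ true.  Contracting a vertex set keeps
-- the index types and turns edges into loops, which no cut and no matching sees.
record Net (n m : ℕ) : Set where
  field
    alive     : Fin n → Bool
    src tgt   : Fin m → Fin n
    src-alive : ∀ e → alive (src e) ≡ true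
    tgt-alive : ∀ e → alive (tgt e) ≡ true

module _ {n m : ℕ} (G : Net n m) where
  open Net G

  cross : (Fin n → Bool) → Fin m → Bool
  cross U e = U (src e) xor U (tgt e)

  -- Incidence is crossing of a singleton, so that degrees are cuts and a loop is incident with no
  -- vertex.
  inc : Fin m → Fin n → Bool
  inc e v = cross (_== v) e

  cut : (Fin n → Bool) → (Fin m → ℤ) → ℤ
  cut U x = ∑ (λ e → ⟦ cross U e ⟧ * x e)

  deg : Fin n → (Fin m → ℤ) → ℤ
  deg v = cut (_== v)

  Odd : (Fin n → Bool) → Set
  Odd U = ⨁ (λ v → alive v ∧ U v) ≡ true

  -- Degrees do not see loops, which therefore have to be excluded by a field of their own.
  record IsPM (M : Fin m → Bool) : Set where
    constructor isPM
    field
      noloop : ∀ e → M e ≡ true → src e ≢ tgt e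
      deg≡1  : ∀ v → alive v ≡ true → deg v (⟦_⟧ ∘ M) ≡ 1ℤ

  PM : Set
  PM = Σ (Fin m → Bool) IsPM

  cross-cong : ∀ {U W} → (∀ v → alive v ≡ true → U v ≡ W v) → ∀ e → cross U e ≡ cross W e
  cross-cong h e = cong₂ _xor_ (h _ (src-alive e)) (h _ (tgt-alive e))

  cut-cong : ∀ {U W} {x y : Fin m → ℤ} → (∀ v → alive v ≡ true → U v ≡ W v) →
             (∀ e → cross U e ≡ true → x e ≡ y e) → cut U x ≡ cut W y
  cut-cong {U} {W} {x} {y} h k = ∑-cong λ e → lem e (cross U e) refl
    where
    lem : ∀ e b → cross U e ≡ b → ⟦ cross U e ⟧ * x e ≡ ⟦ cross W e ⟧ * y e
    lem e true  q rewrite sym (cross-cong h e) | q = cong (1ℤ *_) (k e q)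
    lem e false q rewrite sym (cross-cong h e) | q = trans (ℤₚ.*-zeroˡ (x e)) (sym (ℤₚ.*-zeroˡ (y e)))

  cut-congʳ : ∀ {U} {x y : Fin m → ℤ} → (∀ e → x e ≡ y e) → cut U x ≡ cut U y
  cut-congʳ {U} {x} {y} k = cut-cong {U} {U} {x} {y} (λ _ _ → refl) (λ e _ → k e)

  cut-lincomb : ∀ U a c (x y : Fin m → ℤ) → cut U (λ e → a * x e - c * y e) ≡ a * cut U x - c * cut U y
  cut-lincomb U a c x y = trans (∑-cong (λ e → lem ⟦ cross U e ⟧ a c (x e) (y e)))
    (∑-lincomb a c (λ e → ⟦ cross U e ⟧ * x e) (λ e → ⟦ cross U e ⟧ * y e))
    where
    lem : ∀ z a c x y → z * (a * x - c * y) ≡ a * (z * x) - c * (z * y)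
    lem = solve-∀

  cut-+ : ∀ U (x y : Fin m → ℤ) → cut U (λ e → x e + y e) ≡ cut U x + cut U y
  cut-+ U x y = trans (∑-cong (λ e → ℤₚ.*-distribˡ-+ ⟦ cross U e ⟧ (x e) (y e)))
                      (∑-+ (λ e → ⟦ cross U e ⟧ * x e) (λ e → ⟦ cross U e ⟧ * y e))

  cut-* : ∀ U a (x : Fin m → ℤ) → cut U (λ e → a * x e) ≡ a * cut U x
  cut-* U a x = trans (∑-cong (λ e → lem ⟦ cross U e ⟧ a (x e))) (∑-* a (λ e → ⟦ cross U e ⟧ * x e))
    where
    lem : ∀ z a x → z * (a * x) ≡ a * (z * x)
    lem = solve-∀

  cut-0 : ∀ U → cut U (λ _ → 0ℤ) ≡ 0ℤ
  cut-0 U = ∑-0 (λ e → ℤₚ.*-zeroʳ ⟦ cross U e ⟧)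

  cross-∁ : ∀ U e → cross (not ∘ U) e ≡ cross U e
  cross-∁ U e = Boolₚ.xor-annihilates-not (U (src e)) (U (tgt e))

  cut-∁ : ∀ U x → cut (not ∘ U) x ≡ cut U x
  cut-∁ U x = ∑-cong (λ e → cong (λ b → ⟦ b ⟧ * x e) (cross-∁ U e))

  edge≤cut : ∀ U {x : Fin m → ℤ} → (∀ e → 0ℤ ≤ x e) → ∀ e → cross U e ≡ true → x e ≤ cut U x
  edge≤cut U {x} p e c = subst (_≤ cut U x) (trans (cong (λ b → ⟦ b ⟧ * x e) c) (ℤₚ.*-identityˡ (x e)))
    (term≤∑ {f = λ e → ⟦ cross U e ⟧ * x e} (λ e → 0≤* (0≤⟦⟧ (cross U e)) (p e)) e)

  odd-cong : ∀ {U W} → (∀ v → alive v ≡ true → U v ≡ W v) → Odd U → Odd W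
  odd-cong {U} {W} h = trans (⨁-cong (λ v → lem (alive v) (h v)))
    where
    lem : ∀ {u w} a → (a ≡ true → u ≡ w) → a ∧ w ≡ a ∧ u
    lem true  k = sym (k refl)
    lem false k = refl

  odd-∁ : ∀ {U} → ⨁ alive ≡ false → Odd U → Odd (not ∘ U)
  odd-∁ {U} even o = begin
    ⨁ (λ v → alive v ∧ not (U v))                              ≡⟨ ⨁-cong (λ v → lem (alive v) (U v)) ⟩
    ⨁ (λ v → alive v xor (alive v ∧ U v))                      ≡⟨ ⨁-xor alive (λ v → alive v ∧ U v) ⟩
    ⨁ alive xor ⨁ (λ v → alive v ∧ U v)                        ≡⟨ cong₂ _xor_ even o ⟩
    true                                                       ∎
    where
    open ≡-Reasoning
    lem : ∀ a u → a ∧ not u ≡ a xor (a ∧ u)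
    lem true  u = refl
    lem false u = refl

  inc⇒end : ∀ e v → inc e v ≡ true → src e ≡ v ⊎ tgt e ≡ v
  inc⇒end e v p with src e ≟ v | tgt e ≟ v
  ... | yes q | _     = inj₁ q
  ... | no _  | yes q = inj₂ q
  inc⇒end e v () | no _ | no _

  inc-alive : ∀ e v → inc e v ≡ true → alive v ≡ true
  inc-alive e v p with inc⇒end e v p
  ... | inj₁ refl = src-alive e
  ... | inj₂ refl = tgt-alive e

  inc-noloop : ∀ e v → inc e v ≡ true → src e ≢ tgt e
  inc-noloop e v p q = true≢false p (trans (cong (λ u → (u == v) xor (tgt e == v)) q) (Boolₚ.xor-same (tgt e == v)))

  inc-src : ∀ e → src e ≢ tgt e → inc e (src e) ≡ true
  inc-src e ne rewrite ==-refl (src e) | ≢⇒== {i = tgt e} {src e} (ne ∘ sym) = refl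

  inc-tgt : ∀ e → src e ≢ tgt e → inc e (tgt e) ≡ true
  inc-tgt e ne rewrite ==-refl (tgt e) | ≢⇒== {i = src e} {tgt e} ne = refl

  ⟦∧⟧ : ∀ a b → ⟦ a ∧ b ⟧ ≡ ⟦ a ⟧ * ⟦ b ⟧
  ⟦∧⟧ true  b = sym (ℤₚ.*-identityˡ ⟦ b ⟧)
  ⟦∧⟧ false b = sym (ℤₚ.*-zeroˡ ⟦ b ⟧)

  cut-count : ∀ U (M : Fin m → Bool) → cut U (⟦_⟧ ∘ M) ≡ ∑ (λ e → ⟦ cross U e ∧ M e ⟧)
  cut-count U M = ∑-cong (λ e → sym (⟦∧⟧ (cross U e) (M e)))

  -- Handshake modulo 2: the sum of the degrees of M over U counts each edge inside U twice, so that
  -- M ∩ δ(U) has the parity of U.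
  pm-odd-cut : ∀ {M} → IsPM M → ∀ {U} → Odd U → Σ (Fin m) λ e → cross U e ∧ M e ≡ true
  pm-odd-cut {M} pm {U} o = ⨁-true (λ e → cross U e ∧ M e) (trans (sym handshake) o)
    where
    open IsPM pm
    degree : ∀ v → ⨁ (λ e → inc e v ∧ M e) ≡ alive v
    degree v with alive v in a
    ... | true  = ∑-parity (λ e → inc e v ∧ M e) (trans (sym (cut-count (_== v) M)) (deg≡1 v a))
    ... | false = ⨁-false (λ e → cong (_∧ M e) (¬-not (λ i → true≢false (inc-alive e v i) a)))
    ends : ∀ e → ⨁ (λ v → U v ∧ inc e v) ≡ cross U e
    ends e = begin
      ⨁ (λ v → U v ∧ inc e v)
        ≡⟨ ⨁-cong (λ v → trans (Boolₚ.∧-distribˡ-xor (U v) _ _)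
             (cong₂ _xor_ (trans (Boolₚ.∧-comm (U v) _) (cong (_∧ U v) (==-comm (src e) v)))
                          (trans (Boolₚ.∧-comm (U v) _) (cong (_∧ U v) (==-comm (tgt e) v))))) ⟩
      ⨁ (λ v → ((v == src e) ∧ U v) xor ((v == tgt e) ∧ U v))
        ≡⟨ ⨁-xor (λ v → (v == src e) ∧ U v) (λ v → (v == tgt e) ∧ U v) ⟩
      ⨁ (λ v → (v == src e) ∧ U v) xor ⨁ (λ v → (v == tgt e) ∧ U v)
        ≡⟨ cong₂ _xor_ (⨁-delta (src e) U) (⨁-delta (tgt e) U) ⟩
      cross U e ∎
      where open ≡-Reasoning
    handshake : ⨁ (λ v → alive v ∧ U v) ≡ ⨁ (λ e → cross U e ∧ M e)
    handshake = begin
      ⨁ (λ v → alive v ∧ U v)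
        ≡⟨ ⨁-cong (λ v → trans (Boolₚ.∧-comm (alive v) (U v)) (trans (cong (U v ∧_) (sym (degree v)))
             (sym (⨁-∧ (U v) (λ e → inc e v ∧ M e))))) ⟩
      ⨁ (λ v → ⨁ (λ e → U v ∧ (inc e v ∧ M e)))
        ≡⟨ ⨁-swap (λ v e → U v ∧ (inc e v ∧ M e)) ⟩
      ⨁ (λ e → ⨁ (λ v → U v ∧ (inc e v ∧ M e)))
        ≡⟨ ⨁-cong (λ e → trans (⨁-cong (λ v → trans (sym (Boolₚ.∧-assoc (U v) _ _)) (Boolₚ.∧-comm _ (M e))))
             (trans (⨁-∧ (M e) (λ v → U v ∧ inc e v)) (trans (cong (M e ∧_) (ends e)) (Boolₚ.∧-comm (M e) _)))) ⟩
      ⨁ (λ e → cross U e ∧ M e) ∎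
      where open ≡-Reasoning

  pm-odd-cut≥1 : ∀ {M} → IsPM M → ∀ {U} → Odd U → 1ℤ ≤ cut U (⟦_⟧ ∘ M)
  pm-odd-cut≥1 {M} pm {U} o with pm-odd-cut pm {U} o
  ... | e , p = subst (_≤ cut U (⟦_⟧ ∘ M)) (cong ⟦_⟧ (∧-true₂ (cross U e) p))
                  (edge≤cut U (λ e → 0≤⟦⟧ (M e)) e (∧-true₁ p))
    where
    ∧-true₁ : ∀ {a b} → a ∧ b ≡ true → a ≡ true
    ∧-true₁ {true} _ = refl
    ∧-true₂ : ∀ a {b} → a ∧ b ≡ true → b ≡ true
    ∧-true₂ true p = p

  -- Dyadic combinations of perfect matchings

  total : List PM → Fin m → ℤ
  total []            e = 0ℤ
  total ((M , _) ∷ L) e = ⟦ M e ⟧ + total L e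

  -- Membership in the dyadic cone of the perfect matchings, with a common denominator 2ᵏ.
  Dy : (Fin m → ℤ) → Set
  Dy x = Σ ℕ λ k → Σ (List PM) λ L → ∀ e → + (2 ^ k) * x e ≡ total L e

  total-++ : ∀ L L′ e → total (L ++ L′) e ≡ total L e + total L′ e
  total-++ []            L′ e = sym (ℤₚ.+-identityˡ _)
  total-++ ((M , _) ∷ L) L′ e = trans (cong (λ s → ⟦ M e ⟧ + s) (total-++ L L′ e)) (sym (ℤₚ.+-assoc ⟦ M e ⟧ _ _))

  copies : ℕ → List PM → List PM
  copies zero    L = []
  copies (suc c) L = L ++ copies c L

  total-copies : ∀ c L e → total (copies c L) e ≡ + c * total L e
  total-copies zero    L e = sym (ℤₚ.*-zeroˡ (total L e))
  total-copies (suc c) L e = begin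
    total (L ++ copies c L) e         ≡⟨ total-++ L (copies c L) e ⟩
    total L e + total (copies c L) e  ≡⟨ cong (λ s → total L e + s) (total-copies c L e) ⟩
    total L e + + c * total L e       ≡⟨ lem (+ c) (total L e) ⟩
    (1ℤ + + c) * total L e            ∎
    where
    open ≡-Reasoning
    lem : ∀ c t → t + c * t ≡ (1ℤ + c) * t
    lem = solve-∀

  total-nonneg : ∀ L e → 0ℤ ≤ total L e
  total-nonneg []            e = ℤₚ.≤-refl
  total-nonneg ((M , _) ∷ L) e = 0≤+ (0≤⟦⟧ (M e)) (total-nonneg L e)

  dy-ext : ∀ {x y} → (∀ e → x e ≡ y e) → Dy x → Dy y
  dy-ext h (k , L , p) = k , L , λ e → trans (cong (+ (2 ^ k) *_) (sym (h e))) (p e)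

  dy-0 : ∀ {x} → (∀ e → x e ≡ 0ℤ) → Dy x
  dy-0 h = 0 , [] , λ e → trans (ℤₚ.*-identityˡ _) (h e)

  dy-pm : (M : PM) → Dy (⟦_⟧ ∘ proj₁ M)
  dy-pm M = 0 , M ∷ [] , λ e → trans (ℤₚ.*-identityˡ _) (sym (ℤₚ.+-identityʳ _))

  2^+ : ∀ k l → + (2 ^ (k ℕ.+ l)) ≡ + (2 ^ k) * + (2 ^ l)
  2^+ k l = trans (cong +_ (ℕₚ.^-distribˡ-+-* 2 k l)) (ℤₚ.pos-* (2 ^ k) (2 ^ l))

  dy-+ : ∀ {x y} → Dy x → Dy y → Dy (λ e → x e + y e)
  dy-+ {x} {y} (k , L , p) (l , L′ , q) = k ℕ.+ l , copies (2 ^ l) L ++ copies (2 ^ k) L′ , λ e → begin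
    + (2 ^ (k ℕ.+ l)) * (x e + y e)                   ≡⟨ cong (_* (x e + y e)) (2^+ k l) ⟩
    + (2 ^ k) * + (2 ^ l) * (x e + y e)               ≡⟨ lem (+ (2 ^ k)) (+ (2 ^ l)) (x e) (y e) ⟩
    + (2 ^ l) * (+ (2 ^ k) * x e) + + (2 ^ k) * (+ (2 ^ l) * y e)
      ≡⟨ cong₂ (λ a b → + (2 ^ l) * a + + (2 ^ k) * b) (p e) (q e) ⟩
    + (2 ^ l) * total L e + + (2 ^ k) * total L′ e
      ≡⟨ cong₂ _+_ (total-copies (2 ^ l) L e) (total-copies (2 ^ k) L′ e) ⟨
    total (copies (2 ^ l) L) e + total (copies (2 ^ k) L′) e
      ≡⟨ total-++ (copies (2 ^ l) L) (copies (2 ^ k) L′) e ⟨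
    total (copies (2 ^ l) L ++ copies (2 ^ k) L′) e   ∎
    where
    open ≡-Reasoning
    lem : ∀ a b x y → a * b * (x + y) ≡ b * (a * x) + a * (b * y)
    lem = solve-∀

  dy-ℕ* : ∀ c {x} → Dy x → Dy (λ e → + c * x e)
  dy-ℕ* c {x} (k , L , p) = k , copies c L , λ e →
    trans (lem (+ (2 ^ k)) (+ c) (x e)) (trans (cong (+ c *_) (p e)) (sym (total-copies c L e)))
    where
    lem : ∀ a c x → a * (c * x) ≡ c * (a * x)
    lem = solve-∀

  dy-* : ∀ {c} → 0ℤ ≤ c → ∀ {x} → Dy x → Dy (λ e → c * x e)
  dy-* {+ c}       _ = dy-ℕ* c

  dy-/2^ : ∀ j {x} → Dy (λ e → + (2 ^ j) * x e) → Dy x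
  dy-/2^ j {x} (k , L , p) = k ℕ.+ j , L , λ e →
    trans (cong (_* x e) (2^+ k j)) (trans (ℤₚ.*-assoc (+ (2 ^ k)) _ _) (p e))

  lsum : (PM → ℤ) → List PM → ℤ
  lsum f []      = 0ℤ
  lsum f (M ∷ L) = f M + lsum f L

  cut-total : ∀ U L → cut U (total L) ≡ lsum (λ M → cut U (⟦_⟧ ∘ proj₁ M)) L
  cut-total U []      = cut-0 U
  cut-total U (M ∷ L) = trans (cut-+ U (⟦_⟧ ∘ proj₁ M) (total L)) (cong (λ s → cut U (⟦_⟧ ∘ proj₁ M) + s) (cut-total U L))

  -- Each gap `g M - f M` is at most the sum of all gaps, which is 0. This is the source of
  -- complementary slackness in `tight⇒1`.
  lsum-equal : ∀ {f g : PM → ℤ} L → (∀ M → f M ≤ g M) → lsum f L ≡ lsum g L → ∀ {M} → M ∈ L → f M ≡ g M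
  lsum-equal {f} {g} L h q {M} M∈ =
    ℤₚ.≤-antisym (h M) (diff (neg (ℤₚ.≤-trans (gap L M∈) (ℤₚ.≤-reflexive (ℤₚ.i≡j⇒i-j≡0 (sym q))))))
    where
    neg : ∀ {M} → g M - f M ≤ 0ℤ → 0ℤ ≤ f M - g M
    neg {M} p = subst (0ℤ ≤_) (lem (f M) (g M)) (undiff p)
      where
      lem : ∀ a b → 0ℤ - (b - a) ≡ a - b
      lem = solve-∀
    all≤ : ∀ L → lsum f L ≤ lsum g L
    all≤ []      = ℤₚ.≤-refl
    all≤ (N ∷ L) = ℤₚ.+-mono-≤ (h N) (all≤ L)
    gap : ∀ L {M} → M ∈ L → g M - f M ≤ lsum g L - lsum f L
    gap (N ∷ L) (here refl) = diff (subst (0ℤ ≤_) (lem (g N) (f N) (lsum g L) (lsum f L)) (undiff (all≤ L)))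
      where
      lem : ∀ a b c d → c - d ≡ (a + c) - (b + d) - (a - b)
      lem = solve-∀
    gap (N ∷ L) {M} (there p) = ℤₚ.≤-trans (gap L p)
      (diff (subst (0ℤ ≤_) (lem (g N) (f N) (lsum g L) (lsum f L)) (undiff (h N))))
      where
      lem : ∀ a b c d → a - b ≡ (a + c) - (b + d) - (c - d)
      lem = solve-∀

  total-∈ : ∀ L {M e} → M ∈ L → proj₁ M e ≡ true → 0ℤ < total L e
  total-∈ (N ∷ L) {e = e} (here refl) p rewrite p = ℤₚ.<-≤-trans (ℤ.+<+ (ℕ.s≤s ℕ.z≤n))
    (subst (_≤ 1ℤ + total L e) (ℤₚ.+-identityʳ 1ℤ) (ℤₚ.+-monoʳ-≤ 1ℤ (total-nonneg L e)))
  total-∈ (N ∷ L) {e = e} (there q) p = ℤₚ.<-≤-trans (total-∈ L q p)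
    (subst (_≤ ⟦ proj₁ N e ⟧ + total L e) (ℤₚ.+-identityˡ _) (ℤₚ.+-monoˡ-≤ (total L e) (0≤⟦⟧ (proj₁ N e))))

  total-pos : ∀ L {e} → 0ℤ < total L e → Σ PM λ M → M ∈ L × proj₁ M e ≡ true
  total-pos [] (ℤ.+<+ ())
  total-pos (N ∷ L) {e} p with proj₁ N e in q
  ... | true  = N , here refl , q
  ... | false = let M , i , r = total-pos L (subst (0ℤ <_) (ℤₚ.+-identityˡ _) p) in M , there i , r

2^-pos : ∀ k → 0ℤ < + (2 ^ k)
2^-pos k = ℤ.+<+ (ℕₚ.m^n>0 2 k)

*-pos⁻¹ : ∀ {a b} → 0ℤ < a → 0ℤ < a * b → 0ℤ < b
*-pos⁻¹ {a} {b} p q = ℤₚ.*-cancelˡ-<-nonNeg a {{ℤ.nonNegative (ℤₚ.<⇒≤ p)}} (subst (_< a * b) (sym (ℤₚ.*-zeroʳ a)) q)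

-- Switching along alternating paths

∧-intro : ∀ {a b} → a ≡ true → b ≡ true → a ∧ b ≡ true
∧-intro refl refl = refl

∧-elimˡ : ∀ {a b} → a ∧ b ≡ true → a ≡ true
∧-elimˡ {true} _ = refl

∧-elimʳ : ∀ a {b} → a ∧ b ≡ true → b ≡ true
∧-elimʳ true p = p

-- Written as a sum modulo 2, so that cuts change by `inc`; it is a removal only if u lies in U.
remove : ∀ {n} → (Fin n → Bool) → Fin n → Fin n → Bool
remove U u v = U v xor (v == u)

remove-⊆ : ∀ {n} {U : Fin n → Bool} {u v} → U u ≡ true → remove U u v ≡ true → U v ≡ true
remove-⊆ {u = u} {v} Uu p with v ≟ u
... | yes refl = Uu
... | no _     = trans (sym (Boolₚ.xor-identityʳ _)) p

remove-≢ : ∀ {n} {U : Fin n → Bool} {u v} → U u ≡ true → remove U u v ≡ true → v ≢ u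
remove-≢ {u = u} Uu p refl rewrite Uu | ==-refl u = true≢false refl (sym p)

remove-true : ∀ {n} {U : Fin n → Bool} {u v} → U v ≡ true → v ≢ u → remove U u v ≡ true
remove-true Uv v≢u rewrite Uv | ≢⇒== v≢u = refl

module _ {n m : ℕ} (G : Net n m) where
  open Net G

  cross⇒end : ∀ {U e} → cross G U e ≡ true → Σ (Fin n) λ u → U u ≡ true × inc G e u ≡ true
  cross⇒end {U} {e} p with U (src e) in a | U (tgt e) in b
  ... | true  | false = src e , a , inc-src G e (λ q → true≢false a (trans (cong U q) b))
  ... | false | true  = tgt e , b , inc-tgt G e (λ q → true≢false b (trans (cong U (sym q)) a))
  cross⇒end () | true | true
  cross⇒end () | false | false

  two-ends : ∀ {U e u v} → inc G e u ≡ true → inc G e v ≡ true → u ≢ v → cross G U e ≡ U u xor U v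
  two-ends {U} {e} {u} {v} p q u≢v with inc⇒end G e u p | inc⇒end G e v q
  ... | inj₁ refl | inj₁ refl = ⊥-elim (u≢v refl)
  ... | inj₁ refl | inj₂ refl = refl
  ... | inj₂ refl | inj₁ refl = Boolₚ.xor-comm (U v) (U u)
  ... | inj₂ refl | inj₂ refl = ⊥-elim (u≢v refl)

  cross⇒one-end : ∀ {U e u v} → cross G U e ≡ true → U u ≡ true → U v ≡ true →
                  inc G e u ≡ true → v ≢ u → inc G e v ≡ false
  cross⇒one-end {U} {e} {u} {v} c Uu Uv i v≢u = ¬-not λ j → true≢false c
    (trans (two-ends {U} i j (v≢u ∘ sym)) (cong₂ _xor_ Uu Uv))

  cross-remove : ∀ U u e → cross G (remove U u) e ≡ cross G U e xor inc G e u
  cross-remove U u e = xor-interchange (U (src e)) (src e == u) (U (tgt e)) (tgt e == u)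

  -- Only the edges that meet U are constrained. Any number of them may leave U, and the set of
  -- those that do is the object of the exchange argument.
  Saturates : (Fin n → Bool) → (Fin m → Bool) → Set
  Saturates U f = ∀ v → alive v ≡ true → U v ≡ true → ExactlyOne (λ e → inc G e v ∧ f e)

  sat-unique : ∀ {U f v e e′} → Saturates U f → alive v ≡ true → U v ≡ true →
               inc G e v ≡ true → f e ≡ true → inc G e′ v ≡ true → f e′ ≡ true → e ≡ e′
  sat-unique s a Uv i fe i′ fe′ = proj₂ (s _ a Uv) _ _ (∧-intro i fe) (∧-intro i′ fe′)

  -- Two matchings that saturate U, one of which uses the boundary edge e, are switched
  -- along the alternating path in U that starts with e and ends with the boundary edge e′.
  record Switch (U : Fin n → Bool) (f g : Fin m → Bool) (e : Fin m) : Set where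
    field
      e′         : Fin m
      cross-e′   : cross G U e′ ≡ true
      e′≢e       : e′ ≢ e
      differ     : g e′ ≡ not (f e′)
      f′ g′      : Fin m → Bool
      sat-f      : Saturates U f′
      sat-g      : Saturates U g′
      flip-f     : ∀ x → cross G U x ≡ true → f′ x ≡ f x xor ((x == e) xor (x == e′))
      flip-g     : ∀ x → cross G U x ≡ true → g′ x ≡ g x xor ((x == e) xor (x == e′))
      away-f     : ∀ x → (∀ v → U v ≡ true → inc G x v ≡ false) → f′ x ≡ f x
      away-g     : ∀ x → (∀ v → U v ≡ true → inc G x v ≡ false) → g′ x ≡ g x
      supp-f     : ∀ x → f′ x ≡ true → f x ≡ true ⊎ g x ≡ true
      supp-g     : ∀ x → g′ x ≡ true → f x ≡ true ⊎ g x ≡ true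

  sat-at : ∀ {U u h} → (a : Fin m) → inc G a u ≡ true → h a ≡ true →
           (∀ x → inc G x u ≡ true → h x ≡ true → x ≡ a) →
           (∀ v → alive v ≡ true → U v ≡ true → v ≢ u → ExactlyOne (λ e → inc G e v ∧ h e)) →
           Saturates U h
  sat-at {u = u} {h} a i q only others v av Uv with v ≟ u
  ... | no v≢u   = others v av Uv v≢u
  ... | yes refl = (a , ∧-intro i q) ,
    λ x y p r → trans (only x (∧-elimˡ p) (∧-elimʳ (inc G x u) p)) (sym (only y (∧-elimˡ r) (∧-elimʳ (inc G y u) r)))

  unique-cong : ∀ {v} {h h′ : Fin m → Bool} → (∀ e → inc G e v ≡ true → h e ≡ h′ e) →
                ExactlyOne (λ e → inc G e v ∧ h e) → ExactlyOne (λ e → inc G e v ∧ h′ e)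
  unique-cong {v} {h} {h′} k ((a , p) , u) = (a , trans (sym (eq a)) p) , λ x y q r → u x y (trans (eq x) q) (trans (eq y) r)
    where
    eq : ∀ e → inc G e v ∧ h e ≡ inc G e v ∧ h′ e
    eq e with inc G e v in i
    ... | true  = k e i
    ... | false = refl

  -- Induction on U: the path leaves e at its end u in U, and continues in U without u.
  CanSwitch : (Fin n → Bool) → Set
  CanSwitch U = ∀ f g → Saturates U f → Saturates U g →
                ∀ e → cross G U e ≡ true → f e ≡ true → g e ≡ false → Switch U f g e

  switch-step : ∀ U → (∀ U′ → count U′ ℕ.< count U → CanSwitch U′) → CanSwitch U
  switch-step U ih f g sf sg e ce fe ge with cross⇒end {U} ce
  ... | u , Uu , iu with proj₁ (sg u (inc-alive G e u iu) Uu)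
  ... | e₁ , p₁ = go (cross G U e₁) refl
    where
    au : alive u ≡ true
    au = inc-alive G e u iu
    i₁ : inc G e₁ u ≡ true
    i₁ = ∧-elimˡ p₁
    ge₁ : g e₁ ≡ true
    ge₁ = ∧-elimʳ (inc G e₁ u) p₁
    only-e : ∀ x → inc G x u ≡ true → f x ≡ true → x ≡ e
    only-e x i q = sat-unique sf au Uu i q iu fe
    only-e₁ : ∀ x → inc G x u ≡ true → g x ≡ true → x ≡ e₁
    only-e₁ x i q = sat-unique sg au Uu i q i₁ ge₁
    e₁≢e : e₁ ≢ e
    e₁≢e q = true≢false ge₁ (trans (cong g q) ge)
    fe₁ : f e₁ ≡ false
    fe₁ = ¬-not λ q → e₁≢e (only-e e₁ i₁ q)
    not-at : ∀ {x v} a → cross G U a ≡ true → inc G a u ≡ true → U v ≡ true → v ≢ u → inc G x v ≡ true → x ≢ a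
    not-at a ca ia Uv v≢u ix refl = true≢false ix (cross⇒one-end {U} ca Uu Uv ia v≢u)

    go : ∀ b → cross G U e₁ ≡ b → Switch U f g e
    go true c₁ = record
      { e′ = e₁ ; cross-e′ = c₁ ; e′≢e = e₁≢e ; differ = trans ge₁ (cong not (sym fe₁))
      ; f′ = flp f ; g′ = flp g
      ; sat-f = sat-at e₁ i₁ (trans (flp-e₁ f) (cong not fe₁)) only-f (others sf)
      ; sat-g = sat-at e iu (trans (flp-e g) (cong not ge)) only-g (others sg)
      ; flip-f = λ _ _ → refl ; flip-g = λ _ _ → refl
      ; away-f = away f ; away-g = away g
      ; supp-f = λ x q → [ inj₁ , (λ r → [ (λ { refl → inj₁ fe }) , (λ { refl → inj₂ ge₁ }) ]′ r) ]′ (supp f x q)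
      ; supp-g = λ x q → [ inj₂ , (λ r → [ (λ { refl → inj₁ fe }) , (λ { refl → inj₂ ge₁ }) ]′ r) ]′ (supp g x q) }
      where
      flp : (Fin m → Bool) → Fin m → Bool
      flp h x = h x xor ((x == e) xor (x == e₁))
      flp-at : ∀ h x → x ≢ e → x ≢ e₁ → flp h x ≡ h x
      flp-at h x a b rewrite ≢⇒== a | ≢⇒== b = Boolₚ.xor-identityʳ (h x)
      flp-e : ∀ h → flp h e ≡ not (h e)
      flp-e h rewrite ==-refl e | ≢⇒== (e₁≢e ∘ sym) = Boolₚ.xor-comm (h e) true
      flp-e₁ : ∀ h → flp h e₁ ≡ not (h e₁)
      flp-e₁ h rewrite ==-refl e₁ | ≢⇒== e₁≢e = Boolₚ.xor-comm (h e₁) true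
      supp : ∀ h x → flp h x ≡ true → h x ≡ true ⊎ (x ≡ e ⊎ x ≡ e₁)
      supp h x q = by (x ≟ e) (x ≟ e₁)
        where
        by : Dec (x ≡ e) → Dec (x ≡ e₁) → h x ≡ true ⊎ (x ≡ e ⊎ x ≡ e₁)
        by (yes r) _       = inj₂ (inj₁ r)
        by (no _)  (yes r) = inj₂ (inj₂ r)
        by (no a)  (no b)  = inj₁ (trans (sym (flp-at h x a b)) q)
      only-f : ∀ x → inc G x u ≡ true → flp f x ≡ true → x ≡ e₁
      only-f x i q with supp f x q
      ... | inj₂ (inj₂ r)    = r
      ... | inj₂ (inj₁ refl) = ⊥-elim (true≢false q (trans (flp-e f) (cong not fe)))
      ... | inj₁ r with only-e x i r
      ...   | refl = ⊥-elim (true≢false q (trans (flp-e f) (cong not fe)))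
      only-g : ∀ x → inc G x u ≡ true → flp g x ≡ true → x ≡ e
      only-g x i q with supp g x q
      ... | inj₂ (inj₁ r)    = r
      ... | inj₂ (inj₂ refl) = ⊥-elim (true≢false q (trans (flp-e₁ g) (cong not ge₁)))
      ... | inj₁ r with only-e₁ x i r
      ...   | refl = ⊥-elim (true≢false q (trans (flp-e₁ g) (cong not ge₁)))
      others : ∀ {h} → Saturates U h → ∀ v → alive v ≡ true → U v ≡ true → v ≢ u → ExactlyOne (λ x → inc G x v ∧ flp h x)
      others {h} s v av Uv v≢u = unique-cong
        (λ x i → sym (flp-at h x (not-at e ce iu Uv v≢u i) (not-at e₁ c₁ i₁ Uv v≢u i))) (s v av Uv)
      away : ∀ h x → (∀ v → U v ≡ true → inc G x v ≡ false) → flp h x ≡ h x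
      away h x w = flp-at h x (λ { refl → true≢false iu (w u Uu) }) (λ { refl → true≢false i₁ (w u Uu) })
    -- The path goes on: `e₁` lies inside U, hence crosses U - u, and belongs to g but not to f. The
    -- induction hypothesis is applied with f and g exchanged.
    go false c₁ = recurse
      where
      U′ : Fin n → Bool
      U′ = remove U u
      U⊆ : ∀ {v} → U′ v ≡ true → U v ≡ true
      U⊆ = remove-⊆ {U = U} Uu
      smaller : count U′ ℕ.< count U
      smaller = count-strict (λ _ → U⊆) u (trans (cong (_xor (u == u)) Uu) (cong not (==-refl u))) Uu
      cross′ : ∀ x b → cross G U x ≡ b → ∀ c → inc G x u ≡ c → cross G U′ x ≡ b xor c
      cross′ x b p c q = trans (cross-remove U u x) (cong₂ _xor_ p q)
      recurse : Switch U f g e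
      recurse = record
        { e′ = e′ ; cross-e′ = ce′ ; e′≢e = e′≢e
        ; differ = trans (sym (Boolₚ.not-involutive (g e′))) (cong not (sym S.differ))
        ; f′ = F ; g′ = H
        ; sat-f = sat-at e₁ i₁ (trans (flp-≢ S.g′ e₁≢e) (trans (Sflip-f e₁ ce₁′) (trans (at-e₁ f) (cong not fe₁)))) only-F
                    (others S.sat-g)
        ; sat-g = sat-at e iu (trans (flp-e S.f′) (cong not (trans (S.away-f e away-e) ge))) only-H (others S.sat-f)
        ; flip-f = flip′ S.g′ f S.flip-g S.away-g ; flip-g = flip′ S.f′ g S.flip-f S.away-f
        ; away-f = away′ S.g′ f S.away-g ; away-g = away′ S.f′ g S.away-f
        ; supp-f = λ x q → supp S.g′ (λ r → [ inj₂ , inj₁ ]′ (S.supp-g x r)) q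
        ; supp-g = λ x q → supp S.f′ (λ r → [ inj₂ , inj₁ ]′ (S.supp-f x r)) q }
        where
        ce₁′ : cross G U′ e₁ ≡ true
        ce₁′ = cross′ e₁ false c₁ true i₁
        module S = Switch (ih U′ smaller g f
                            (λ v av U′v → sg v av (U⊆ U′v)) (λ v av U′v → sf v av (U⊆ U′v)) e₁ ce₁′ ge₁ fe₁)
        open S using (e′)
        Sflip-f : ∀ x → cross G U′ x ≡ true → S.g′ x ≡ f x xor ((x == e₁) xor (x == e′))
        Sflip-f = S.flip-g
        ce₀ : cross G U′ e ≡ false
        ce₀ = cross′ e true ce true iu
        e′≢e : e′ ≢ e
        e′≢e q = true≢false S.cross-e′ (trans (cong (cross G U′) q) ce₀)
        at-e₁ : ∀ h → h e₁ xor ((e₁ == e₁) xor (e₁ == e′)) ≡ not (h e₁)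
        at-e₁ h rewrite ==-refl e₁ | ≢⇒== (S.e′≢e ∘ sym) = Boolₚ.xor-comm (h e₁) true
        -- Exactly one of f and g contains `e′`, but at u they contain only e and `e₁`.
        e′-away : inc G e′ u ≡ false
        e′-away = ¬-not λ i → lem i (bool-cases (f e′))
          where
          lem : inc G e′ u ≡ true → f e′ ≡ true ⊎ f e′ ≡ false → ⊥
          lem i (inj₁ q) = e′≢e (only-e e′ i q)
          lem i (inj₂ q) = S.e′≢e (only-e₁ e′ i (trans (sym (Boolₚ.not-involutive _)) (cong not (trans (sym S.differ) q))))
        ce′ : cross G U e′ ≡ true
        ce′ = lem (bool-cases (cross G U e′))
          where
          lem : cross G U e′ ≡ true ⊎ cross G U e′ ≡ false → cross G U e′ ≡ true
          lem (inj₁ q) = q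
          lem (inj₂ q) = ⊥-elim (true≢false S.cross-e′ (cross′ e′ false q false e′-away))
        -- An edge at u that leaves U has no end in U′, so the switch inside U′ does not touch it.
        -- This is why `Switch` records what happens to edges away from U.
        outer : ∀ x → cross G U x ≡ true → inc G x u ≡ true → ∀ v → U′ v ≡ true → inc G x v ≡ false
        outer x c i v U′v = cross⇒one-end {U} c Uu (U⊆ U′v) i (remove-≢ {U = U} Uu U′v)
        away-e : ∀ v → U′ v ≡ true → inc G e v ≡ false
        away-e = outer e ce iu
        flp : (Fin m → Bool) → Fin m → Bool
        flp h x = h x xor (x == e)
        flp-≢ : ∀ h {x} → x ≢ e → flp h x ≡ h x
        flp-≢ h a rewrite ≢⇒== a = Boolₚ.xor-identityʳ _
        flp-e : ∀ h → flp h e ≡ not (h e)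
        flp-e h rewrite ==-refl e = Boolₚ.xor-comm (h e) true
        F H : Fin m → Bool
        F = flp S.g′
        H = flp S.f′
        supp : ∀ h {x} → (h x ≡ true → f x ≡ true ⊎ g x ≡ true) → flp h x ≡ true → f x ≡ true ⊎ g x ≡ true
        supp h {x} k q = by (x ≟ e)
          where
          by : Dec (x ≡ e) → f x ≡ true ⊎ g x ≡ true
          by (yes refl) = inj₁ fe
          by (no a)     = k (trans (sym (flp-≢ h a)) q)
        only-F : ∀ x → inc G x u ≡ true → F x ≡ true → x ≡ e₁
        only-F x i q = by (x ≟ e) (x ≟ e₁) (bool-cases (cross G U x))
          where
          by : Dec (x ≡ e) → Dec (x ≡ e₁) → cross G U x ≡ true ⊎ cross G U x ≡ false → x ≡ e₁
          by _ (yes r) _ = r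
          by (yes refl) (no _) _ = ⊥-elim (true≢false q (trans (flp-e S.g′) (cong not (trans (S.away-g e away-e) fe))))
          by (no a) (no _) (inj₁ c) = ⊥-elim (a (only-e x i (trans (sym (S.away-g x (outer x c i))) (trans (sym (flp-≢ S.g′ a)) q))))
          by (no a) (no b) (inj₂ c) = ⊥-elim (a (only-e x i (trans (sym old) (trans (sym (flp-≢ S.g′ a)) q))))
            where
            old : S.g′ x ≡ f x
            old = trans (S.flip-g x (cross′ x false c true i))
                  (trans (cong (f x xor_) (cong₂ _xor_ (≢⇒== b) (≢⇒== {i = x} {e′} λ { refl → true≢false i e′-away }))) (Boolₚ.xor-identityʳ (f x)))
        only-H : ∀ x → inc G x u ≡ true → H x ≡ true → x ≡ e
        only-H x i q = by (x ≟ e) (x ≟ e₁) (bool-cases (cross G U x))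
          where
          by : Dec (x ≡ e) → Dec (x ≡ e₁) → cross G U x ≡ true ⊎ cross G U x ≡ false → x ≡ e
          by (yes r) _ _ = r
          by (no a) (yes refl) _ = ⊥-elim (true≢false q (trans (flp-≢ S.f′ a) (trans (S.flip-f e₁ ce₁′) (trans (at-e₁ g) (cong not ge₁)))))
          by (no a) (no b) (inj₁ c) = ⊥-elim (b (only-e₁ x i (trans (sym (S.away-f x (outer x c i))) (trans (sym (flp-≢ S.f′ a)) q))))
          by (no a) (no b) (inj₂ c) = ⊥-elim (b (only-e₁ x i (trans (sym old) (trans (sym (flp-≢ S.f′ a)) q))))
            where
            old : S.f′ x ≡ g x
            old = trans (S.flip-f x (cross′ x false c true i))
                  (trans (cong (g x xor_) (cong₂ _xor_ (≢⇒== b) (≢⇒== {i = x} {e′} λ { refl → true≢false i e′-away }))) (Boolₚ.xor-identityʳ (g x)))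
        others : ∀ {h} → Saturates U′ h → ∀ v → alive v ≡ true → U v ≡ true → v ≢ u → ExactlyOne (λ x → inc G x v ∧ flp h x)
        others {h} s v av Uv v≢u = unique-cong
          (λ x i → sym (flp-≢ h (not-at e ce iu Uv v≢u i))) (s v av (remove-true {U = U} Uv v≢u))
        flip′ : ∀ h h₀ → (∀ x → cross G U′ x ≡ true → h x ≡ h₀ x xor ((x == e₁) xor (x == e′))) →
                (∀ x → (∀ v → U′ v ≡ true → inc G x v ≡ false) → h x ≡ h₀ x) →
                ∀ x → cross G U x ≡ true → flp h x ≡ h₀ x xor ((x == e) xor (x == e′))
        flip′ h h₀ fl aw x c = by (bool-cases (inc G x u))
          where
          x≢e₁ : x ≢ e₁
          x≢e₁ refl = true≢false c c₁
          by : inc G x u ≡ true ⊎ inc G x u ≡ false → flp h x ≡ h₀ x xor ((x == e) xor (x == e′))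
          by (inj₁ i) = cong₂ _xor_ (aw x (outer x c i)) (sym (trans (cong ((x == e) xor_) (≢⇒== {i = x} {e′} λ { refl → true≢false i e′-away })) (Boolₚ.xor-identityʳ _)))
          by (inj₂ i) = trans (cong₂ _xor_ (trans (fl x (cross′ x true c false i)) (cong (λ b → h₀ x xor (b xor (x == e′))) (≢⇒== x≢e₁))) x≢e)
                        (trans (Boolₚ.xor-identityʳ _) (cong (λ b → h₀ x xor (b xor (x == e′))) (sym x≢e)))
            where
            x≢e : x == e ≡ false
            x≢e = ≢⇒== {i = x} {e} λ { refl → true≢false iu i }
        away′ : ∀ h h₀ → (∀ x → (∀ v → U′ v ≡ true → inc G x v ≡ false) → h x ≡ h₀ x) →
                ∀ x → (∀ v → U v ≡ true → inc G x v ≡ false) → flp h x ≡ h₀ x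
        away′ h h₀ aw x w = trans (flp-≢ h λ { refl → true≢false iu (w u Uu) }) (aw x (λ v p → w v (U⊆ p)))

  switch : ∀ U → CanSwitch U
  switch U = go (suc (count U)) U ℕₚ.≤-refl
    where
    go : ∀ k U → count U ℕ.< k → CanSwitch U
    go (suc k) U b = switch-step U (λ U′ c → go k U′ (ℕₚ.≤-trans c (ℕₚ.≤-pred b)))

-- Common members of two exchange families

-- Excluded middle for the goal ⊥. It stands in for the decidability of links, reachability and
-- separations, none of which is ever computed.
em : {P : Set} → (P ⊎ ¬ P → ⊥) → ⊥
em k = k (inj₂ (k ∘ inj₁))

-- The traces on a set A of boundary edges of the matchings that saturate one side of a cut.
record ExchangeFamily {E : Set} (A : E → Set) (F : List E → Set) : Set where
  field
    perm  : ∀ {X Y} → X ↭ Y → F X → F Y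
    quad  : ∀ {x y z w} → A x → A y → A z → A w → x ≢ y → x ≢ z → y ≢ z → w ≢ x → w ≢ y → w ≢ z →
            F (x ∷ y ∷ z ∷ []) → F (w ∷ y ∷ z ∷ []) ⊎ F (x ∷ w ∷ z ∷ []) ⊎ F (x ∷ y ∷ w ∷ [])
    join  : ∀ {o a b c d} → A o → A a → A b → A c → A d →
            o ≢ a → o ≢ b → o ≢ c → o ≢ d → a ≢ b → a ≢ c → a ≢ d → b ≢ c → b ≢ d → c ≢ d →
            F (o ∷ a ∷ b ∷ []) → F (o ∷ c ∷ d ∷ []) →
            F (o ∷ a ∷ b ∷ c ∷ d ∷ []) ⊎ (F (o ∷ b ∷ c ∷ []) × F (o ∷ a ∷ d ∷ []))
                                       ⊎ (F (o ∷ a ∷ c ∷ []) × F (o ∷ b ∷ d ∷ []))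
    cover : ∀ {x y} → A x → A y → x ≢ y → Σ E λ z → A z × z ≢ x × z ≢ y × F (x ∷ y ∷ z ∷ [])

-- For o in A, the triples {o,a,b} of the two families are the edges of two edge-disjoint
-- graphs on A - o.  Without a common triple there is no triangle with exactly one edge in
-- each graph, and without a common 5-set there is no path a-b-c-d of one graph whose
-- complement b-d-a-c is a path of the other.  As for cographs this forces every set to be
-- disconnected in one of the graphs; descending into a part leads to a pair covered by
-- only one of the families.
module _ {E : Set} (A : E → Set) (F : Bool → List E → Set)
         (family : ∀ c → ExchangeFamily A (F c))
         (disjoint : ∀ {X} → Unique X → All A X → length X ≡ 3 ⊎ length X ≡ 5 → F true X → F false X → ⊥)
         (o : E) (Ao : A o) where

  module Fam c = ExchangeFamily (family c)

  V : E → Set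
  V a = A a × o ≢ a

  disjoint′ : ∀ c {X} → Unique X → All A X → length X ≡ 3 ⊎ length X ≡ 5 → F c X → F (not c) X → ⊥
  disjoint′ true  u As l f g = disjoint u As l f g
  disjoint′ false u As l f g = disjoint u As l g f

  no-triple : ∀ c {x y z} → A x → A y → A z → x ≢ y → x ≢ z → y ≢ z →
              F c (x ∷ y ∷ z ∷ []) → F (not c) (x ∷ y ∷ z ∷ []) → ⊥
  no-triple c p q r s t u = disjoint′ c ((s ∷ t ∷ []) ∷ (u ∷ []) ∷ [] ∷ []) (p ∷ q ∷ r ∷ []) (inj₁ refl)

  rot : ∀ {x y z : E} → (x ∷ y ∷ z ∷ []) ↭ (z ∷ x ∷ y ∷ [])
  rot {x} {y} {z} = ↭-trans (prep x (swap y z ↭-refl)) (swap x z ↭-refl)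

  swap₁₂ : ∀ {x y z : E} → (x ∷ y ∷ z ∷ []) ↭ (y ∷ x ∷ z ∷ [])
  swap₁₂ {x} {y} = swap x y ↭-refl

  swap₂₃ : ∀ {x y z : E} → (x ∷ y ∷ z ∷ []) ↭ (x ∷ z ∷ y ∷ [])
  swap₂₃ {x} {y} {z} = prep x (swap y z ↭-refl)

  record Link (c : Bool) (a b : E) : Set where
    constructor edge
    field
      Va  : V a
      Vb  : V b
      a≢b : a ≢ b
      tri : F c (o ∷ a ∷ b ∷ [])

  Link-sym : ∀ {c a b} → Link c a b → Link c b a
  Link-sym {c} (edge p q r t) = edge q p (r ∘ sym) (Fam.perm c swap₂₃ t)

  Link-disj : ∀ c {a b} → Link c a b → Link (not c) a b → ⊥
  Link-disj c (edge (Aa , oa) (Ab , ob) r t) (edge _ _ _ t′) = no-triple c Ao Aa Ab oa ob r t t′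

  -- When d is exchanged into {o,a,b}, it can replace neither a nor b for lack of a link, and so it
  -- replaces o.
  triangle : ∀ c {a b d} → Link c a b → V d → d ≢ a → d ≢ b → ¬ Link c a d → ¬ Link c b d → F c (a ∷ b ∷ d ∷ [])
  triangle c (edge (Aa , oa) (Ab , ob) r t) (Ad , od) da db ¬ad ¬bd
    with Fam.quad c Ao Aa Ab Ad oa ob r (od ∘ sym) da db t
  ... | inj₁ f        = Fam.perm c (↭-trans rot rot) f
  ... | inj₂ (inj₁ f) = ⊥-elim (¬bd (edge (Ab , ob) (Ad , od) (db ∘ sym) (Fam.perm c swap₂₃ f)))
  ... | inj₂ (inj₂ f) = ⊥-elim (¬ad (edge (Aa , oa) (Ad , od) (da ∘ sym) f))

  -- A converse to `triangle`: here o is exchanged into {a,b,d}.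
  triangle-edge : ∀ c {a b d} → V a → V b → V d → a ≢ b → a ≢ d → b ≢ d → F c (a ∷ b ∷ d ∷ []) →
                  Link c b d ⊎ Link c a d ⊎ Link c a b
  triangle-edge c (Aa , oa) (Ab , ob) (Ad , od) ab ad bd t with Fam.quad c Aa Ab Ad Ao ab ad bd oa ob od t
  ... | inj₁ f        = inj₁ (edge (Ab , ob) (Ad , od) bd f)
  ... | inj₂ (inj₁ f) = inj₂ (inj₁ (edge (Aa , oa) (Ad , od) ad (Fam.perm c swap₁₂ f)))
  ... | inj₂ (inj₂ f) = inj₂ (inj₂ (edge (Aa , oa) (Ab , ob) ab (Fam.perm c rot f)))

  -- By `triangle`, applied to either link, {a,b,d} would be a common triple of the two families.
  no-rainbow : ∀ c {a b d} → Link c a b → Link (not c) b d → ¬ Link c a d → ¬ Link (not c) a d → ⊥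
  no-rainbow c {a} {b} {d} ab bd ¬ad ¬ad′ =
    no-triple c Aa Ab Ad (Link.a≢b ab) a≢d (Link.a≢b bd)
      (triangle c ab (Ad , od) (a≢d ∘ sym) (Link.a≢b bd ∘ sym) ¬ad (λ k → Link-disj c k bd))
      (Fam.perm (not c) rot
        (triangle (not c) bd (Aa , oa) (Link.a≢b ab) a≢d (λ k → Link-disj c ab (Link-sym k)) (¬ad′ ∘ Link-sym)))
    where
    Aa = proj₁ (Link.Va ab)
    oa = proj₂ (Link.Va ab)
    Ab = proj₁ (Link.Vb ab)
    Ad = proj₁ (Link.Vb bd)
    od = proj₂ (Link.Vb bd)
    a≢d : a ≢ d
    a≢d refl = Link-disj c ab (Link-sym bd)

  -- The `join` of the two outer links of a path yields either the five-set or a link that already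
  -- belongs to the other graph. So both paths yield the five-set {o,p,q,v,w}, which cannot be
  -- common.
  no-P₄ : ∀ c {p q v w} → Link c p q → Link c q v → Link c v w → Link (not c) q w → Link (not c) w p → Link (not c) p v → ⊥
  no-P₄ c {p} {q} {v} {w} pq qv vw qw wp pv = by
      (Fam.join c Ao Ap Aq Av Aw op oq ov ow p≢q p≢v p≢w q≢v q≢w v≢w (Link.tri pq) (Link.tri vw))
      (Fam.join (not c) Ao Ap Av Aq Aw op ov oq ow p≢v p≢q p≢w (q≢v ∘ sym) v≢w q≢w (Link.tri pv) (Link.tri qw))
    where
    open Link pq using () renaming (Va to Vp; Vb to Vq; a≢b to p≢q)
    open Link vw using () renaming (Va to Vv; Vb to Vw; a≢b to v≢w)
    open Σ Vp renaming (proj₁ to Ap; proj₂ to op)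
    open Σ Vq renaming (proj₁ to Aq; proj₂ to oq)
    open Σ Vv renaming (proj₁ to Av; proj₂ to ov)
    open Σ Vw renaming (proj₁ to Aw; proj₂ to ow)
    p≢v = Link.a≢b pv
    p≢w = Link.a≢b wp ∘ sym
    q≢v = Link.a≢b qv
    q≢w = Link.a≢b qw
    by : F c (o ∷ p ∷ q ∷ v ∷ w ∷ []) ⊎ (F c (o ∷ q ∷ v ∷ []) × F c (o ∷ p ∷ w ∷ [])) ⊎ (F c (o ∷ p ∷ v ∷ []) × F c (o ∷ q ∷ w ∷ [])) →
         F (not c) (o ∷ p ∷ v ∷ q ∷ w ∷ []) ⊎ (F (not c) (o ∷ v ∷ q ∷ []) × F (not c) (o ∷ p ∷ w ∷ []))
                                            ⊎ (F (not c) (o ∷ p ∷ q ∷ []) × F (not c) (o ∷ v ∷ w ∷ [])) → ⊥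
    by (inj₂ (inj₁ (_ , f))) _ = Link-disj c (edge Vp Vw p≢w f) (Link-sym wp)
    by (inj₂ (inj₂ (f , _))) _ = Link-disj c (edge Vp Vv p≢v f) pv
    by (inj₁ _) (inj₂ (inj₁ (f , _))) = Link-disj c (Link-sym qv) (edge Vv Vq (q≢v ∘ sym) f)
    by (inj₁ _) (inj₂ (inj₂ (f , _))) = Link-disj c pq (edge Vp Vq p≢q f)
    by (inj₁ f) (inj₁ g) = disjoint′ c
      ((op ∷ oq ∷ ov ∷ ow ∷ []) ∷ (p≢q ∷ p≢v ∷ p≢w ∷ []) ∷ (q≢v ∷ q≢w ∷ []) ∷ (v≢w ∷ []) ∷ [] ∷ [])
      (Ao ∷ Ap ∷ Aq ∷ Av ∷ Aw ∷ []) (inj₂ refl) f (Fam.perm (not c) (prep o (prep p (swap v q ↭-refl))) g)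

  record Disconnected (c : Bool) (S : List E) : Set₁ where
    constructor disconnected
    field
      Q     : E → Set
      x′ y′ : E
      x∈′   : x′ ∈ S
      y∈′   : y′ ∈ S
      Qx′   : Q x′
      ¬Qy′  : ¬ Q y′
      split : ∀ {a b} → a ∈ S → b ∈ S → Q a → ¬ Q b → ¬ Link c a b

  data Reach (c : Bool) (S : List E) (x : E) : E → Set where
    stop : Reach c S x x
    step : ∀ {y z} → Reach c S x y → z ∈ S → Link c y z → Reach c S x z

  reach-∈ : ∀ {c S x y} → x ∈ S → Reach c S x y → y ∈ S
  reach-∈ p stop         = p
  reach-∈ p (step _ q _) = q

  reach-trans : ∀ {c S x y z} → Reach c S x y → Reach c S y z → Reach c S x z
  reach-trans r stop         = r
  reach-trans r (step q i l) = step (reach-trans r q) i l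

  reach-sym : ∀ {c S x y} → x ∈ S → Reach c S x y → Reach c S y x
  reach-sym p stop         = stop
  reach-sym p (step r i l) = reach-trans (step stop (reach-∈ p r) (Link-sym l)) (reach-sym p r)

  -- Here b has no c-link to the c-component of x, so `no-rainbow` carries the absence of a link of
  -- the other graph along every c-link of that component: b sees all of the component alike.
  uniform : ∀ {c S x a b} → x ∈ S → b ∈ S → ¬ Reach c S x b → Reach c S x a → ¬ Link (not c) x b → ¬ Link (not c) a b
  uniform x∈ b∈ ¬r stop n = n
  uniform {c} x∈ b∈ ¬r (step r i l) n k = no-rainbow c l k
    (λ m → ¬r (step r b∈ m)) (uniform x∈ b∈ ¬r r n)

  uniform⁻ : ∀ {c S x a b} → x ∈ S → b ∈ S → ¬ Reach c S x b → Reach c S x a → ¬ Link (not c) a b → ¬ Link (not c) x b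
  uniform⁻ x∈ b∈ ¬r stop n = n
  uniform⁻ {c} x∈ b∈ ¬r (step r i l) n = uniform⁻ x∈ b∈ ¬r r
    (λ k → no-rainbow c (Link-sym l) k (λ m → ¬r (step (step r i l) b∈ m)) n)

  -- A discrete intermediate value argument: on the path from x to w there is a step p, q at which
  -- the link to v appears.
  frontier : ∀ {c S v x w} → x ∈ S → ¬ Link c v x → Reach c S x w → Link c v w →
             (∀ {p q} → Reach c S x p → q ∈ S → Link c p q → ¬ Link c v p → Link c v q → ⊥) → ⊥
  frontier x∈ n stop l k = n l
  frontier {c} {S} {v} x∈ n (step {y} r i l) lw k = em {Link c v y} λ where
    (inj₁ m) → frontier x∈ n r m k
    (inj₂ m) → k r i l m lw

  -- Every c-component of S has a c-neighbour of v, since otherwise it splits off in graph c. Some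
  -- `u₀` is not a c-neighbour of v, since otherwise v is isolated in the other graph. So the
  -- c-component of `u₀` contains a c-link from p to q with v joined to q only, and this separates
  -- the component from v and from the rest of S in the other graph.
  extend : ∀ c v S → v ∉ S → Disconnected c S → (∀ c → Disconnected c (v ∷ S) → ⊥) → ⊥
  extend c v S v∉ D k = not-all λ u₀∈ ¬vu₀ → neighbour u₀∈ λ r lw → frontier u₀∈ ¬vu₀ r lw (separate u₀∈)
    where
    open Disconnected D
    closed : ∀ {u b} → u ∈ S → Q u → Reach c S u b → ¬ Q b → ⊥
    closed u∈ q stop n = n q
    closed u∈ q (step r i l) n = em λ where
      (inj₁ Qy) → split (reach-∈ u∈ r) i Qy n l
      (inj₂ ¬Qy) → closed u∈ q r ¬Qy
    closed⁻ : ∀ {u b} → u ∈ S → ¬ Q u → Reach c S u b → Q b → ⊥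
    closed⁻ u∈ q stop n = q n
    closed⁻ u∈ q (step r i l) n = em λ where
      (inj₁ Qy) → closed⁻ u∈ q r Qy
      (inj₂ ¬Qy) → split i (reach-∈ u∈ r) n ¬Qy (Link-sym l)
    apart : ∀ {u} → u ∈ S → (∀ {b} → b ∈ S → ¬ Reach c S u b → ⊥) → ⊥
    apart {u} u∈ n = em {Q u} λ where
      (inj₁ Qu)  → n y∈′ (λ r → closed u∈ Qu r ¬Qy′)
      (inj₂ ¬Qu) → n x∈′ (λ r → closed⁻ u∈ ¬Qu r Qx′)
    neighbour : ∀ {z} → z ∈ S → (∀ {w} → Reach c S z w → Link c v w → ⊥) → ⊥
    neighbour {z} z∈ n = k c (disconnected (λ u → Reach c S z u × u ∈ S) z v (there z∈) (here refl) (stop , z∈) (v∉ ∘ proj₂)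
      λ where
        _ (here refl) (ra , a∈) ¬Qb l → n ra (Link-sym l)
        _ (there b∈)  (ra , a∈) ¬Qb l → ¬Qb (step ra b∈ l , b∈))
    not-all : (∀ {u} → u ∈ S → ¬ Link c v u → ⊥) → ⊥
    not-all n = k (not c) (disconnected (_≡ v) v x′ (here refl) (there x∈′) refl (λ { refl → v∉ x∈′ })
      λ where
        _ (here refl) refl ¬Qb l → ¬Qb refl
        _ (there b∈)  refl ¬Qb l → n b∈ (λ m → Link-disj c m l))
    separate : ∀ {u₀ p q} → u₀ ∈ S → Reach c S u₀ p → q ∈ S → Link c p q → ¬ Link c v p → Link c v q → ⊥
    separate {u₀} {p} {q} u₀∈ rp q∈ pq ¬vp vq = k (not c)
      (disconnected (λ u → Reach c S u₀ u × u ∈ S) u₀ v (there u₀∈) (here refl) (stop , u₀∈) (v∉ ∘ proj₂)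
      λ where
        _ (here refl) (ra , a∈) ¬Qb l → to-v ra l
        _ (there b∈)  (ra , a∈) ¬Qb l → to-S ra b∈ (λ r → ¬Qb (r , b∈)) l)
      where
      rq : Reach c S u₀ q
      rq = step rp q∈ pq
      -- By `no-rainbow` a link of the other graph between p and w forces v-p and q-w into that
      -- graph too; then p-q-v-w is the path excluded by `no-P₄`.
      from-p : ∀ {w} → w ∈ S → ¬ Reach c S u₀ w → Link c v w → ¬ Link (not c) p w
      from-p w∈ ¬rw vw pw = em λ where
        (inj₂ ¬vp′) → no-rainbow c vw (Link-sym pw) ¬vp ¬vp′
        (inj₁ vp′)  → em λ where
          (inj₂ ¬qw) → no-rainbow c (Link-sym pq) pw (λ m → ¬rw (step rq w∈ m)) ¬qw
          (inj₁ qw)  → no-P₄ c pq (Link-sym vq) vw qw (Link-sym pw) (Link-sym vp′)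
      from-K : ∀ {a w} → Reach c S u₀ a → w ∈ S → ¬ Reach c S u₀ w → Link c v w → ¬ Link (not c) a w
      from-K ra w∈ ¬rw vw = uniform u₀∈ w∈ ¬rw ra (uniform⁻ u₀∈ w∈ ¬rw rp (from-p w∈ ¬rw vw))
      far : ∀ {b w} → b ∈ S → ¬ Reach c S u₀ b → Reach c S b w → ¬ Reach c S u₀ w
      far b∈ ¬rb rw ru = ¬rb (reach-trans ru (reach-sym b∈ rw))
      to-v : ∀ {a} → Reach c S u₀ a → ¬ Link (not c) a v
      to-v ra l = apart u₀∈ λ b∈ ¬rb → neighbour b∈ λ rw vw →
        no-rainbow c (Link-sym vw) (Link-sym l)
          (λ m → far b∈ ¬rb rw (step ra (reach-∈ b∈ rw) (Link-sym m)))
          (λ m → from-K ra (reach-∈ b∈ rw) (far b∈ ¬rb rw) vw (Link-sym m))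
      -- The component of b has a c-neighbour w of v. By `from-K` the vertex a is not linked to w,
      -- and by uniformity not to b.
      to-S : ∀ {a b} → Reach c S u₀ a → b ∈ S → ¬ Reach c S u₀ b → ¬ Link (not c) a b
      to-S ra b∈ ¬rb l = neighbour b∈ λ rw vw →
        uniform⁻ b∈ (reach-∈ u₀∈ ra) (λ r → ¬rb (reach-trans ra (reach-sym b∈ r))) rw
          (λ m → from-K ra (reach-∈ b∈ rw) (far b∈ ¬rb rw) vw (Link-sym m)) (Link-sym l)

  -- Pairs are coloured by the graph that links them, with a third colour for no link; `no-rainbow`
  -- makes this a colouring without rainbow triangles, as studied by Gallai. With `no-P₄` the
  -- argument is the one for cographs: vertices are added one at a time by `extend`, beginning with
  -- two distinct ones.
  gallai : ∀ S {x y} → x ∈ S → y ∈ S → x ≢ y → (∀ c → Disconnected c S → ⊥) → ⊥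
  gallai (v ∷ S) {x} {y} x∈ y∈ x≢y k = cases x∈ y∈
    where
    back : ∀ {a} → v ∈ S → a ∈ v ∷ S → a ∈ S
    back v∈ (here refl) = v∈
    back v∈ (there p)   = p
    old : ∀ c → v ∈ S → Disconnected c S → ⊥
    old c v∈ (disconnected Q p q p∈ q∈ Qp ¬Qq split) = k c (disconnected Q p q (there p∈) (there q∈) Qp ¬Qq
      λ a∈ b∈ → split (back v∈ a∈) (back v∈ b∈))
    more : ∀ {w z} → w ∈ S → z ∈ S → w ≢ z → ⊥
    more w∈ z∈ w≢z = gallai S w∈ z∈ w≢z λ c D → em λ
      { (inj₁ v∈) → old c v∈ D
      ; (inj₂ v∉) → extend c v S v∉ D k }
    pair : ∀ {w} → w ∈ S → w ≢ v → ⊥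
    pair {w} w∈ w≢v = em {Σ E λ z → z ∈ S × w ≢ z} λ where
      (inj₁ (z , z∈ , w≢z)) → more w∈ z∈ w≢z
      (inj₂ none) → em {Link true v w} λ where
        (inj₁ l)  → k false (disconnected (_≡ v) v w (here refl) (there w∈) refl w≢v
                      λ { _ (here refl) refl ¬Qb _ → ¬Qb refl
                        ; {b = b} _ (there b∈) refl _ m → none (b , b∈ , λ { refl → Link-disj true l m }) })
        (inj₂ ¬l) → k true (disconnected (_≡ v) v w (here refl) (there w∈) refl w≢v
                      λ { _ (here refl) refl ¬Qb _ → ¬Qb refl
                        ; {b = b} _ (there b∈) refl _ m → none (b , b∈ , λ { refl → ¬l m }) })
    cases : x ∈ v ∷ S → y ∈ v ∷ S → ⊥
    cases (here refl) (here refl) = x≢y refl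
    cases (here refl) (there y∈)  = pair y∈ (x≢y ∘ sym)
    cases (there x∈)  (here refl) = pair x∈ x≢y
    cases (there x∈)  (there y∈)  = more x∈ y∈ x≢y

  -- A filter by an undecided predicate, which exists only under a double negation; hence the
  -- continuation.
  sublist : ∀ (P : E → Set) S → (∀ S′ → (∀ {z} → z ∈ S′ → z ∈ S × P z) → (∀ {z} → z ∈ S → P z → z ∈ S′) →
            length S′ ℕ.≤ length S → (∀ {z} → z ∈ S → ¬ P z → length S′ ℕ.< length S) → ⊥) → ⊥
  sublist P [] k = k [] (λ ()) (λ ()) ℕ.z≤n (λ ())
  sublist P (v ∷ S) k = sublist P S λ S′ sub cov le lt → em {P v} λ where
    (inj₁ Pv) → k (v ∷ S′)
      (λ { (here refl) → here refl , Pv ; (there q) → there (proj₁ (sub q)) , proj₂ (sub q) })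
      (λ { (here refl) _ → here refl ; (there q) r → there (cov q r) })
      (ℕ.s≤s le) (λ { (here refl) n → ⊥-elim (n Pv) ; (there q) n → ℕ.s≤s (lt q n) })
    (inj₂ ¬Pv) → k S′
      (λ q → there (proj₁ (sub q)) , proj₂ (sub q))
      (λ { (here refl) r → ⊥-elim (¬Pv r) ; (there q) r → cov q r })
      (ℕₚ.m≤n⇒m≤1+n le) (λ _ _ → ℕ.s≤s le)

  -- Doubly negated, because the descent only ever has to reach ⊥.
  Closed : List E → Set
  Closed S = ∀ {b} → V b → b ∉ S → (∀ c → (∀ {s} → s ∈ S → ¬ Link c b s) → ⊥) → ⊥

  -- The other family covers a and b by a triple {a,b,t}, and o exchanged into it gives a link of
  -- the other graph, which lies in S if t does. If t is outside S, closedness deprives t of its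
  -- links to S in one graph. If this is graph c, then `triangle` makes {a,b,t} a common triple; if
  -- it is the other one, then a-b is linked in both.
  other-edge : ∀ c {S a b} → (∀ {z} → z ∈ S → V z) → Closed S → a ∈ S → b ∈ S → Link c a b →
               (∀ {x y} → x ∈ S → y ∈ S → Link (not c) x y → ⊥) → ⊥
  other-edge c {S} {a} {b} on cl a∈ b∈ ab k with Fam.cover (not c) (proj₁ (Link.Va ab)) (proj₁ (Link.Vb ab)) (Link.a≢b ab)
  ... | t , At , t≢a , t≢b , f = em {o ≡ t} λ
    { (inj₁ refl) → Link-disj c ab (edge (Link.Va ab) (Link.Vb ab) (Link.a≢b ab) (Fam.perm (not c) rot f))
    ; (inj₂ o≢t) → em {t ∈ S} λ
      { (inj₁ t∈) → [ k b∈ t∈ , [ k a∈ t∈ , k a∈ b∈ ]′ ]′ (edge-of o≢t)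
      ; (inj₂ t∉) → cl (At , o≢t) t∉ λ d none → outside o≢t d none } }
    where
    edge-of : o ≢ t → Link (not c) b t ⊎ Link (not c) a t ⊎ Link (not c) a b
    edge-of o≢t = triangle-edge (not c) (Link.Va ab) (Link.Vb ab) (At , o≢t) (Link.a≢b ab) (t≢a ∘ sym) (t≢b ∘ sym) f
    same : ∀ d → d ≡ c → (∀ {s} → s ∈ S → ¬ Link d t s) → o ≢ t → ⊥
    same _ refl none o≢t = no-triple c (proj₁ (Link.Va ab)) (proj₁ (Link.Vb ab)) At (Link.a≢b ab) (t≢a ∘ sym) (t≢b ∘ sym)
      (triangle c ab (At , o≢t) t≢a t≢b (none a∈ ∘ Link-sym) (none b∈ ∘ Link-sym)) f
    differ : ∀ d → d ≡ not c → (∀ {s} → s ∈ S → ¬ Link d t s) → o ≢ t → ⊥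
    differ _ refl none o≢t = [ none b∈ ∘ Link-sym , [ none a∈ ∘ Link-sym , Link-disj c ab ]′ ]′ (edge-of o≢t)
    outside : o ≢ t → ∀ d → (∀ {s} → s ∈ S → ¬ Link d t s) → ⊥
    outside o≢t d none with d Boolₚ.≟ c
    ... | yes q = same d q none o≢t
    ... | no q  = differ d (¬-not q) none o≢t

  -- `gallai` makes S fall apart in some graph d. The parts are closed again, because the remainder
  -- of S has no d-links to a part. By `other-edge` some d-link lies in S; it cannot run between the
  -- parts, so it starts the same argument in a smaller one.
  descend : ∀ k S → length S ℕ.< k → (∀ {z} → z ∈ S → V z) → Closed S →
            ∀ {c a b} → a ∈ S → b ∈ S → Link c a b → ⊥
  descend (suc k) S len on cl {c} {a} {b} a∈ b∈ ab = gallai S a∈ b∈ (Link.a≢b ab) λ d D →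
    edge-in d λ {x} {y} x∈ y∈ xy → let open Disconnected D in em {Q x} λ
      { (inj₁ Qx) → em {Q y} λ
        { (inj₁ Qy)  → part d Q split y∈′ ¬Qy′ x∈ y∈ Qx Qy xy
        ; (inj₂ ¬Qy) → split x∈ y∈ Qx ¬Qy xy }
      ; (inj₂ ¬Qx) → em {Q y} λ
        { (inj₁ Qy)  → split y∈ x∈ Qy ¬Qx (Link-sym xy)
        ; (inj₂ ¬Qy) → part d (λ z → ¬ Q z)
            (λ p∈ q∈ ¬Qp ¬¬Qq l → ¬¬Qq λ Qq → split q∈ p∈ Qq ¬Qp (Link-sym l))
            x∈′ (λ n → n Qx′) x∈ y∈ ¬Qx ¬Qy xy } }
    where
    edge-in : ∀ d → (∀ {x y} → x ∈ S → y ∈ S → Link d x y → ⊥) → ⊥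
    edge-in d n with d Boolₚ.≟ c
    ... | yes refl = n a∈ b∈ ab
    ... | no q     = other-edge c on cl a∈ b∈ ab (subst (λ e → ∀ {x y} → x ∈ S → y ∈ S → Link e x y → ⊥) (¬-not q) n)
    part : ∀ d (P : E → Set) → (∀ {p q} → p ∈ S → q ∈ S → P p → ¬ P q → ¬ Link d p q) →
           ∀ {z} → z ∈ S → ¬ P z → ∀ {x y} → x ∈ S → y ∈ S → P x → P y → Link d x y → ⊥
    part d P split z∈ ¬Pz x∈ y∈ Px Py xy = sublist P S λ S′ sub cov le lt →
      descend k S′ (ℕₚ.<-≤-trans (lt z∈ ¬Pz) (ℕₚ.≤-pred len)) (on ∘ proj₁ ∘ sub)
        (λ {b} Vb b∉ n → em {b ∈ S} λ where
          (inj₁ b∈) → n d (λ s∈ l → split (proj₁ (sub s∈)) b∈ (proj₂ (sub s∈)) (b∉ ∘ cov b∈) (Link-sym l))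
          (inj₂ b∉S) → cl Vb b∉S λ e none → n e (none ∘ proj₁ ∘ sub))
        (cov x∈ Px) (cov y∈ Py) xy

  no-exchange-pair : ∀ S → (∀ {z} → z ∈ S → V z) → (∀ {z} → V z → z ∈ S) → ∀ {a} → A a → o ≢ a → ⊥
  no-exchange-pair S on all Aa oa with Fam.cover true Ao Aa oa
  ... | t , At , t≢o , t≢a , f =
    descend (suc (length S)) S ℕₚ.≤-refl on (λ Vb b∉ _ → b∉ (all Vb)) (all (Aa , oa)) (all (At , t≢o ∘ sym))
      (edge (Aa , oa) (At , t≢o ∘ sym) (t≢a ∘ sym) f)

-- Matchings crossing a cut three or five times

∑-list : ∀ {n} {X : List (Fin n)} → Unique X → (p : Fin n → Bool) →
         (∀ i → p i ≡ true → i ∈ X) → (∀ i → i ∈ X → p i ≡ true) → ∑ (λ i → ⟦ p i ⟧) ≡ + length X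
∑-list {X = []} [] p to from = ∑-0 λ i → cong ⟦_⟧ (¬-not λ q → case to i q of λ ())
∑-list {X = x ∷ X} (x∉ ∷ u) p to from =
  trans (∑-cong split) (trans (∑-+ (λ i → ⟦ i == x ⟧) (λ i → ⟦ p i ∧ not (i == x) ⟧))
    (cong₂ _+_ (∑-delta₁ x) (∑-list u (λ i → p i ∧ not (i == x)) to′ from′)))
  where
  split : ∀ i → ⟦ p i ⟧ ≡ ⟦ i == x ⟧ + ⟦ p i ∧ not (i == x) ⟧
  split i with i ≟ x
  ... | yes refl rewrite from x (here refl) = refl
  ... | no _     rewrite Boolₚ.∧-identityʳ (p i) = sym (ℤₚ.+-identityˡ _)
  to′ : ∀ i → p i ∧ not (i == x) ≡ true → i ∈ X
  to′ i q with i ≟ x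
  ... | yes refl = ⊥-elim (true≢false q (Boolₚ.∧-zeroʳ (p i)))
  ... | no i≢x   with to i (∧-elimˡ q)
  ...   | here r  = ⊥-elim (i≢x r)
  ...   | there r = r
  from′ : ∀ i → i ∈ X → p i ∧ not (i == x) ≡ true
  from′ i i∈ with i ≟ x
  ... | yes refl = ⊥-elim (All.lookup x∉ i∈ refl)
  ... | no _     = trans (Boolₚ.∧-identityʳ (p i)) (from i (there i∈))

module _ {n m : ℕ} (G : Net n m) (P : Fin m → Set) (U : Fin n → Bool) where
  open Net G

  record Trace (Q : Fin m → Set) : Set where
    field
      f    : Fin m → Bool
      sat  : Saturates G U f
      supp : ∀ e → f e ≡ true → P e
      bd⇒  : ∀ e → cross G U e ≡ true → f e ≡ true → Q e
      bd⇐  : ∀ e → cross G U e ≡ true → Q e → f e ≡ true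

  trace-resp : ∀ {Q R} → (∀ e → cross G U e ≡ true → Q e → R e) → (∀ e → cross G U e ≡ true → R e → Q e) →
               Trace Q → Trace R
  trace-resp to from t = record
    { f = f ; sat = sat ; supp = supp ; bd⇒ = λ e c q → to e c (bd⇒ e c q) ; bd⇐ = λ e c r → bd⇐ e c (from e c r) }
    where open Trace t

  -- The symmetric difference of Q and {e, e′}.
  Toggle : Fin m → Fin m → (Fin m → Set) → Fin m → Set
  Toggle e e′ Q x = (x ≢ e × x ≢ e′ × Q x) ⊎ ((x ≡ e ⊎ x ≡ e′) × ¬ Q x)

  toggle : ∀ {Q} (t : Trace Q) {e e′} → e′ ≢ e → cross G U e ≡ true → cross G U e′ ≡ true →
           (f′ : Fin m → Bool) → Saturates G U f′ → (∀ x → f′ x ≡ true → P x) →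
           (∀ x → cross G U x ≡ true → f′ x ≡ Trace.f t x xor ((x == e) xor (x == e′))) → Trace (Toggle e e′ Q)
  toggle {Q} t {e} {e′} e′≢e ce ce′ f′ sat′ supp′ flip = record
    { f = f′ ; sat = sat′ ; supp = supp′
    ; bd⇒ = λ x c q → to x c (x ≟ e) (x ≟ e′) (trans (sym (flip x c)) q)
    ; bd⇐ = λ x c q → trans (flip x c) (from x c q) }
    where
    open Trace t
    at-e : f e xor ((e == e) xor (e == e′)) ≡ not (f e)
    at-e rewrite ==-refl e | ≢⇒== (e′≢e ∘ sym) = Boolₚ.xor-comm (f e) true
    at-e′ : f e′ xor ((e′ == e) xor (e′ == e′)) ≡ not (f e′)
    at-e′ rewrite ==-refl e′ | ≢⇒== e′≢e = Boolₚ.xor-comm (f e′) true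
    else : ∀ x → x ≢ e → x ≢ e′ → f x xor ((x == e) xor (x == e′)) ≡ f x
    else x a b rewrite ≢⇒== a | ≢⇒== b = Boolₚ.xor-identityʳ (f x)
    not-Q : ∀ x → cross G U x ≡ true → not (f x) ≡ true → ¬ Q x
    not-Q x c q r = true≢false q (cong not (bd⇐ x c r))
    to : ∀ x → cross G U x ≡ true → Dec (x ≡ e) → Dec (x ≡ e′) → f x xor ((x == e) xor (x == e′)) ≡ true → Toggle e e′ Q x
    to x c (yes refl) _ q = inj₂ (inj₁ refl , not-Q x c (trans (sym at-e) q))
    to x c (no _) (yes refl) q = inj₂ (inj₂ refl , not-Q x c (trans (sym at-e′) q))
    to x c (no a) (no b) q = inj₁ (a , b , bd⇒ x c (trans (sym (else x a b)) q))
    from : ∀ x → cross G U x ≡ true → Toggle e e′ Q x → f x xor ((x == e) xor (x == e′)) ≡ true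
    from x c (inj₁ (a , b , q)) = trans (else x a b) (bd⇐ x c q)
    from x c (inj₂ (inj₁ refl , ¬q)) = trans at-e (cong not (¬-not (¬q ∘ bd⇒ x c)))
    from x c (inj₂ (inj₂ refl , ¬q)) = trans at-e′ (cong not (¬-not (¬q ∘ bd⇒ x c)))

  -- The alternating path of `switch` ends in an edge of exactly one of the two traces, and the same
  -- pair is toggled in both. This is a simultaneous form of the exchange property of even
  -- delta-matroids.
  exchange : ∀ {Q R} → Trace Q → Trace R → ∀ e → cross G U e ≡ true → Q e → ¬ R e →
             Σ (Fin m) λ e′ → cross G U e′ ≡ true × e′ ≢ e × ((Q e′ × ¬ R e′) ⊎ (¬ Q e′ × R e′)) ×
                              Trace (Toggle e e′ Q) × Trace (Toggle e e′ R)
  exchange {Q} {R} t s e ce Qe ¬Re = e′ , cross-e′ , e′≢e , kind (bool-cases (T.f e′)) ,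
    toggle t e′≢e ce cross-e′ f′ sat-f (λ x q → [ T.supp x , S.supp x ]′ (supp-f x q)) flip-f ,
    toggle s e′≢e ce cross-e′ g′ sat-g (λ x q → [ T.supp x , S.supp x ]′ (supp-g x q)) flip-g
    where
    module T = Trace t
    module S = Trace s
    open Switch (switch G U T.f S.f T.sat S.sat e ce (T.bd⇐ e ce Qe) (¬-not (¬Re ∘ S.bd⇒ e ce)))
    kind : T.f e′ ≡ true ⊎ T.f e′ ≡ false → (Q e′ × ¬ R e′) ⊎ (¬ Q e′ × R e′)
    kind (inj₁ q) = inj₁ (T.bd⇒ e′ cross-e′ q , λ r → true≢false (S.bd⇐ e′ cross-e′ r) (trans differ (cong not q)))
    kind (inj₂ q) = inj₂ ((λ r → true≢false (T.bd⇐ e′ cross-e′ r) q) , S.bd⇒ e′ cross-e′ (trans differ (cong not q)))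

  Feas : List (Fin m) → Set
  Feas X = Trace (_∈ X)

  feas-perm : ∀ {X Y} → X ↭ Y → Feas X → Feas Y
  feas-perm p = trace-resp (λ _ _ → ∈-resp-↭ p) (λ _ _ → ∈-resp-↭ (↭-sym p))

  replace : ∀ {e e′ Z} → e′ ∉ Z → e ∉ (e′ ∷ Z) → Trace (Toggle e e′ (_∈ (e′ ∷ Z))) → Feas (e ∷ Z)
  replace {e} {e′} {Z} e′∉ e∉ = trace-resp to from
    where
    to : ∀ x → cross G U x ≡ true → Toggle e e′ (_∈ (e′ ∷ Z)) x → x ∈ e ∷ Z
    to x _ (inj₁ (_ , b , here r))     = ⊥-elim (b r)
    to x _ (inj₁ (_ , b , there r))    = there r
    to x _ (inj₂ (inj₁ refl , _))      = here refl
    to x _ (inj₂ (inj₂ refl , q))      = ⊥-elim (q (here refl))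
    from : ∀ x → cross G U x ≡ true → x ∈ e ∷ Z → Toggle e e′ (_∈ (e′ ∷ Z)) x
    from x _ (here refl) = inj₂ (inj₁ refl , e∉)
    from x _ (there r)   = inj₁ ((λ { refl → e∉ (there r) }) , (λ { refl → e′∉ r }) , there r)

  add : ∀ {e e′ Z} → e ∉ Z → e′ ∉ Z → Trace (Toggle e e′ (_∈ Z)) → Feas (e ∷ e′ ∷ Z)
  add {e} {e′} {Z} e∉ e′∉ = trace-resp to from
    where
    to : ∀ x → cross G U x ≡ true → Toggle e e′ (_∈ Z) x → x ∈ e ∷ e′ ∷ Z
    to x _ (inj₁ (_ , _ , r))     = there (there r)
    to x _ (inj₂ (inj₁ refl , _)) = here refl
    to x _ (inj₂ (inj₂ refl , _)) = there (here refl)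
    from : ∀ x → cross G U x ≡ true → x ∈ e ∷ e′ ∷ Z → Toggle e e′ (_∈ Z) x
    from x _ (here refl)         = inj₂ (inj₁ refl , e∉)
    from x _ (there (here refl)) = inj₂ (inj₂ refl , e′∉)
    from x _ (there (there r))   = inj₁ ((λ { refl → e∉ r }) , (λ { refl → e′∉ r }) , r)

  -- One `exchange` gives each property: `quad` from the singleton {w} against {x,y,z}, `join` from
  -- the two triples through o, `cover` from the whole of A against the singleton {x}.
  family : (A : Fin m → Set) → (∀ {e} → A e → cross G U e ≡ true) → Trace A →
           (∀ {e} → A e → Feas (e ∷ [])) → ExchangeFamily A Feas
  family A bd whole top = record { perm = feas-perm ; quad = quad ; join = join ; cover = cover }
    where
    ∉-2 : ∀ {x y z : Fin m} → x ≢ y → x ≢ z → x ∉ (y ∷ z ∷ [])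
    ∉-2 a b (here q)         = a q
    ∉-2 a b (there (here q)) = b q
    ∉-3 : ∀ {x y z w : Fin m} → x ≢ y → x ≢ z → x ≢ w → x ∉ (y ∷ z ∷ w ∷ [])
    ∉-3 a b c (here q)                 = a q
    ∉-3 a b c (there (here q))         = b q
    ∉-3 a b c (there (there (here q))) = c q
    sw : ∀ {x y z : Fin m} → (x ∷ y ∷ z ∷ []) ↭ (y ∷ x ∷ z ∷ [])
    sw {x} {y} = swap x y ↭-refl
    ro : ∀ {x y z : Fin m} → (x ∷ y ∷ z ∷ []) ↭ (y ∷ z ∷ x ∷ [])
    ro {x} {y} {z} = ↭-trans (swap x y ↭-refl) (prep y (swap x z ↭-refl))
    ro⁻ : ∀ {x y z : Fin m} → (x ∷ y ∷ z ∷ []) ↭ (z ∷ x ∷ y ∷ [])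
    ro⁻ = ↭-sym ro
    tog : ∀ {e e′ X Y} → X ↭ Y → Trace (Toggle e e′ (_∈ X)) → Trace (Toggle e e′ (_∈ Y))
    tog {e} {e′} p = trace-resp (λ x _ → by p x) (λ x _ → by (↭-sym p) x)
      where
      by : ∀ {X Y} → X ↭ Y → ∀ x → Toggle e e′ (_∈ X) x → Toggle e e′ (_∈ Y) x
      by p x (inj₁ (a , b , q)) = inj₁ (a , b , ∈-resp-↭ p q)
      by p x (inj₂ (a , q))     = inj₂ (a , q ∘ ∈-resp-↭ (↭-sym p))
    toggle-comm : ∀ {e e′ Q} → Trace (Toggle e e′ Q) → Trace (Toggle e′ e Q)
    toggle-comm {e} {e′} {Q} = trace-resp (λ x _ → flip x) (λ x _ → flip x)
      where
      flip : ∀ {p q} x → Toggle p q Q x → Toggle q p Q x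
      flip x (inj₁ (h , k , l))  = inj₁ (k , h , l)
      flip x (inj₂ (inj₁ h , l)) = inj₂ (inj₂ h , l)
      flip x (inj₂ (inj₂ h , l)) = inj₂ (inj₁ h , l)
    quad : ∀ {x y z w} → A x → A y → A z → A w → x ≢ y → x ≢ z → y ≢ z → w ≢ x → w ≢ y → w ≢ z →
           Feas (x ∷ y ∷ z ∷ []) → Feas (w ∷ y ∷ z ∷ []) ⊎ Feas (x ∷ w ∷ z ∷ []) ⊎ Feas (x ∷ y ∷ w ∷ [])
    quad {x} {y} {z} {w} Ax Ay Az Aw xy xz yz wx wy wz t
      with exchange (top Aw) t w (bd Aw) (here refl) (∉-3 wx wy wz)
    ... | e′ , _ , e′≢w , inj₁ (here r , _) , _ = ⊥-elim (e′≢w r)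
    ... | _ , _ , _ , inj₂ (_ , here refl) , _ , s =
      inj₁ (replace (∉-2 xy xz) (∉-3 wx wy wz) s)
    ... | _ , _ , _ , inj₂ (_ , there (here refl)) , _ , s =
      inj₂ (inj₁ (feas-perm sw (replace (∉-2 (xy ∘ sym) yz) (∉-3 wy wx wz) (tog sw s))))
    ... | _ , _ , _ , inj₂ (_ , there (there (here refl))) , _ , s =
      inj₂ (inj₂ (feas-perm ro (replace (∉-2 (xz ∘ sym) (yz ∘ sym)) (∉-3 wz wx wy) (tog ro⁻ s))))
    join : ∀ {o a b c d} → A o → A a → A b → A c → A d →
           o ≢ a → o ≢ b → o ≢ c → o ≢ d → a ≢ b → a ≢ c → a ≢ d → b ≢ c → b ≢ d → c ≢ d →
           Feas (o ∷ a ∷ b ∷ []) → Feas (o ∷ c ∷ d ∷ []) →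
           Feas (o ∷ a ∷ b ∷ c ∷ d ∷ []) ⊎ (Feas (o ∷ b ∷ c ∷ []) × Feas (o ∷ a ∷ d ∷ []))
                                         ⊎ (Feas (o ∷ a ∷ c ∷ []) × Feas (o ∷ b ∷ d ∷ []))
    join {o} {a} {b} {c} {d} Ao Aa Ab Ac Ad oa ob oc od ab ac ad bc bd′ cd t s
      with exchange t s a (bd Aa) (there (here refl)) (∉-3 (oa ∘ sym) ac ad)
    ... | _ , _ , _ , inj₁ (here refl , q) , _ = ⊥-elim (q (here refl))
    ... | _ , _ , e′≢a , inj₁ (there (here r) , _) , _ = ⊥-elim (e′≢a r)
    ... | _ , _ , _ , inj₁ (there (there (here refl)) , _) , _ , s′ =
      inj₁ (feas-perm (↭-trans (prep a (swap b o ↭-refl)) (swap a o ↭-refl))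
             (add (∉-3 (oa ∘ sym) ac ad) (∉-3 (ob ∘ sym) bc bd′) s′))
    ... | _ , _ , _ , inj₂ (q , here refl) , _ = ⊥-elim (q (here refl))
    ... | _ , _ , _ , inj₂ (_ , there (here refl)) , t′ , s′ =
      inj₂ (inj₁ ( feas-perm ro (replace (∉-2 (oa ∘ sym) ab) (∉-3 (ac ∘ sym) (oc ∘ sym) (bc ∘ sym)) (tog sw (toggle-comm t′)))
                 , feas-perm sw (replace (∉-2 (oc ∘ sym) cd) (∉-3 ac (oa ∘ sym) ad) (tog sw s′))))
    ... | _ , _ , _ , inj₂ (_ , there (there (here refl))) , t′ , s′ =
      inj₂ (inj₂ ( feas-perm sw (replace (∉-2 (od ∘ sym) (cd ∘ sym)) (∉-3 ad (oa ∘ sym) ac) (tog ro⁻ s′))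
                 , feas-perm ro (replace (∉-2 (oa ∘ sym) ab) (∉-3 (ad ∘ sym) (od ∘ sym) (bd′ ∘ sym)) (tog sw (toggle-comm t′)))))
    cover : ∀ {x y} → A x → A y → x ≢ y → Σ (Fin m) λ z → A z × z ≢ x × z ≢ y × Feas (x ∷ y ∷ z ∷ [])
    cover {x} {y} Ax Ay x≢y with exchange whole (top Ax) y (bd Ay) Ay (λ { (here r) → x≢y (sym r) })
    ... | z , _ , z≢y , inj₁ (Az , z∉) , _ , s = z , Az , (z∉ ∘ here) , z≢y ,
      feas-perm ro⁻ (add (λ { (here r) → x≢y (sym r) }) z∉ s)
    ... | _ , _ , _ , inj₂ (¬Az , here refl) , _ = ⊥-elim (¬Az Ax)

module _ {n m : ℕ} (G : Net n m) (P : Fin m → Set) (P-noloop : ∀ {e} → P e → Net.src G e ≢ Net.tgt G e) where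
  open Net G

  -- Edges that meet U are taken from the first matching, all others from the second; on the
  -- boundary both consist of X.
  glue : ∀ {U X} → Unique X → (∀ {e} → e ∈ X → cross G U e ≡ true) → Feas G P U X → Feas G P (not ∘ U) X →
         Σ (PM G) λ M → (∀ e → proj₁ M e ≡ true → P e) × cut G U (⟦_⟧ ∘ proj₁ M) ≡ + length X
  glue {U} {X} u bd t s = (M , isPM (λ e q → P-noloop (supp e q)) degree) , supp , size
    where
    module T = Trace t
    module S = Trace s
    M : Fin m → Bool
    M e = if U (src e) ∨ U (tgt e) then T.f e else S.f e
    supp : ∀ e → M e ≡ true → P e
    supp e q with U (src e) ∨ U (tgt e)
    ... | true  = T.supp e q
    ... | false = S.supp e q
    on-boundary : ∀ e → cross G U e ≡ true → T.f e ≡ S.f e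
    on-boundary e c = by (bool-cases (T.f e)) (bool-cases (S.f e))
      where
      c′ : cross G (not ∘ U) e ≡ true
      c′ = trans (cross-∁ G U e) c
      by : T.f e ≡ true ⊎ T.f e ≡ false → S.f e ≡ true ⊎ S.f e ≡ false → T.f e ≡ S.f e
      by (inj₁ p) _        = trans p (sym (S.bd⇐ e c′ (T.bd⇒ e c p)))
      by (inj₂ p) (inj₂ q) = trans p (sym q)
      by (inj₂ p) (inj₁ q) = ⊥-elim (true≢false (T.bd⇐ e c (S.bd⇒ e c′ q)) p)
    M-T : ∀ e v → U v ≡ true → inc G e v ≡ true → M e ≡ T.f e
    M-T e v Uv i with inc⇒end G e v i
    ... | inj₁ refl rewrite Uv = refl
    ... | inj₂ refl rewrite Uv | Boolₚ.∨-zeroʳ (U (src e)) = refl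
    M-cross : ∀ e → cross G U e ≡ true → M e ≡ T.f e
    M-cross e c with cross⇒end G {U} c
    ... | u , Uu , i = M-T e u Uu i
    M-S : ∀ e v → U v ≡ false → inc G e v ≡ true → M e ≡ S.f e
    M-S e v Uv i = by (bool-cases (cross G U e))
      where
      by : cross G U e ≡ true ⊎ cross G U e ≡ false → M e ≡ S.f e
      by (inj₁ c) = trans (M-cross e c) (on-boundary e c)
      by (inj₂ c) with inc⇒end G e v i
      ... | inj₁ refl rewrite Uv | c = refl
      ... | inj₂ refl rewrite Uv | trans (sym (Boolₚ.xor-identityʳ (U (src e)))) c = refl
    degree : ∀ v → alive v ≡ true → deg G v (⟦_⟧ ∘ M) ≡ 1ℤ
    degree v av = trans (cut-count G (_== v) M) (unique⇒∑ (by (bool-cases (U v))))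
      where
      by : U v ≡ true ⊎ U v ≡ false → ExactlyOne (λ e → inc G e v ∧ M e)
      by (inj₁ Uv) = unique-cong G (λ e i → sym (M-T e v Uv i)) (T.sat v av Uv)
      by (inj₂ Uv) = unique-cong G (λ e i → sym (M-S e v Uv i)) (S.sat v av (cong not Uv))
    size : cut G U (⟦_⟧ ∘ M) ≡ + length X
    size = trans (cut-count G U M) (∑-list u (λ e → cross G U e ∧ M e)
      (λ e q → T.bd⇒ e (∧-elimˡ q) (trans (sym (M-cross e (∧-elimˡ q))) (∧-elimʳ (cross G U e) q)))
      (λ e e∈ → ∧-intro (bd e∈) (trans (M-cross e (bd e∈)) (T.bd⇐ e (bd e∈) e∈))))

  pm-saturates : ∀ {M} → IsPM G M → ∀ U → Saturates G U M
  pm-saturates {M} pm U v av _ = ∑⇒unique (trans (sym (cut-count G (_== v) M)) (IsPM.deg≡1 pm v av))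

  -- Here A is M ∩ δ(U), and the two families are the traces on A from U and from its complement. A
  -- common member of size 3 or 5 is glued to a perfect matching; if there is none,
  -- `no-exchange-pair` refutes the existence of o and a. The third hypothesis supplies the
  -- singletons.
  small-crossing : (U : Fin n → Bool) (M : PM G) → (∀ e → proj₁ M e ≡ true → P e) →
    (∀ e → cross G U e ≡ true → proj₁ M e ≡ true →
       Σ (PM G) λ N → (∀ x → proj₁ N x ≡ true → P x) × proj₁ N e ≡ true × (∀ x → cross G U x ≡ true → proj₁ N x ≡ true → x ≡ e)) →
    ∀ {o a} → cross G U o ≡ true → proj₁ M o ≡ true → cross G U a ≡ true → proj₁ M a ≡ true → o ≢ a →
    ((M′ : PM G) → (∀ e → proj₁ M′ e ≡ true → P e) →
       cut G U (⟦_⟧ ∘ proj₁ M′) ≡ + 3 ⊎ cut G U (⟦_⟧ ∘ proj₁ M′) ≡ + 5 → ⊥) → ⊥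
  small-crossing U (M , pm) M⊆P top {o} {a} co Mo ca Ma o≢a k =
    no-exchange-pair A F fam
      (λ u As l f g → let M′ , s , c = glue u (members As) f g in
        k M′ s ([ (λ q → inj₁ (trans c (cong +_ q))) , (λ q → inj₂ (trans c (cong +_ q))) ]′ l))
      o (co , Mo) S (λ z∈ → proj₂ (∈-filter⁻ V? {xs = allFin m} z∈)) (λ {z} Vz → ∈-filter⁺ V? (∈-allFin z) Vz) (ca , Ma) o≢a
    where
    A : Fin m → Set
    A e = cross G U e ≡ true × M e ≡ true
    side : Bool → Fin n → Bool
    side true  = U
    side false = not ∘ U
    cross-side : ∀ c e → cross G (side c) e ≡ cross G U e
    cross-side true  e = refl
    cross-side false e = cross-∁ G U e
    F : Bool → List (Fin m) → Set
    F c = Feas G P (side c)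
    members : ∀ {X} → All A X → ∀ {e} → e ∈ X → cross G U e ≡ true
    members h e∈ = proj₁ (All.lookup h e∈)
    V? : (z : Fin m) → Dec (A z × o ≢ z)
    V? z = ((cross G U z Boolₚ.≟ true) ×-dec (M z Boolₚ.≟ true)) ×-dec ¬? (o ≟ z)
    S : List (Fin m)
    S = filter V? (allFin m)
    fam : ∀ c → ExchangeFamily A (F c)
    fam c = family G P (side c) A (λ {e} Ae → trans (cross-side c e) (proj₁ Ae))
      (record { f = M ; sat = pm-saturates pm (side c) ; supp = M⊆P
              ; bd⇒ = λ e x q → trans (sym (cross-side c e)) x , q ; bd⇐ = λ e _ → proj₂ })
      (λ {e} Ae → let (N , pmN) , N⊆P , Ne , only = top e (proj₁ Ae) (proj₂ Ae) in record
        { f = N ; sat = pm-saturates pmN (side c) ; supp = N⊆P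
        ; bd⇒ = λ x cx q → here (only x (trans (sym (cross-side c x)) cx) q)
        ; bd⇐ = λ { x _ (here refl) → Ne } })

-- Contraction along a tight cut

+-cancelˡ : ∀ a {b c : ℤ} → a + b ≡ a + c → b ≡ c
+-cancelˡ a {b} {c} p = trans (sym (lem a b)) (trans (cong (_- a) p) (lem a c))
  where
  lem : ∀ a b → a + b - a ≡ b
  lem = solve-∀

module _ {n m : ℕ} (G : Net n m) where
  open Net G

  -- Edmonds' description of the cone of perfect matchings. Loops must have weight 0, as contraction
  -- creates them and no inequality sees them.
  record Good (x : Fin m → ℤ) (r : ℤ) : Set where
    constructor good
    field
      nonneg : ∀ e → 0ℤ ≤ x e
      loop≡0 : ∀ e → src e ≡ tgt e → x e ≡ 0ℤ
      deg≡r  : ∀ v → alive v ≡ true → deg G v x ≡ r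
      r≤cut  : ∀ {U} → Odd G U → r ≤ cut G U x

  inside : (Fin n → Bool) → Fin m → Bool
  inside T e = T (src e) ∧ T (tgt e)

  -- The image of x under contraction of T: the edges inside T become loops and lose their weight.
  outside-of : (Fin n → Bool) → (Fin m → ℤ) → Fin m → ℤ
  outside-of T x e = if inside T e then 0ℤ else x e

  cross⇒¬inside : ∀ T e → cross G T e ≡ true → inside T e ≡ false
  cross⇒¬inside T e c with T (src e) | T (tgt e)
  ... | true  | false = refl
  ... | false | true  = refl
  cross⇒¬inside T e () | true | true

  module _ (T : Fin n → Bool) (t₀ : Fin n) (at₀ : alive t₀ ≡ true) (Tt₀ : T t₀ ≡ true) where

    collapse : Fin n → Fin n
    collapse v = if T v then t₀ else v

    keep : Fin n → Bool
    keep v = alive v ∧ (not (T v) ∨ (v == t₀))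

    keep-collapse : ∀ v → alive v ≡ true → keep (collapse v) ≡ true
    keep-collapse v av with T v in q
    ... | true  rewrite at₀ | Tt₀ = ==-refl t₀
    ... | false rewrite av | q = refl

    contract : Net n m
    contract = record
      { alive = keep ; src = collapse ∘ src ; tgt = collapse ∘ tgt
      ; src-alive = λ e → keep-collapse _ (src-alive e) ; tgt-alive = λ e → keep-collapse _ (tgt-alive e) }

    -- The odd set T is replaced by the single vertex `t₀`, which keeps parities. So odd sets of the
    -- contraction pull back to odd sets of G.
    contract-parity : Odd G T → ∀ (S : Fin n → Bool) → ⨁ (λ v → keep v ∧ S v) ≡ ⨁ (λ v → alive v ∧ S (collapse v))
    contract-parity odd S = begin
      ⨁ (λ v → keep v ∧ S v)
        ≡⟨ ⨁-cong new ⟩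
      ⨁ (λ v → ((v == t₀) ∧ S t₀) xor rest v)
        ≡⟨ ⨁-xor (λ v → (v == t₀) ∧ S t₀) rest ⟩
      ⨁ (λ v → (v == t₀) ∧ S t₀) xor ⨁ rest
        ≡⟨ cong (_xor ⨁ rest) (⨁-delta t₀ (λ _ → S t₀)) ⟩
      S t₀ xor ⨁ rest
        ≡⟨ cong (_xor ⨁ rest) (sym part) ⟩
      ⨁ (λ v → S t₀ ∧ (alive v ∧ T v)) xor ⨁ rest
        ≡⟨ ⨁-xor (λ v → S t₀ ∧ (alive v ∧ T v)) rest ⟨
      ⨁ (λ v → (S t₀ ∧ (alive v ∧ T v)) xor rest v)
        ≡⟨ ⨁-cong old ⟨
      ⨁ (λ v → alive v ∧ S (collapse v)) ∎
      where
      open ≡-Reasoning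
      rest : Fin n → Bool
      rest v = alive v ∧ (not (T v) ∧ S v)
      part : ⨁ (λ v → S t₀ ∧ (alive v ∧ T v)) ≡ S t₀
      part = trans (⨁-∧ (S t₀) (λ v → alive v ∧ T v)) (trans (cong (S t₀ ∧_) odd) (Boolₚ.∧-identityʳ (S t₀)))
      old : ∀ v → alive v ∧ S (collapse v) ≡ (S t₀ ∧ (alive v ∧ T v)) xor rest v
      old v with alive v | T v
      ... | true  | true  = sym (trans (Boolₚ.xor-identityʳ _) (Boolₚ.∧-identityʳ (S t₀)))
      ... | true  | false rewrite Boolₚ.∧-zeroʳ (S t₀) = refl
      ... | false | _     rewrite Boolₚ.∧-zeroʳ (S t₀) = refl
      new : ∀ v → keep v ∧ S v ≡ ((v == t₀) ∧ S t₀) xor rest v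
      new v with v ≟ t₀
      ... | yes refl = lem at₀ Tt₀ (S v)
        where
        lem : ∀ {a t} → a ≡ true → t ≡ true → ∀ s → (a ∧ (not t ∨ true)) ∧ s ≡ s xor (a ∧ (not t ∧ s))
        lem refl refl s = sym (Boolₚ.xor-identityʳ s)
      ... | no _ = lem (alive v) (not (T v)) (S v)
        where
        lem : ∀ a t s → (a ∧ (t ∨ false)) ∧ s ≡ a ∧ (t ∧ s)
        lem a t s rewrite Boolₚ.∨-identityʳ t = Boolₚ.∧-assoc a t s

    collapse-t₀ : ∀ u → (collapse u == t₀) ≡ T u
    collapse-t₀ u with T u in q
    ... | true  = ==-refl t₀
    ... | false = ≢⇒== {i = u} {t₀} λ { refl → true≢false Tt₀ q }

    collapse-other : ∀ {v} → T v ≡ false → ∀ u → (collapse u == v) ≡ (u == v)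
    collapse-other {v} ¬Tv u with T u in q
    ... | true  = trans (≢⇒== {i = t₀} {v} λ { refl → true≢false Tt₀ ¬Tv }) (sym (≢⇒== {i = u} {v} λ { refl → true≢false q ¬Tv }))
    ... | false = refl

    keep-cases : ∀ v → keep v ≡ true → v ≡ t₀ ⊎ (alive v ≡ true × T v ≡ false)
    keep-cases v kv with v ≟ t₀ | T v
    ... | yes r | _     = inj₁ r
    ... | no _  | false = inj₂ (∧-elimˡ kv , refl)
    ... | no _  | true  = ⊥-elim (true≢false kv (Boolₚ.∧-zeroʳ (alive v)))

    contract-deg-t₀ : ∀ x → deg contract t₀ x ≡ cut G T x
    contract-deg-t₀ x = cut-cong G (λ v _ → collapse-t₀ v) (λ _ _ → refl)

    contract-deg : ∀ {v} → T v ≡ false → ∀ x → deg contract v x ≡ deg G v x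
    contract-deg ¬Tv x = cut-cong G (λ u _ → collapse-other ¬Tv u) (λ _ _ → refl)

    inside⇒loop : ∀ e → inside T e ≡ true → collapse (src e) ≡ collapse (tgt e)
    inside⇒loop e i rewrite ∧-elimˡ {T (src e)} i | ∧-elimʳ (T (src e)) i = refl

    cross⇒¬inside′ : ∀ S e → cross contract S e ≡ true → inside T e ≡ false
    cross⇒¬inside′ S e c = ¬-not λ i → true≢false c
      (trans (cong (λ v → S (collapse (src e)) xor S v) (sym (inside⇒loop e i))) (Boolₚ.xor-same (S (collapse (src e)))))

    outside-cut : ∀ S x → cut contract S (outside-of T x) ≡ cut contract S x
    outside-cut S x = cut-cong contract {S} {S} (λ _ _ → refl)
      (λ e c → cong (λ b → if b then 0ℤ else x e) (cross⇒¬inside′ S e c))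

    contract-even : Odd G T → ⨁ alive ≡ false → ⨁ keep ≡ false
    contract-even odd even = trans (⨁-cong (λ v → sym (Boolₚ.∧-identityʳ (keep v))))
      (trans (contract-parity odd (λ _ → true)) (trans (⨁-cong (λ v → Boolₚ.∧-identityʳ (alive v))) even))

    contract-smaller : ∀ {t₁} → alive t₁ ≡ true → T t₁ ≡ true → t₁ ≢ t₀ → count keep ℕ.< count alive
    contract-smaller {t₁} at₁ Tt₁ ne = count-strict (λ v q → ∧-elimˡ q) t₁
      (trans (cong₂ (λ a b → alive t₁ ∧ (not a ∨ b)) Tt₁ (≢⇒== ne)) (Boolₚ.∧-zeroʳ (alive t₁))) at₁

-- Tightness is exactly what gives the new vertex degree r; the other conditions pull back along the
-- contraction.
contract-good : ∀ {n m} (G : Net n m) T t₀ at₀ Tt₀ {x r} → Odd G T → Good G x r → cut G T x ≡ r →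
                Good (contract G T t₀ at₀ Tt₀) (outside-of G T x) r
contract-good {n} {m} G T t₀ at₀ Tt₀ {x} {r} odd g tight = good nn lp dg ct
  where
  open Net G
  open Good g
  G′ = contract G T t₀ at₀ Tt₀
  nn : ∀ e → 0ℤ ≤ outside-of G T x e
  nn e with inside G T e
  ... | true  = ℤₚ.≤-refl
  ... | false = nonneg e
  lp : ∀ e → Net.src G′ e ≡ Net.tgt G′ e → outside-of G T x e ≡ 0ℤ
  lp e q with T (src e) in a | T (tgt e) in b
  ... | true  | true  = refl
  ... | true  | false = ⊥-elim (true≢false (trans (cong T (sym q)) Tt₀) b)
  ... | false | true  = ⊥-elim (true≢false (trans (cong T q) Tt₀) a)
  ... | false | false = loop≡0 e q
  dg : ∀ v → Net.alive G′ v ≡ true → deg G′ v (outside-of G T x) ≡ r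
  dg v kv with keep-cases G T t₀ at₀ Tt₀ v kv
  ... | inj₁ refl = trans (outside-cut G T t₀ at₀ Tt₀ (_== v) x) (trans (contract-deg-t₀ G T t₀ at₀ Tt₀ x) tight)
  ... | inj₂ (av , ¬Tv) = trans (outside-cut G T t₀ at₀ Tt₀ (_== v) x) (trans (contract-deg G T t₀ at₀ Tt₀ ¬Tv x) (deg≡r v av))
  ct : ∀ {S} → Odd G′ S → r ≤ cut G′ S (outside-of G T x)
  ct {S} o = subst (r ≤_) (sym (outside-cut G T t₀ at₀ Tt₀ S x))
    (r≤cut (trans (sym (contract-parity G T t₀ at₀ Tt₀ odd S)) o))

module _ {n m : ℕ} (G : Net n m) (T : Fin n → Bool)
         (t₀ : Fin n) (at₀ : Net.alive G t₀ ≡ true) (Tt₀ : T t₀ ≡ true)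
         (t₁ : Fin n) (at₁ : Net.alive G t₁ ≡ true) (¬Tt₁ : T t₁ ≡ false) where
  open Net G

  G₁ G₂ : Net n m
  G₁ = contract G T t₀ at₀ Tt₀
  G₂ = contract G (not ∘ T) t₁ at₁ (cong not ¬Tt₁)

  boundary₁ : ∀ {N} → IsPM G₁ N → ExactlyOne (λ e → cross G T e ∧ N e)
  boundary₁ {N} pm = ∑⇒unique (trans (sym (cut-count G T N))
    (trans (sym (contract-deg-t₀ G T t₀ at₀ Tt₀ (⟦_⟧ ∘ N)))
           (IsPM.deg≡1 pm t₀ (trans (cong₂ (λ a b → a ∧ (not b ∨ (t₀ == t₀))) at₀ Tt₀) (==-refl t₀)))))

  boundary₂ : ∀ {N} → IsPM G₂ N → ExactlyOne (λ e → cross G T e ∧ N e)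
  boundary₂ {N} pm = ∑⇒unique (trans (sym (cut-count G T N)) (trans (sym (cut-∁ G T (⟦_⟧ ∘ N)))
    (trans (sym (contract-deg-t₀ G (not ∘ T) t₁ at₁ (cong not ¬Tt₁) (⟦_⟧ ∘ N)))
           (IsPM.deg≡1 pm t₁ (trans (cong₂ (λ a b → a ∧ (not (not b) ∨ (t₁ == t₁))) at₁ ¬Tt₁) (==-refl t₁))))))

  same-boundary : ∀ {p q : Fin m → Bool} → ExactlyOne (λ e → cross G T e ∧ p e) → ExactlyOne (λ e → cross G T e ∧ q e) →
                  ∀ {e₀} → cross G T e₀ ≡ true → p e₀ ≡ true → q e₀ ≡ true → ∀ e → cross G T e ≡ true → p e ≡ q e
  same-boundary {p} {q} (_ , u) (_ , w) {e₀} c₀ pe₀ qe₀ e c with p e in a | q e in b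
  ... | true  | true  = refl
  ... | false | false = refl
  ... | true  | false with u e e₀ (∧-intro c a) (∧-intro c₀ pe₀)
  ...   | refl = ⊥-elim (true≢false qe₀ b)
  same-boundary {p} {q} (_ , u) (_ , w) {e₀} c₀ pe₀ qe₀ e c | false | true with w e e₀ (∧-intro c b) (∧-intro c₀ qe₀)
  ...   | refl = ⊥-elim (true≢false pe₀ a)

  paste : (Fin m → Bool) → (Fin m → Bool) → Fin m → Bool
  paste p q e = if inside G T e then q e else p e

  -- At a vertex of T all edges may be read in q, since those in the cut belong to both or to
  -- neither; at any other vertex all edges come from p.
  paste-pm : ∀ {p q} → IsPM G₁ p → IsPM G₂ q → (∀ e → cross G T e ≡ true → p e ≡ q e) → IsPM G (paste p q)
  paste-pm {p} {q} pm₁ pm₂ agree = isPM nl dg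
    where
    nl : ∀ e → paste p q e ≡ true → src e ≢ tgt e
    nl e r s≡t with inside G T e
    ... | true  = IsPM.noloop pm₂ e r (cong (collapse G (not ∘ T) t₁ at₁ (cong not ¬Tt₁)) s≡t)
    ... | false = IsPM.noloop pm₁ e r (cong (collapse G T t₀ at₀ Tt₀) s≡t)
    at-T : ∀ {v} → T v ≡ true → ∀ e → inc G e v ≡ true → paste p q e ≡ q e
    at-T {v} Tv e i with inside G T e in r
    ... | true  = refl
    ... | false = agree e (by (inc⇒end G e v i))
      where
      by : src e ≡ v ⊎ tgt e ≡ v → cross G T e ≡ true
      by (inj₁ refl) rewrite Tv = cong not r
      by (inj₂ refl) rewrite Tv | Boolₚ.∧-identityʳ (T (src e)) | r = refl
    at-¬T : ∀ {v} → T v ≡ false → ∀ e → inc G e v ≡ true → paste p q e ≡ p e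
    at-¬T {v} ¬Tv e i with inc⇒end G e v i
    ... | inj₁ refl rewrite ¬Tv = refl
    ... | inj₂ refl rewrite ¬Tv | Boolₚ.∧-zeroʳ (T (src e)) = refl
    dg : ∀ v → alive v ≡ true → deg G v (⟦_⟧ ∘ paste p q) ≡ 1ℤ
    dg v av with T v in Tv
    ... | true  = trans (cut-cong G {_== v} {_== v} (λ _ _ → refl) (λ e i → cong ⟦_⟧ (at-T Tv e i)))
      (trans (sym (contract-deg G (not ∘ T) t₁ at₁ (cong not ¬Tt₁) (cong not Tv) (⟦_⟧ ∘ q)))
             (IsPM.deg≡1 pm₂ v (cong₂ (λ a b → a ∧ (not (not b) ∨ (v == t₁))) av Tv)))
    ... | false = trans (cut-cong G {_== v} {_== v} (λ _ _ → refl) (λ e i → cong ⟦_⟧ (at-¬T Tv e i)))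
      (trans (sym (contract-deg G T t₀ at₀ Tt₀ Tv (⟦_⟧ ∘ p)))
             (IsPM.deg≡1 pm₁ v (cong₂ (λ a b → a ∧ (not b ∨ (v == t₀))) av Tv)))

  total-remove : ∀ {n m} {H : Net n m} xs (N : PM H) ys e → total H (xs ++ N ∷ ys) e ≡ ⟦ proj₁ N e ⟧ + total H (xs ++ ys) e
  total-remove []       N ys e = refl
  total-remove {H = H} (X ∷ xs) N ys e = trans (cong (λ s → ⟦ proj₁ X e ⟧ + s) (total-remove {H = H} xs N ys e))
    (lem ⟦ proj₁ X e ⟧ ⟦ proj₁ N e ⟧ (total H (xs ++ ys) e))
    where
    lem : ∀ a b c → a + (b + c) ≡ b + (a + c)
    lem = solve-∀

  -- Matchings are paired by their unique cut edge. As the totals agree on the cut, the cut edge of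
  -- the first matching in L₁ also occurs in a matching of L₂; removing the pair keeps the
  -- agreement. The lists run out together, because every matching has a cut edge.
  merge : ∀ L₁ L₂ → (∀ e → cross G T e ≡ true → total G₁ L₁ e ≡ total G₂ L₂ e) →
          Σ (List (PM G)) λ L → (∀ e → inside G T e ≡ true → total G L e ≡ total G₂ L₂ e) ×
                                (∀ e → inside G T e ≡ false → total G L e ≡ total G₁ L₁ e)
  merge [] [] h = [] , (λ _ _ → refl) , (λ _ _ → refl)
  merge [] ((N , pm) ∷ L₂) h with boundary₂ pm
  ... | (e , p) , _ = ⊥-elim (ℤₚ.<-irrefl (h e (∧-elimˡ p))
    (total-∈ G₂ ((N , pm) ∷ L₂) {e = e} (here refl) (∧-elimʳ (cross G T e) p)))
  merge ((N₁ , pm₁) ∷ L₁) L₂ h with boundary₁ pm₁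
  ... | (e₀ , p) , _ with total-pos G₂ L₂ {e₀} (subst (0ℤ <_) (h e₀ (∧-elimˡ p))
        (total-∈ G₁ ((N₁ , pm₁) ∷ L₁) {e = e₀} (here refl) (∧-elimʳ (cross G T e₀) p)))
  ...   | (N₂ , pm₂) , N₂∈ , q with ∈-∃++ N₂∈
  ...     | xs , ys , refl = (paste N₁ N₂ , paste-pm pm₁ pm₂ agree) ∷ L , in-T , out-T
    where
    agree : ∀ e → cross G T e ≡ true → N₁ e ≡ N₂ e
    agree = same-boundary {N₁} {N₂} (boundary₁ pm₁) (boundary₂ pm₂) (∧-elimˡ p) (∧-elimʳ (cross G T e₀) p) q
    split : ∀ e → total G₂ L₂ e ≡ ⟦ N₂ e ⟧ + total G₂ (xs ++ ys) e
    split = total-remove {H = G₂} xs (N₂ , pm₂) ys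
    rest : ∀ e → cross G T e ≡ true → total G₁ L₁ e ≡ total G₂ (xs ++ ys) e
    rest e c = +-cancelˡ ⟦ N₁ e ⟧ (trans (h e c) (trans (split e)
      (cong (λ b → ⟦ b ⟧ + total G₂ (xs ++ ys) e) (sym (agree e c)))))
    ih = merge L₁ (xs ++ ys) rest
    L = proj₁ ih
    in-T : ∀ e → inside G T e ≡ true → ⟦ paste N₁ N₂ e ⟧ + total G L e ≡ total G₂ L₂ e
    in-T e i = trans (cong₂ _+_ (cong (λ b → ⟦ if b then N₂ e else N₁ e ⟧) i) (proj₁ (proj₂ ih) e i)) (sym (split e))
    out-T : ∀ e → inside G T e ≡ false → ⟦ paste N₁ N₂ e ⟧ + total G L e ≡ ⟦ N₁ e ⟧ + total G₁ L₁ e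
    out-T e i = cong₂ _+_ (cong (λ b → ⟦ if b then N₂ e else N₁ e ⟧) i) (proj₂ (proj₂ ih) e i)

  dy-merge : ∀ {x} → Dy G₁ (outside-of G T x) → Dy G₂ (outside-of G (not ∘ T) x) → Dy G x
  dy-merge {x} (k , L₁ , p) (l , L₂ , q) = k ℕ.+ l , L , λ e → by e (bool-cases (inside G T e))
    where
    K₁ K₂ : ℤ
    K₁ = + (2 ^ k)
    K₂ = + (2 ^ l)
    eq₁ : ∀ e → inside G T e ≡ false → total G₁ (copies G₁ (2 ^ l) L₁) e ≡ K₁ * K₂ * x e
    eq₁ e i = trans (total-copies G₁ (2 ^ l) L₁ e) (trans (cong (K₂ *_) (trans (sym (p e))
      (cong (λ b → K₁ * (if b then 0ℤ else x e)) i))) (lem K₁ K₂ (x e)))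
      where
      lem : ∀ a b c → b * (a * c) ≡ a * b * c
      lem = solve-∀
    eq₂ : ∀ e → inside G (not ∘ T) e ≡ false → total G₂ (copies G₂ (2 ^ k) L₂) e ≡ K₁ * K₂ * x e
    eq₂ e i = trans (total-copies G₂ (2 ^ k) L₂ e) (trans (cong (K₁ *_) (trans (sym (q e))
      (cong (λ b → K₂ * (if b then 0ℤ else x e)) i))) (sym (ℤₚ.*-assoc K₁ K₂ (x e))))
    ¬both : ∀ e → inside G T e ≡ true → inside G (not ∘ T) e ≡ false
    ¬both e i rewrite ∧-elimˡ {T (src e)} i = refl
    merged = merge (copies G₁ (2 ^ l) L₁) (copies G₂ (2 ^ k) L₂) λ e c →
      trans (eq₁ e (cross⇒¬inside G T e c))
            (sym (eq₂ e (cross⇒¬inside G (not ∘ T) e (trans (cross-∁ G T e) c))))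
    L = proj₁ merged
    by : ∀ e → inside G T e ≡ true ⊎ inside G T e ≡ false → + (2 ^ (k ℕ.+ l)) * x e ≡ total G L e
    by e (inj₁ i) = trans (cong (_* x e) (2^+ G k l)) (sym (trans (proj₁ (proj₂ merged) e i) (eq₂ e (¬both e i))))
    by e (inj₂ i) = trans (cong (_* x e) (2^+ G k l)) (sym (trans (proj₂ (proj₂ merged) e i) (eq₁ e i)))

-- Leaving the cone along a ray

allVecs : ∀ n → List (Vec Bool n)
allVecs zero    = [] ∷ []
allVecs (suc n) = map (true ∷_) (allVecs n) ++ map (false ∷_) (allVecs n)

∈-allVecs : ∀ {n} (v : Vec Bool n) → v ∈ allVecs n
∈-allVecs []                = here refl
∈-allVecs {suc n} (true  ∷ v) = ∈-++⁺ˡ (∈-map⁺ (true ∷_) (∈-allVecs v))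
∈-allVecs {suc n} (false ∷ v) = ∈-++⁺ʳ (map (true ∷_) (allVecs n)) (∈-map⁺ (false ∷_) (∈-allVecs v))

-- fi * cj ≤ fj * ci compares the ratios fi / ci and fj / cj.
ratio-trans : ∀ {fi ci fj cj fk ck} → 0ℤ < cj → 0ℤ ≤ ci → 0ℤ ≤ ck →
              fi * cj ≤ fj * ci → fj * ck ≤ fk * cj → fi * ck ≤ fk * ci
ratio-trans {fi} {ci} {fj} {cj} {fk} {ck} cj>0 ci≥0 ck≥0 p q =
  ℤₚ.*-cancelʳ-≤-pos (fi * ck) (fk * ci) cj {{ℤ.positive cj>0}}
    (diff (subst (0ℤ ≤_) (lem fi ci fj cj fk ck) (0≤+ (0≤* (undiff p) ck≥0) (0≤* (undiff q) ci≥0))))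
  where
  lem : ∀ fi ci fj cj fk ck → (fj * ci - fi * cj) * ck + (fk * cj - fj * ck) * ci ≡ fk * ci * cj - fi * ck * cj
  lem = solve-∀

argmax : {A : Set} (f c : A → ℤ) (x : A) (xs : List A) → (∀ {i} → i ∈ x ∷ xs → 0ℤ < c i) →
         Σ A λ i → i ∈ x ∷ xs × (∀ {j} → j ∈ x ∷ xs → f j * c i ≤ f i * c j)
argmax f c x [] pos = x , here refl , λ { (here refl) → ℤₚ.≤-refl }
argmax f c x (y ∷ xs) pos with argmax f c y xs (pos ∘ there)
... | i , i∈ , max with f x * c i ℤₚ.≤? f i * c x
...   | yes p = i , there i∈ , λ { (here refl) → p ; (there j∈) → max j∈ }
...   | no ¬p = x , here refl , λ
  { (here refl) → ℤₚ.≤-refl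
  ; (there j∈)  → ratio-trans {f _} {c _} {f i} {c i} {f x} {c x} (pos (there i∈)) (ℤₚ.<⇒≤ (pos (there j∈))) (ℤₚ.<⇒≤ (pos (here refl)))
                    (max j∈) (ℤₚ.<⇒≤ (ℤₚ.≰⇒> ¬p)) }

two^ : ∀ j → j ℕ.≤ 2 ^ j
two^ zero    = ℕ.z≤n
two^ (suc j) = ℕₚ.≤-trans (ℕₚ.+-mono-≤ (ℕₚ.m^n>0 2 j) (two^ j)) (ℕₚ.≤-reflexive (cong (2 ^ j ℕ.+_) (sym (ℕₚ.+-identityʳ (2 ^ j)))))

-- Nontrivial odd cuts, complementary slackness, and a coprimality argument

module _ {n m : ℕ} (G : Net n m) where
  open Net G

  Regular : (Fin m → ℤ) → ℤ → Set
  Regular x r = ∀ v → alive v ≡ true → deg G v x ≡ r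

  record Two (U : Fin n → Bool) : Set where
    constructor two
    field
      u₀ u₁ : Fin n
      alive₀ : alive u₀ ≡ true
      alive₁ : alive u₁ ≡ true
      U₀     : U u₀ ≡ true
      U₁     : U u₁ ≡ true
      u₁≢u₀  : u₁ ≢ u₀

  two? : ∀ U → Dec (Two U)
  two? U = map′ (λ (a , b , (p , q) , (r , s) , t) → two a b p q r s t)
                (λ (two a b p q r s t) → a , b , (p , q) , (r , s) , t)
    (any? λ a → any? λ b → ((alive a Boolₚ.≟ true) ×-dec (alive b Boolₚ.≟ true)) ×-dec
                           (((U a Boolₚ.≟ true) ×-dec (U b Boolₚ.≟ true)) ×-dec ¬? (b ≟ a)))

  -- Two vertices on each side make both contractions smaller than G.
  record OddCut (U : Fin n → Bool) : Set where
    constructor oddCut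
    field
      odd   : Odd G U
      two-∈ : Two U
      two-∉ : Two (not ∘ U)

  oddCut? : ∀ U → Dec (OddCut U)
  oddCut? U = map′ (λ (a , b , c) → oddCut a b c) (λ (oddCut a b c) → a , b , c)
    ((⨁ (λ v → alive v ∧ U v) Boolₚ.≟ true) ×-dec (two? U ×-dec two? (not ∘ U)))

  singleton-cut : ∀ {U x r} → Odd G U → ¬ Two U → Regular x r → cut G U x ≡ r
  singleton-cut {U} {x} odd ¬two reg with ⨁-true (λ v → alive v ∧ U v) odd
  ... | v , p = trans (cut-cong G {U} {_== v} (λ u au → lem u au) (λ _ _ → refl)) (reg v (∧-elimˡ p))
    where
    lem : ∀ u → alive u ≡ true → U u ≡ u == v
    lem u au with u ≟ v
    ... | yes refl = ∧-elimʳ (alive v) p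
    ... | no u≢v   = ¬-not λ q → ¬two (two v u (∧-elimˡ p) au (∧-elimʳ (alive v) p) q u≢v)

  -- A side without two vertices is a single vertex by parity, and the cut is its star, whose weight
  -- is fixed by regularity. So only the finitely many members of `cuts` have to be watched.
  classify : ⨁ alive ≡ false → ∀ {U} → Odd G U → OddCut U ⊎ (∀ {x r} → Regular x r → cut G U x ≡ r)
  classify even {U} odd with two? U | two? (not ∘ U)
  ... | yes a | yes b = inj₁ (oddCut odd a b)
  ... | no ¬a | _     = inj₂ (singleton-cut odd ¬a)
  ... | yes _ | no ¬b = inj₂ λ {x} reg → trans (sym (cut-∁ G U x)) (singleton-cut (odd-∁ G even odd) ¬b reg)

  cuts : List (Vec Bool n)
  cuts = filter (λ T → oddCut? (lookup T)) (allVecs n)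

  ∈-cuts : ∀ {T} → T ∈ cuts → OddCut (lookup T)
  ∈-cuts T∈ = proj₂ (∈-filter⁻ (λ T → oddCut? (lookup T)) {xs = allVecs n} T∈)

  oddCut-resp : ∀ {U W} → (∀ v → U v ≡ W v) → OddCut U → OddCut W
  oddCut-resp h (oddCut o a b) = oddCut (odd-cong G (λ v _ → h v) o) (two-resp h a) (two-resp (cong not ∘ h) b)
    where
    two-resp : ∀ {U W} → (∀ v → U v ≡ W v) → Two U → Two W
    two-resp h (two a b p q r s t) = two a b p q (trans (sym (h a)) r) (trans (sym (h b)) s) t

  cuts-complete : ∀ {U} → OddCut U → Σ (Vec Bool n) λ T → T ∈ cuts × (∀ v → lookup T v ≡ U v)
  cuts-complete {U} c = tabulate U , ∈-filter⁺ (λ T → oddCut? (lookup T)) (∈-allVecs (tabulate U))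
    (oddCut-resp (λ v → sym (lookup∘tabulate U v)) c) , lookup∘tabulate U

  pm-regular : (M : PM G) → Regular (⟦_⟧ ∘ proj₁ M) 1ℤ
  pm-regular (_ , pm) = IsPM.deg≡1 pm

  -- Complementary slackness: every matching of a decomposition crosses T at least once, and once on
  -- average, because T weighs as much as the star of a vertex.
  tight⇒1 : ∀ {b r T K L} → Good G b r → Odd G T → cut G T b ≡ r → (∀ e → + K * b e ≡ total G L e) →
            ∀ {M} → M ∈ L → cut G T (⟦_⟧ ∘ proj₁ M) ≡ 1ℤ
  tight⇒1 {b} {r} {T} {K} {L} g odd tight dec M∈ with ⨁-true (λ v → alive v ∧ T v) odd
  ... | v , p = sym (lsum-equal G L (λ (M , pm) → pm-odd-cut≥1 G pm odd) sums M∈)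
    where
    av : alive v ≡ true
    av = ∧-elimˡ p
    ones : ∀ L → lsum G (λ M → deg G v (⟦_⟧ ∘ proj₁ M)) L ≡ lsum G (λ _ → 1ℤ) L
    ones []            = refl
    ones ((_ , pm) ∷ L) = cong₂ _+_ (IsPM.deg≡1 pm v av) (ones L)
    K*r : ∀ U → cut G U b ≡ r → lsum G (λ M → cut G U (⟦_⟧ ∘ proj₁ M)) L ≡ + K * r
    K*r U q = trans (sym (cut-total G U L)) (trans (cut-congʳ G {U} (λ e → sym (dec e)))
                (trans (cut-* G U (+ K) b) (cong (+ K *_) q)))
    sums : lsum G (λ _ → 1ℤ) L ≡ lsum G (λ M → cut G T (⟦_⟧ ∘ proj₁ M)) L
    sums = trans (sym (ones L)) (trans (K*r (_== v) (Good.deg≡r g v av)) (sym (K*r T tight)))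

  summand≢0 : ∀ {b : Fin m → ℤ} {k L} {N : PM G} {e} → (∀ e′ → + (2 ^ k) * b e′ ≡ total G L e′) → N ∈ L → proj₁ N e ≡ true → b e ≢ 0ℤ
  summand≢0 {b} {k} {L} {N} {e} dec N∈ Ne q = ℤₚ.<-irrefl {0ℤ} {total G L e} 0≡total (total-∈ G L {N} {e} N∈ Ne)
    where
    0≡total : 0ℤ ≡ total G L e
    0≡total = trans (sym (trans (cong (λ z → + (2 ^ k) * z) q) (ℤₚ.*-zeroʳ (+ (2 ^ k))))) (dec e)

  good-÷ : ∀ {f x r} → 0ℤ < f → Good G (λ e → f * x e) (f * r) → Good G x r
  good-÷ {f} {x} {r} f>0 (good nn lp dg ct) = good
    (λ e → ℤₚ.*-cancelˡ-≤-pos 0ℤ (x e) f (subst (_≤ f * x e) (sym (ℤₚ.*-zeroʳ f)) (nn e)))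
    (λ e q → ℤₚ.*-cancelˡ-≡ f (x e) 0ℤ (trans (lp e q) (sym (ℤₚ.*-zeroʳ f))))
    (λ v av → ℤₚ.*-cancelˡ-≡ f _ r (trans (sym (cut-* G (_== v) f x)) (dg v av)))
    (λ {U} o → ℤₚ.*-cancelˡ-≤-pos r (cut G U x) f (subst (f * r ≤_) (cut-* G U f x) (ct o)))
    where instance
      f-pos : ℤ.Positive f
      f-pos = ℤ.positive f>0
      f-nz : ℤ.NonZero f
      f-nz = ℤ.>-nonZero f>0

  dy-sub : ∀ {x y} → Dy G x → Dy G y → ∀ {z} → (∀ e → x e + y e ≡ z e) → Dy G z
  dy-sub p q h = dy-ext G h (dy-+ G p q)

  -- 2ʲ = a (N k + 1) + c k for a = 2ʲ mod k and j large
  dy-coprime : ∀ k N → 0ℤ < k → 0ℤ < N → ∀ {x} → Dy G (λ e → k * x e) → Dy G (λ e → (N * k + 1ℤ) * x e) → Dy G x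
  dy-coprime (+ zero) _ (ℤ.+<+ ())
  dy-coprime (+ suc k′) (+ N) _ _ {x} p q = dy-/2^ G j
    (dy-sub (dy-* G {+ a} (ℤ.+≤+ ℕ.z≤n) q) (dy-* G {c} c≥0 p) λ e → trans (lem₁ (+ a) (+ N) (+ k) c (x e)) (cong (_* x e) sum))
    where
    k j a d : ℕ
    k = suc k′
    -- Since j ≤ 2ʲ, the quotient d is at least k N; as a < k, the multiplier c = d - a N is
    -- nonnegative.
    j = k ℕ.* (k ℕ.* N)
    a = (2 ^ j) ℕ.% k
    d = (2 ^ j) ℕ./ k
    c : ℤ
    c = + d - + a * + N
    aN≤d : a ℕ.* N ℕ.≤ d
    aN≤d = ℕₚ.≤-trans (ℕₚ.*-monoˡ-≤ N (ℕₚ.<⇒≤ (m%n<n (2 ^ j) k)))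
      (subst (ℕ._≤ d) (trans (cong (ℕ._/ k) (ℕₚ.*-comm k (k ℕ.* N))) (m*n/n≡m (k ℕ.* N) k)) (/-monoˡ-≤ k (two^ j)))
    c≥0 : 0ℤ ≤ c
    c≥0 = undiff (subst (_≤ + d) (ℤₚ.pos-* a N) (ℤ.+≤+ aN≤d))
    lem₁ : ∀ a N k c x → a * ((N * k + 1ℤ) * x) + c * (k * x) ≡ (a * (N * k + 1ℤ) + c * k) * x
    lem₁ = solve-∀
    lem₂ : ∀ a N k d → a * (N * k + 1ℤ) + (d - a * N) * k ≡ a + d * k
    lem₂ = solve-∀
    sum : + a * (+ N * + k + 1ℤ) + c * + k ≡ + (2 ^ j)
    sum = trans (lem₂ (+ a) (+ N) (+ k) (+ d)) (trans (cong (λ z → + a + z) (sym (ℤₚ.pos-* d k)))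
      (cong +_ (sym (m≡m%n+[m/n]*n (2 ^ j) k))))

filter-shrinks : {A : Set} {P Q : A → Set} (P? : ∀ x → Dec (P x)) (Q? : ∀ x → Dec (Q x)) (xs : List A) →
                 (∀ {x} → x ∈ xs → P x → Q x) → length (filter P? xs) ℕ.≤ length (filter Q? xs)
filter-shrinks P? Q? [] h = ℕ.z≤n
filter-shrinks P? Q? (x ∷ xs) h with P? x | Q? x
... | yes _ | yes _ = ℕ.s≤s (filter-shrinks P? Q? xs (h ∘ there))
... | yes p | no ¬q = ⊥-elim (¬q (h (here refl) p))
... | no _  | yes _ = ℕₚ.m≤n⇒m≤1+n (filter-shrinks P? Q? xs (h ∘ there))
... | no _  | no _  = filter-shrinks P? Q? xs (h ∘ there)

filter-shrinks-strictly : {A : Set} {P Q : A → Set} (P? : ∀ x → Dec (P x)) (Q? : ∀ x → Dec (Q x)) (xs : List A) →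
                          (∀ {x} → x ∈ xs → P x → Q x) → ∀ {y} → y ∈ xs → ¬ P y → Q y →
                          length (filter P? xs) ℕ.< length (filter Q? xs)
filter-shrinks-strictly P? Q? (x ∷ xs) h (here refl) ¬p q with P? x | Q? x
... | yes p | _     = ⊥-elim (¬p p)
... | no _  | yes _ = ℕ.s≤s (filter-shrinks P? Q? xs (h ∘ there))
... | no _  | no ¬q = ⊥-elim (¬q q)
filter-shrinks-strictly P? Q? (x ∷ xs) h (there y∈) ¬p q with P? x | Q? x
... | yes _ | yes _ = ℕ.s≤s (filter-shrinks-strictly P? Q? xs (h ∘ there) y∈ ¬p q)
... | yes p | no ¬q = ⊥-elim (¬q (h (here refl) p))
... | no _  | yes _ = ℕₚ.m≤n⇒m≤1+n (filter-shrinks-strictly P? Q? xs (h ∘ there) y∈ ¬p q)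
... | no _  | no _  = filter-shrinks-strictly P? Q? xs (h ∘ there) y∈ ¬p q

0<1 : 0ℤ < 1ℤ
0<1 = ℤ.+<+ (ℕ.s≤s ℕ.z≤n)

0<+ : ∀ {a b} → 0ℤ < a → 0ℤ ≤ b → 0ℤ < a + b
0<+ p q = ℤₚ.+-mono-<-≤ p q

1≤ : ∀ {a} → 0ℤ < a → 0ℤ ≤ a - 1ℤ
1≤ {a} p = subst (0ℤ ≤_) (cong (_- 1ℤ) (ℤₚ.+-identityʳ a)) (<⇒1≤ p)

nonpos⇒0 : ∀ {a} → 0ℤ ≤ a → ¬ 0ℤ < a → a ≡ 0ℤ
nonpos⇒0 p ¬q = ℤₚ.≤-antisym (ℤₚ.≮⇒≥ ¬q) p

isPM? : ∀ {n m} (G : Net n m) (M : Fin m → Bool) → Dec (IsPM G M)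
isPM? G M = map′ (λ (p , q) → isPM p q) (λ (isPM p q) → p , q)
  (all? (λ e → (M e Boolₚ.≟ true) →-dec ¬? (Net.src G e ≟ Net.tgt G e)) ×-dec
   all? (λ v → (Net.alive G v Boolₚ.≟ true) →-dec (deg G v (⟦_⟧ ∘ M) ℤₚ.≟ 1ℤ)))

isPM-resp : ∀ {n m} (G : Net n m) {M N : Fin m → Bool} → (∀ e → M e ≡ N e) → IsPM G M → IsPM G N
isPM-resp G h (isPM p q) = isPM (λ e r → p e (trans (h e) r))
  (λ v av → trans (cut-congʳ G {_== v} (λ e → cong ⟦_⟧ (sym (h e)))) (q v av))

two-crossing : ∀ {n m} (G : Net n m) U (M : Fin m → Bool) → 1ℤ < cut G U (⟦_⟧ ∘ M) →
               Σ (Fin m) λ o → Σ (Fin m) λ a → (cross G U o ≡ true × M o ≡ true) × (cross G U a ≡ true × M a ≡ true) × o ≢ a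
two-crossing G U M h with ∑-pos (λ e → ⟦ cross G U e ∧ M e ⟧) (ℤₚ.<-trans 0<1 (subst (1ℤ <_) (cut-count G U M) h))
... | o , po with any? (λ a → ((cross G U a ∧ M a) Boolₚ.≟ true) ×-dec ¬? (o ≟ a))
...   | yes (a , pa , ne) = o , a , both o (⟦⟧-pos po) , both a pa , ne
  where
  both : ∀ e → cross G U e ∧ M e ≡ true → cross G U e ≡ true × M e ≡ true
  both e p = ∧-elimˡ p , ∧-elimʳ (cross G U e) p
...   | no none = ⊥-elim (ℤₚ.<-irrefl (sym (unique⇒∑ {p = p} ((o , ⟦⟧-pos po) , λ i j pi pj → trans (only i pi) (sym (only j pj)))))
                    (subst (1ℤ <_) (cut-count G U M) h))
  where
  p : _ → Bool
  p e = cross G U e ∧ M e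
  only : ∀ i → p i ≡ true → i ≡ o
  only i pi with o ≟ i
  ... | yes q = sym q
  ... | no q  = ⊥-elim (none (i , pi , q))

module _ {n m : ℕ} (G : Net n m) (even : ⨁ (Net.alive G) ≡ false) where
  open Net G

  good-by-cuts : ∀ {x r} → (∀ e → 0ℤ ≤ x e) → (∀ e → src e ≡ tgt e → x e ≡ 0ℤ) → Regular G x r →
                 (∀ {T} → T ∈ cuts G → r ≤ cut G (lookup T) x) → Good G x r
  good-by-cuts {x} {r} nn lp reg ct = good nn lp reg λ {U} odd → by (classify G even {U} odd)
    where
    by : ∀ {U} → OddCut G U ⊎ (∀ {x r} → Regular G x r → cut G U x ≡ r) → r ≤ cut G U x
    by {U} (inj₁ c) with cuts-complete G c
    ... | T , T∈ , eq = subst (r ≤_) (cut-cong G {lookup T} {U} (λ v _ → eq v) (λ _ _ → refl)) (ct T∈)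
    by (inj₂ q) = ℤₚ.≤-reflexive (sym (q reg))

  module _ {w : Fin m → ℤ} {r : ℤ} (gw : Good G w r)
           (strict : ∀ {T} → T ∈ cuts G → r < cut G (lookup T) w) where
    open Good gw

    data Hit (y : Fin m → ℤ) (ρ f c : ℤ) : Set where
      hit-edge : ∀ e → 0ℤ < w e → f ≡ y e → c ≡ w e → Hit y ρ f c
      hit-cut  : ∀ {T} → T ∈ cuts G → f ≡ cut G (lookup T) y - ρ → c ≡ cut G (lookup T) w - r → Hit y ρ f c

    -- The ray from w in the direction -y leaves the cone at the inequality with the
    -- largest ratio of its values f at y and c at w.
    hit : ∀ y ρ → Regular G y ρ → (∀ e → w e ≡ 0ℤ → y e ≡ 0ℤ) → ∀ e → 0ℤ < w e → 0ℤ < y e →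
          Σ ℤ λ f → Σ ℤ λ c → 0ℤ < f × 0ℤ < c × Hit y ρ f c × Good G (λ x → f * w x - c * y x) (f * r - c * ρ)
    hit y ρ reg zero-off e₀ we₀ ye₀ = f i , c i , fi>0 , cpos i∈ , kind i i∈ , g
      where
      c f : Fin m ⊎ Vec Bool n → ℤ
      c (inj₁ e) = w e
      c (inj₂ T) = cut G (lookup T) w - r
      f (inj₁ e) = y e
      f (inj₂ T) = cut G (lookup T) y - ρ
      pos? : ∀ e → Dec (0ℤ < w e)
      pos? e = 0ℤ ℤₚ.<? w e
      edges : List (Fin m)
      edges = filter pos? (allFin m)
      cons : List (Fin m ⊎ Vec Bool n)
      cons = map inj₁ edges ++ map inj₂ (cuts G)
      edge∈ : ∀ {e} → 0ℤ < w e → inj₁ e ∈ cons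
      edge∈ p = ∈-++⁺ˡ (∈-map⁺ inj₁ (∈-filter⁺ pos? (∈-allFin _) p))
      cut∈ : ∀ {T} → T ∈ cuts G → inj₂ T ∈ cons
      cut∈ T∈ = ∈-++⁺ʳ (map inj₁ edges) (∈-map⁺ inj₂ T∈)
      cpos′ : ∀ {i} → i ∈ cons → 0ℤ < c i
      cpos′ i∈ with ∈-++⁻ (map inj₁ edges) i∈
      ... | inj₁ p with ∈-map⁻ inj₁ p
      ...   | e , e∈ , refl = proj₂ (∈-filter⁻ pos? {xs = allFin m} e∈)
      cpos′ i∈ | inj₂ p with ∈-map⁻ inj₂ p
      ...   | T , T∈ , refl = 0<- (strict T∈)
      cpos : ∀ {i} → i ∈ inj₁ e₀ ∷ cons → 0ℤ < c i
      cpos (here refl) = we₀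
      cpos (there p)   = cpos′ p
      -- Putting `e₀` in front makes the list nonempty. Its ratio is positive, and therefore the
      -- largest one is.
      best = argmax f c (inj₁ e₀) cons cpos
      i = proj₁ best
      i∈ = proj₁ (proj₂ best)
      max = proj₂ (proj₂ best)
      fi>0 : 0ℤ < f i
      fi>0 = *-pos⁻¹ we₀ (subst (0ℤ <_) (ℤₚ.*-comm (f i) (w e₀))
               (ℤₚ.<-≤-trans (0<* ye₀ (cpos i∈)) (max (here refl))))
      kind : ∀ i → i ∈ inj₁ e₀ ∷ cons → Hit y ρ (f i) (c i)
      kind (inj₁ e) p = hit-edge e (cpos p) refl refl
      kind (inj₂ T) (there p) with ∈-++⁻ (map inj₁ edges) p
      ... | inj₁ q with ∈-map⁻ inj₁ q
      ...   | _ , _ , ()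
      kind (inj₂ T) (there p) | inj₂ q with ∈-map⁻ inj₂ q
      ...   | _ , T∈ , refl = hit-cut T∈ refl refl
      b : Fin m → ℤ
      b x = f i * w x - c i * y x
      g : Good G b (f i * r - c i * ρ)
      g = good-by-cuts nn lp (λ v av → trans (cut-lincomb G (_== v) (f i) (c i) w y) (cong₂ (λ p q → f i * p - c i * q) (deg≡r v av) (reg v av))) ct
        where
        zero-b : ∀ e → w e ≡ 0ℤ → b e ≡ 0ℤ
        zero-b e q rewrite q | zero-off e q = lem (f i) (c i)
          where
          lem : ∀ a b → a * 0ℤ - b * 0ℤ ≡ 0ℤ
          lem = solve-∀
        nn : ∀ e → 0ℤ ≤ b e
        nn e with pos? e
        ... | yes p = subst (0ℤ ≤_) (cong (λ z → f i * w e - z) (ℤₚ.*-comm (y e) (c i))) (undiff (max (there (edge∈ p))))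
        ... | no ¬p = ℤₚ.≤-reflexive (sym (zero-b e (nonpos⇒0 (nonneg e) ¬p)))
        lp : ∀ e → src e ≡ tgt e → b e ≡ 0ℤ
        lp e q = zero-b e (loop≡0 e q)
        ct : ∀ {T} → T ∈ cuts G → f i * r - c i * ρ ≤ cut G (lookup T) b
        ct {T} T∈ = diff (subst (0ℤ ≤_)
          (trans (lem (cut G (lookup T) w) (cut G (lookup T) y) r ρ (f i) (c i))
                 (cong (_- (f i * r - c i * ρ)) (sym (cut-lincomb G (lookup T) (f i) (c i) w y))))
          (undiff (max (there (cut∈ T∈)))))
          where
          lem : ∀ a b r ρ f c → f * (a - r) - (b - ρ) * c ≡ (f * a - c * b) - (f * r - c * ρ)
          lem = solve-∀

-- Descent along the boundary

module _ {n m : ℕ} (G : Net n m) (even : ⨁ (Net.alive G) ≡ false)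
         {w : Fin m → ℤ} {r : ℤ} (gw : Good G w r)
         (strict : ∀ {T} → T ∈ cuts G → r < cut G (lookup T) w)
         (solve-tight : ∀ {b s U} → Good G b s → OddCut G U → cut G U b ≡ s → Dy G b)
         (M : PM G) (M⊆w : ∀ e → proj₁ M e ≡ true → 0ℤ < w e) where
  open Net G
  open Good gw

  Tight : (Fin m → ℤ) → ℤ → Vec Bool n → Set
  Tight b s T = cut G (lookup T) b ≡ s

  tight? : ∀ b s T → Dec (Tight b s T)
  tight? b s T = cut G (lookup T) b ℤₚ.≟ s

  tights : (Fin m → ℤ) → ℤ → List (Vec Bool n)
  tights b s = filter (tight? b s) (cuts G)

  slack : Vec Bool n → ℤ
  slack T = cut G (lookup T) w - r

  slack-pos : ∀ {T} → T ∈ cuts G → 0ℤ < slack T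
  slack-pos T∈ = 0<- (strict T∈)

  excess : PM G → Vec Bool n → ℤ
  excess N T = cut G (lookup T) (⟦_⟧ ∘ proj₁ N) - 1ℤ

  -- Invariant of the descent: b is on the boundary of the cone because of cuts only.
  record Face (b : Fin m → ℤ) (s : ℤ) : Set where
    field
      good-b    : Good G b s
      full      : ∀ e → 0ℤ < w e → 0ℤ < b e
      zero-b    : ∀ e → w e ≡ 0ℤ → b e ≡ 0ℤ
      crossed   : ∀ {T} → T ∈ cuts G → Tight b s T → 1ℤ < cut G (lookup T) (⟦_⟧ ∘ proj₁ M)
      S         : Fin m → ℤ
      dy-S      : Dy G S
      k         : ℤ
      k>0       : 0ℤ < k
      b+S       : ∀ e → b e + S e ≡ k * w e

  Crosses3or5 : Vec Bool n → Set
  Crosses3or5 T = Σ (PM G) λ M′ → (∀ e → proj₁ M′ e ≡ true → 0ℤ < w e) ×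
    (cut G (lookup T) (⟦_⟧ ∘ proj₁ M′) ≡ + 3 ⊎ cut G (lookup T) (⟦_⟧ ∘ proj₁ M′) ≡ + 5)

  -- A finite search, which turns the doubly negated conclusion of `small-crossing` into an actual
  -- matching.
  crosses-3-or-5? : ∀ T → Dec (Crosses3or5 T)
  crosses-3-or-5? T = map′ to from (Any.any? cand? (allVecs m))
    where
    Cand : Vec Bool m → Set
    Cand v = IsPM G (lookup v) × (∀ e → lookup v e ≡ true → 0ℤ < w e) ×
      (cut G (lookup T) (⟦_⟧ ∘ lookup v) ≡ + 3 ⊎ cut G (lookup T) (⟦_⟧ ∘ lookup v) ≡ + 5)
    cand? : ∀ v → Dec (Cand v)
    cand? v = isPM? G (lookup v) ×-dec (all? (λ e → (lookup v e Boolₚ.≟ true) →-dec (0ℤ ℤₚ.<? w e)) ×-dec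
      ((cut G (lookup T) (⟦_⟧ ∘ lookup v) ℤₚ.≟ + 3) ⊎-dec (cut G (lookup T) (⟦_⟧ ∘ lookup v) ℤₚ.≟ + 5)))
    to : Any Cand (allVecs m) → Crosses3or5 T
    to a with Any.satisfied a
    ... | v , p , q , z = (lookup v , p) , q , z
    from : Crosses3or5 T → Any Cand (allVecs m)
    from ((N , p) , q , z) = lose (∈-allVecs (tabulate N))
      ( isPM-resp G (λ e → sym (eq e)) p
      , (λ e h → q e (trans (sym (eq e)) h))
      , [ (λ h → inj₁ (trans same h)) , (λ h → inj₂ (trans same h)) ]′ z )
      where
      eq : ∀ e → lookup (tabulate N) e ≡ N e
      eq = lookup∘tabulate N
      same : cut G (lookup T) (⟦_⟧ ∘ lookup (tabulate N)) ≡ cut G (lookup T) (⟦_⟧ ∘ N)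
      same = cut-congʳ G {lookup T} (λ e → cong ⟦_⟧ (eq e))

  pos⇒noloop : ∀ {e} → 0ℤ < w e → src e ≢ tgt e
  pos⇒noloop {e} p q = ℤₚ.<-irrefl (sym (loop≡0 e q)) p

  pos? : ∀ e → Dec (0ℤ < w e)
  pos? e = 0ℤ ℤₚ.<? w e

  -- As b is tight at T, it has a decomposition, whose matchings cross T once each. As b is positive
  -- on the support of w, every edge of M in the cut lies in one of them. These matchings provide
  -- the singletons for `small-crossing`.
  crosses-3-or-5 : ∀ {b s T} → Face b s → T ∈ cuts G → Tight b s T → Crosses3or5 T
  crosses-3-or-5 {b} {s} {T} face T∈ tight = decidable-stable (crosses-3-or-5? T) λ none →
    let o , a , (co , Mo) , (ca , Ma) , ne = two-crossing G (lookup T) (proj₁ M) (crossed T∈ tight)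
    in small-crossing G (λ e → 0ℤ < w e) pos⇒noloop (lookup T) M M⊆w top co Mo ca Ma ne
         (λ M′ sub c → none (M′ , sub , c))
    where
    open Face face
    dec = solve-tight good-b (∈-cuts G T∈) tight
    top : ∀ e → cross G (lookup T) e ≡ true → proj₁ M e ≡ true →
          Σ (PM G) λ N → (∀ x → proj₁ N x ≡ true → 0ℤ < w x) × proj₁ N e ≡ true ×
                         (∀ x → cross G (lookup T) x ≡ true → proj₁ N x ≡ true → x ≡ e)
    top e c Me with dec
    ... | k , L , p with total-pos G L {e} (subst (0ℤ <_) (p e) (0<* (2^-pos k) (full e (M⊆w e Me))))
    ...   | N , N∈ , Ne = N , sub , Ne , λ x cx Nx → proj₂ once x e (∧-intro cx Nx) (∧-intro c Ne)
      where
      once : ExactlyOne (λ x → cross G (lookup T) x ∧ proj₁ N x)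
      once = ∑⇒unique (trans (sym (cut-count G (lookup T) (proj₁ N)))
               (tight⇒1 G {T = lookup T} {2 ^ k} {L} good-b (OddCut.odd (∈-cuts G T∈)) tight p {N} N∈))
      sub : ∀ x → proj₁ N x ≡ true → 0ℤ < w x
      sub x Nx = ℤₚ.≤∧≢⇒< (nonneg x) λ q → summand≢0 G {b} {k} {L} {N} p N∈ Nx (zero-b x (sym q))

  -- The next face: leave N b + w, a point close to b, in the direction -M′.
  module Next {b : Fin m → ℤ} {s : ℤ} (face : Face b s) (M′ : PM G) (M′⊆w : ∀ e → proj₁ M′ e ≡ true → 0ℤ < w e)
              {T : Vec Bool n} (T∈ : T ∈ cuts G) (tight : Tight b s T) (F>0 : 0ℤ < excess M′ T)
              (max : ∀ {T′} → T′ ∈ cuts G → Tight b s T′ → excess M′ T′ * slack T ≤ excess M′ T * slack T′) where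
    open Face face

    F C N : ℤ
    F = excess M′ T
    C = slack T
    -- N = C (1 + m). An inequality that is loose at b has slack at least 1 there, hence at least N
    -- at N b, whereas subtracting C M′ costs a cut at most C m and an edge at most C.
    N = C * (1ℤ + ∑ {m} (λ _ → 1ℤ))

    C>0 : 0ℤ < C
    C>0 = slack-pos T∈

    N>0 : 0ℤ < N
    N>0 = 0<* C>0 (0<+ 0<1 (∑-nonneg (λ _ → ℤₚ.<⇒≤ 0<1)))

    x : Fin m → ℤ
    x e = N * b e + w e

    b₂ : Fin m → ℤ
    b₂ e = F * x e - C * ⟦ proj₁ M′ e ⟧

    s₂ : ℤ
    s₂ = F * (N * s + r) - C * 1ℤ

    cut-x : ∀ U → cut G U x ≡ N * cut G U b + cut G U w
    cut-x U = trans (cut-+ G U (λ e → N * b e) w) (cong (_+ cut G U w) (cut-* G U N b))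

    cut-b₂ : ∀ U → cut G U b₂ ≡ F * (N * cut G U b + cut G U w) - C * cut G U (⟦_⟧ ∘ proj₁ M′)
    cut-b₂ U = trans (cut-lincomb G U F C x (⟦_⟧ ∘ proj₁ M′)) (cong (λ z → F * z - C * cut G U (⟦_⟧ ∘ proj₁ M′)) (cut-x U))

    1≤F : 0ℤ ≤ F - 1ℤ
    1≤F = 1≤ F>0

    full₂ : ∀ e → 0ℤ < w e → 0ℤ < b₂ e
    full₂ e p = ℤₚ.<-≤-trans (0<+ 0<1 rest≥0) (ℤₚ.≤-reflexive (lem F C (∑ {m} (λ _ → 1ℤ)) (b e) (w e) ⟦ proj₁ M′ e ⟧))
      where
      c≥0 = ℤₚ.<⇒≤ C>0
      b≥1 = 1≤ (full e p)
      F≥0 = ℤₚ.<⇒≤ F>0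
      M≤1 : 0ℤ ≤ 1ℤ - ⟦ proj₁ M′ e ⟧
      M≤1 with proj₁ M′ e
      ... | true  = ℤₚ.≤-refl
      ... | false = ℤₚ.<⇒≤ 0<1
      rest≥0 = 0≤+ (0≤+ (0≤+ (0≤* 1≤F (ℤₚ.<⇒≤ N>0)) (0≤* (0≤* F≥0 (ℤₚ.<⇒≤ N>0)) b≥1))
                   (0≤+ (0≤* c≥0 M≤1) (0≤* c≥0 (∑-nonneg {m} (λ _ → ℤₚ.<⇒≤ 0<1)))))
                   (0≤+ 1≤F (0≤* F≥0 (1≤ p)))
      lem : ∀ F C K b w M → 1ℤ + (((F - 1ℤ) * (C * (1ℤ + K)) + F * (C * (1ℤ + K)) * (b - 1ℤ) + (C * (1ℤ - M) + C * K)) + (F - 1ℤ + F * (w - 1ℤ)))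
            ≡ F * (C * (1ℤ + K) * b + w) - C * M
      lem = solve-∀

    zero₂ : ∀ e → w e ≡ 0ℤ → b₂ e ≡ 0ℤ
    zero₂ e q = trans (cong₂ (λ y M → F * y - C * ⟦ M ⟧) (cong₂ (λ p q → N * p + q) (zero-b e q) q)
        (¬-not λ h → ℤₚ.<-irrefl (sym q) (M′⊆w e h))) (lem F C N)
      where
      lem : ∀ F C N → F * (N * 0ℤ + 0ℤ) - C * 0ℤ ≡ 0ℤ
      lem = solve-∀

    gap : Vec Bool n → ℤ
    gap T′ = cut G (lookup T′) b₂ - s₂

    gap≡ : ∀ T′ → gap T′ ≡ F * N * (cut G (lookup T′) b - s) + (F * slack T′ - C * excess M′ T′)
    gap≡ T′ = trans (cong (_- s₂) (cut-b₂ (lookup T′)))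
      (lem F C N (cut G (lookup T′) b) (cut G (lookup T′) w) (cut G (lookup T′) (⟦_⟧ ∘ proj₁ M′)) s r)
      where
      lem : ∀ F C N b w M s r → (F * (N * b + w) - C * M) - (F * (N * s + r) - C * 1ℤ)
            ≡ F * N * (b - s) + (F * (w - r) - C * (M - 1ℤ))
      lem = solve-∀

    -- Cuts tight at b get no help from N b: they see a ray that starts at w, and `max` says that T
    -- stops it first among them.
    gap-tight : ∀ {T′} → Tight b s T′ → gap T′ ≡ F * slack T′ - C * excess M′ T′
    gap-tight {T′} q = trans (gap≡ T′) (trans (cong (λ z → F * N * (z - s) + (F * slack T′ - C * excess M′ T′)) q)
                                              (lem F N s (F * slack T′ - C * excess M′ T′)))
      where
      lem : ∀ F N s z → F * N * (s - s) + z ≡ z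
      lem = solve-∀

    gap-loose : ∀ {T′} → T′ ∈ cuts G → ¬ Tight b s T′ → 0ℤ < gap T′
    gap-loose {T′} T′∈ q = ℤₚ.<-≤-trans (0<+ (0<* F>0 (slack-pos T′∈)) rest≥0)
        (ℤₚ.≤-reflexive (trans (lem F C K (slack T′) (cut G (lookup T′) b - s) (cut G (lookup T′) (⟦_⟧ ∘ proj₁ M′))) (sym (gap≡ T′))))
      where
      K = ∑ {m} (λ _ → 1ℤ)
      loose : 0ℤ < cut G (lookup T′) b - s
      loose = 0<- (ℤₚ.≤∧≢⇒< (Good.r≤cut good-b (OddCut.odd (∈-cuts G T′∈))) (q ∘ sym))
      M≤K : 0ℤ ≤ K - cut G (lookup T′) (⟦_⟧ ∘ proj₁ M′)
      M≤K = undiff (subst (_≤ K) (sym (cut-count G (lookup T′) (proj₁ M′))) (∑-mono λ e → ≤1 (cross G (lookup T′) e ∧ proj₁ M′ e)))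
        where
        ≤1 : ∀ b → ⟦ b ⟧ ≤ 1ℤ
        ≤1 true  = ℤₚ.≤-refl
        ≤1 false = ℤₚ.<⇒≤ 0<1
      rest≥0 = 0≤+ (0≤+ (0≤* 1≤F (ℤₚ.<⇒≤ N>0)) (0≤* (0≤* (ℤₚ.<⇒≤ F>0) (ℤₚ.<⇒≤ N>0)) (1≤ loose)))
                   (0≤+ (0≤* (ℤₚ.<⇒≤ C>0) M≤K) (0≤* (ℤₚ.<⇒≤ C>0) (ℤₚ.≤-trans (ℤₚ.<⇒≤ 0<1) 1≤2)))
        where
        1≤2 : 1ℤ ≤ 1ℤ + 1ℤ
        1≤2 = ℤ.+≤+ (ℕ.s≤s ℕ.z≤n)
      lem : ∀ F C K l d M → F * l + (((F - 1ℤ) * (C * (1ℤ + K)) + F * (C * (1ℤ + K)) * (d - 1ℤ)) + (C * (K - M) + C * (1ℤ + 1ℤ)))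
            ≡ F * (C * (1ℤ + K)) * d + (F * l - C * (M - 1ℤ))
      lem = solve-∀

    good₂ : Good G b₂ s₂
    good₂ = good-by-cuts G even nn lp reg ct
      where
      nn : ∀ e → 0ℤ ≤ b₂ e
      nn e with pos? e
      ... | yes p = ℤₚ.<⇒≤ (full₂ e p)
      ... | no ¬p = ℤₚ.≤-reflexive (sym (zero₂ e (nonpos⇒0 (nonneg e) ¬p)))
      lp : ∀ e → src e ≡ tgt e → b₂ e ≡ 0ℤ
      lp e q = zero₂ e (loop≡0 e q)
      reg : Regular G b₂ s₂
      reg v av = trans (cut-b₂ (_== v)) (cong₂ (λ p q → F * p - C * q)
        (cong₂ (λ p q → N * p + q) (Good.deg≡r good-b v av) (deg≡r v av)) (pm-regular G M′ v av))
      ct : ∀ {T′} → T′ ∈ cuts G → s₂ ≤ cut G (lookup T′) b₂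
      ct {T′} T′∈ with tight? b s T′
      ... | no ¬q = diff (ℤₚ.<⇒≤ (gap-loose T′∈ ¬q))
      ... | yes q = diff (subst (0ℤ ≤_) (trans (cong (λ z → F * slack T′ - z) (ℤₚ.*-comm (excess M′ T′) C)) (sym (gap-tight {T′} q)))
                      (undiff (max T′∈ q)))

    tight₂⇒tight : ∀ {T′} → T′ ∈ cuts G → Tight b₂ s₂ T′ → Tight b s T′
    tight₂⇒tight {T′} T′∈ q with tight? b s T′
    ... | yes p = p
    ... | no ¬p = ⊥-elim (ℤₚ.<-irrefl (sym (ℤₚ.i≡j⇒i-j≡0 q)) (gap-loose T′∈ ¬p))

    tight₂ : Tight b₂ s₂ T
    tight₂ = ℤₚ.i-j≡0⇒i≡j (cut G (lookup T) b₂) s₂ (trans (gap-tight {T} tight) (ℤₚ.i≡j⇒i-j≡0 {F * C} {C * F} (ℤₚ.*-comm F C)))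

    S₂ : Fin m → ℤ
    S₂ e = C * ⟦ proj₁ M′ e ⟧ + F * N * S e

    face₂ : Face b₂ s₂
    face₂ = record
      { good-b = good₂ ; full = full₂ ; zero-b = zero₂
      ; crossed = λ T′∈ q → crossed T′∈ (tight₂⇒tight T′∈ q)
      ; S = S₂
      ; dy-S = dy-+ G (dy-* G (ℤₚ.<⇒≤ C>0) (dy-pm G M′)) (dy-* G (0≤* (ℤₚ.<⇒≤ F>0) (ℤₚ.<⇒≤ N>0)) dy-S)
      ; k = F * (N * k + 1ℤ) ; k>0 = 0<* F>0 (0<+ (0<* N>0 k>0) (ℤₚ.<⇒≤ 0<1))
      ; b+S = λ e → trans (lem₁ F C N (b e) (w e) ⟦ proj₁ M′ e ⟧ (S e)) (trans (cong (λ z → F * (N * z + w e)) (b+S e)) (lem₂ F N k (w e))) }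
      where
      lem₁ : ∀ F C N b w M S → F * (N * b + w) - C * M + (C * M + F * N * S) ≡ F * (N * (b + S) + w)
      lem₁ = solve-∀
      lem₂ : ∀ F N k w → F * (N * (k * w) + w) ≡ F * (N * k + 1ℤ) * w
      lem₂ = solve-∀

    -- b₂ + C M′ = F (N b + w), and N k + 1 is prime to k.
    finish : ∀ j → F ≡ + (2 ^ j) → Dy G w
    finish j q = dy-coprime G k N k>0 N>0 dy-kw
      (dy-sub G dy-x (dy-* G (ℤₚ.<⇒≤ N>0) dy-S) λ e → trans (lem₁ N (b e) (w e) (S e)) (trans (cong (λ z → N * z + w e) (b+S e)) (lem₂ N k (w e))))
      where
      dy-kw : Dy G (λ e → k * w e)
      dy-kw = dy-sub G (solve-tight good-b (∈-cuts G T∈) tight) dy-S b+S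
      dy-x : Dy G x
      dy-x = dy-/2^ G j (dy-sub G (solve-tight good₂ (∈-cuts G T∈) tight₂) (dy-* G (ℤₚ.<⇒≤ C>0) (dy-pm G M′))
               λ e → trans (lem (F * x e) (C * ⟦ proj₁ M′ e ⟧)) (cong (_* x e) q))
        where
        lem : ∀ a b → a - b + b ≡ a
        lem = solve-∀
      lem₁ : ∀ N b w S → N * b + w + N * S ≡ N * (b + S) + w
      lem₁ = solve-∀
      lem₂ : ∀ N k w → N * (k * w) + w ≡ (N * k + 1ℤ) * w
      lem₂ = solve-∀

  -- T has the largest ratio of excess to slack among the cuts tight at b, so none of these is
  -- reached before T on the ray in the direction -M′.
  MostCrossed : PM G → (Fin m → ℤ) → ℤ → Vec Bool n → Set
  MostCrossed M′ b s T = ∀ {T′} → T′ ∈ cuts G → Tight b s T′ → excess M′ T′ * slack T ≤ excess M′ T * slack T′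

  most-crossed : ∀ M′ b s {T} → T ∈ cuts G → Tight b s T →
                 Σ (Vec Bool n) λ T* → T* ∈ cuts G × Tight b s T* × MostCrossed M′ b s T*
  most-crossed M′ b s {T} T∈ tight = collect (argmax (excess M′) slack T (tights b s) (λ T′∈ → slack-pos (proj₁ (tight⁻ T′∈))))
    where
    tight⁻ : ∀ {T′} → T′ ∈ T ∷ tights b s → T′ ∈ cuts G × Tight b s T′
    tight⁻ (here refl) = T∈ , tight
    tight⁻ (there p)   = ∈-filter⁻ (tight? b s) {xs = cuts G} p
    collect : Σ (Vec Bool n) (λ T* → T* ∈ T ∷ tights b s ×
                (∀ {T′} → T′ ∈ T ∷ tights b s → excess M′ T′ * slack T* ≤ excess M′ T* * slack T′)) →
              Σ (Vec Bool n) λ T* → T* ∈ cuts G × Tight b s T* × MostCrossed M′ b s T*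
    collect (T* , T*∈ , max) = T* , proj₁ (tight⁻ T*∈) , proj₂ (tight⁻ T*∈) ,
      λ T′∈ q → max (there (∈-filter⁺ (tight? b s) T′∈ q))

  Continue : (Fin m → ℤ) → ℤ → Set
  Continue b s = ∀ {b₂ s₂ T₂} → Face b₂ s₂ → T₂ ∈ cuts G → Tight b₂ s₂ T₂ →
                 length (tights b₂ s₂) ℕ.< length (tights b s) → Dy G w

  -- `T*` is reached strictly before T, so T is loose at the new exit point. No loose cut has become
  -- tight, and the number of tight cuts drops.
  descend-other : ∀ {b s} (face : Face b s) (M′ : PM G) (M′⊆w : ∀ e → proj₁ M′ e ≡ true → 0ℤ < w e) →
                  ∀ {T} → T ∈ cuts G → Tight b s T → ∀ {T*} → T* ∈ cuts G → Tight b s T* → 0ℤ < excess M′ T* →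
                  MostCrossed M′ b s T* → ¬ excess M′ T* * slack T ≤ excess M′ T * slack T* → Continue b s → Dy G w
  descend-other {b} {s} face M′ M′⊆w {T} T∈ tight {T*} T*∈ T*-tight F*>0 max ¬p ih = ih X.face₂ T*∈ X.tight₂
      (filter-shrinks-strictly (tight? X.b₂ X.s₂) (tight? b s) (cuts G) X.tight₂⇒tight T∈ not-tight tight)
    where
    module X = Next face M′ M′⊆w T*∈ T*-tight F*>0 max
    lem : ∀ f f* c c* → f* * c - c* * f ≡ 0ℤ → f * c* - f* * c ≡ 0ℤ
    lem f f* c c* h = trans (lem′ f f* c c*) (cong (λ z → - z) h)
      where
      lem′ : ∀ f f* c c* → f * c* - f* * c ≡ - (f* * c - c* * f)
      lem′ = solve-∀
    not-tight : ¬ Tight X.b₂ X.s₂ T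
    not-tight q = ¬p (diff (ℤₚ.≤-reflexive (sym (lem (excess M′ T) (excess M′ T*) (slack T) (slack T*)
      (trans (sym (X.gap-tight {T} tight)) (ℤₚ.i≡j⇒i-j≡0 {cut G (lookup T) X.b₂} {X.s₂} q))))))

  descend-along : ∀ {b s} (face : Face b s) {T} → T ∈ cuts G → Tight b s T → Continue b s → Crosses3or5 T → Dy G w
  descend-along {b} {s} face {T} T∈ tight ih (M′ , M′⊆w , c) = most (most-crossed M′ b s T∈ tight)
    where
    -- The origin of 3 and 5: the excess is 2 or 4, a power of 2.
    F : Σ ℕ λ j → excess M′ T ≡ + (2 ^ j)
    F = [ (λ q → 1 , cong (_- 1ℤ) q) , (λ q → 2 , cong (_- 1ℤ) q) ]′ c
    F>0 : 0ℤ < excess M′ T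
    F>0 = subst (0ℤ <_) (sym (proj₂ F)) (2^-pos (proj₁ F))
    most : Σ (Vec Bool n) (λ T* → T* ∈ cuts G × Tight b s T* × MostCrossed M′ b s T*) → Dy G w
    most (T* , T*∈ , T*-tight , max) = by (excess M′ T* * slack T ℤₚ.≤? excess M′ T * slack T*)
      where
      F*>0 : 0ℤ < excess M′ T*
      F*>0 = *-pos⁻¹ {slack T} {excess M′ T*} (slack-pos T∈) (subst (0ℤ <_) (ℤₚ.*-comm (excess M′ T*) (slack T))
               (ℤₚ.<-≤-trans (0<* F>0 (slack-pos T*∈)) (max T∈ tight)))
      -- If T attains the maximum too, it may serve as the stopping cut, and its excess is a power
      -- of 2. Nothing is known about the excess of `T*`, which can only be used to continue.
      by : Dec (excess M′ T* * slack T ≤ excess M′ T * slack T*) → Dy G w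
      by (yes p) = Next.finish {b} {s} face M′ M′⊆w {T} T∈ tight F>0
        (λ {T′} T′∈ q → ratio-trans {excess M′ T′} {slack T′} {excess M′ T*} {slack T*} {excess M′ T} {slack T}
          (slack-pos T*∈) (ℤₚ.<⇒≤ (slack-pos T′∈)) (ℤₚ.<⇒≤ (slack-pos T∈)) (max T′∈ q) p)
        (proj₁ F) (proj₂ F)
      by (no ¬p) = descend-other face M′ M′⊆w T∈ tight T*∈ T*-tight F*>0 max ¬p ih

  descend-step : ∀ {b s T} → Face b s → T ∈ cuts G → Tight b s T → Continue b s → Dy G w
  descend-step face T∈ tight ih = descend-along face T∈ tight ih (crosses-3-or-5 face T∈ tight)

  descend-face : ∀ fuel {b s T} → Face b s → T ∈ cuts G → Tight b s T → length (tights b s) ℕ.< fuel → Dy G w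
  descend-face (suc fuel) face T∈ tight len = descend-step face T∈ tight
    λ face₂ T₂∈ tight₂ shorter → descend-face fuel face₂ T₂∈ tight₂ (ℕₚ.<-≤-trans shorter (ℕₚ.≤-pred len))

  interior : (∀ {b s e} → Good G b s → (∀ x → w x ≡ 0ℤ → b x ≡ 0ℤ) → 0ℤ < w e → b e ≡ 0ℤ → Dy G b) →
             ∀ {e₀} → proj₁ M e₀ ≡ true → Dy G w
  interior solve-zero {e₀} Me₀ = exit (hit G even gw strict (⟦_⟧ ∘ proj₁ M) 1ℤ (pm-regular G M)
      (λ e q → cong ⟦_⟧ (¬-not λ h → ℤₚ.<-irrefl (sym q) (M⊆w e h))) e₀ (M⊆w e₀ Me₀) (subst (λ b → 0ℤ < ⟦ b ⟧) (sym Me₀) 0<1))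
    where
   exit : Σ ℤ (λ f → Σ ℤ λ c → 0ℤ < f × 0ℤ < c × Hit G even gw strict (⟦_⟧ ∘ proj₁ M) 1ℤ f c ×
            Good G (λ x → f * w x - c * ⟦ proj₁ M x ⟧) (f * r - c * 1ℤ)) → Dy G w
   exit (f , c , f>0 , c>0 , h , g) = by h
    where
    b : Fin m → ℤ
    b e = f * w e - c * ⟦ proj₁ M e ⟧
    M≡0 : ∀ {e} → w e ≡ 0ℤ → ⟦ proj₁ M e ⟧ ≡ 0ℤ
    M≡0 {e} q = cong ⟦_⟧ (¬-not λ h → ℤₚ.<-irrefl (sym q) (M⊆w e h))
    restore : Dy G (λ e → 1ℤ * w e - c * ⟦ proj₁ M e ⟧) → Dy G w
    restore d = dy-sub G d (dy-* G (ℤₚ.<⇒≤ c>0) (dy-pm G M)) (λ e → lem (w e) (c * ⟦ proj₁ M e ⟧))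
      where
      lem : ∀ a b → 1ℤ * a - b + b ≡ a
      lem = solve-∀
    vanish : ∀ c e → w e ≡ 0ℤ → 1ℤ * w e - c * ⟦ proj₁ M e ⟧ ≡ 0ℤ
    vanish c e q = trans (cong₂ (λ a b → 1ℤ * a - c * b) q (M≡0 q)) (lem c)
      where
      lem : ∀ c → 1ℤ * 0ℤ - c * 0ℤ ≡ 0ℤ
      lem = solve-∀
    by : Hit G even gw strict (⟦_⟧ ∘ proj₁ M) 1ℤ f c → Dy G w
    -- The edge that stops the ray has value 1 in M, so f = 1 and the exit point w - c M needs no
    -- scaling.
    by (hit-edge e we fe ce) = restore (solve-zero
        (subst (λ f → Good G (λ e → f * w e - c * ⟦ proj₁ M e ⟧) (f * r - c * 1ℤ)) f≡1 g) (vanish c) we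
        (trans (cong₂ (λ a b → 1ℤ * w e - a * b) ce (trans (sym fe) f≡1)) (lem (w e))))
      where
      f≡1 : f ≡ 1ℤ
      f≡1 = trans fe (cong ⟦_⟧ (⟦⟧-pos (subst (0ℤ <_) fe f>0)))
      lem : ∀ a → 1ℤ * a - a * 1ℤ ≡ 0ℤ
      lem = solve-∀
    by (hit-cut {T} T∈ fT cT) = cases (any? λ e → pos? e ×-dec (b e ℤₚ.≟ 0ℤ))
      where
      cases : Dec (Σ (Fin m) λ e → 0ℤ < w e × b e ≡ 0ℤ) → Dy G w
      cases (yes (e , we , be)) = restore′ (bool-cases (proj₁ M e))
        where
        -- e is hit at the same time as T
        restore′ : proj₁ M e ≡ true ⊎ proj₁ M e ≡ false → Dy G w
        restore′ (inj₂ q) = ⊥-elim (ℤₚ.<-irrefl (sym (trans (sym (lem (f * w e) c)) (trans (cong (λ z → f * w e - c * ⟦ z ⟧) (sym q)) be)))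
                              (0<* f>0 we))
          where
          lem : ∀ a c → a - c * 0ℤ ≡ a
          lem = solve-∀
        -- As b vanishes at e, c = f w(e) and b = f (w - w(e) M). Dividing by f leaves an integral
        -- point of the cone with smaller support.
        restore′ (inj₁ q) = dy-sub G
          (solve-zero {e = e} (good-÷ G f>0 good-f) (vanish (w e)) we
            (trans (cong (λ z → 1ℤ * w e - w e * ⟦ z ⟧) q) (lem₃ (w e))))
          (dy-* G (ℤₚ.<⇒≤ we) (dy-pm G M)) (λ e′ → lem₄ (w e′) (w e * ⟦ proj₁ M e′ ⟧))
          where
          c≡ : c ≡ f * w e
          c≡ = sym (ℤₚ.i-j≡0⇒i≡j (f * w e) c (trans (cong (λ z → f * w e - z) (sym (ℤₚ.*-identityʳ c)))
                 (trans (cong (λ z → f * w e - c * ⟦ z ⟧) (sym q)) be)))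
          good-f : Good G (λ e′ → f * (1ℤ * w e′ - w e * ⟦ proj₁ M e′ ⟧)) (f * (1ℤ * r - w e * 1ℤ))
          good-f = good-resp (λ e′ → trans (cong (λ z → f * w e′ - z * ⟦ proj₁ M e′ ⟧) c≡) (lem₁ f (w e′) (w e) ⟦ proj₁ M e′ ⟧))
                     (trans (cong (λ z → f * r - z * 1ℤ) c≡) (lem₁ f r (w e) 1ℤ)) g
            where
            lem₁ : ∀ f a w M → f * a - f * w * M ≡ f * (1ℤ * a - w * M)
            lem₁ = solve-∀
            good-resp : ∀ {x y : Fin m → ℤ} {p q} → (∀ e → x e ≡ y e) → p ≡ q → Good G x p → Good G y q
            good-resp {x} {y} h refl (good nn lp dg ct) = good (λ e → subst (0ℤ ≤_) (h e) (nn e)) (λ e l → trans (sym (h e)) (lp e l))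
              (λ v av → trans (cut-congʳ G {_== v} (λ e → sym (h e))) (dg v av)) (λ {U} o → subst (_ ≤_) (cut-congʳ G {U} h) (ct o))
          lem₃ : ∀ a → 1ℤ * a - a * 1ℤ ≡ 0ℤ
          lem₃ = solve-∀
          lem₄ : ∀ a b → 1ℤ * a - b + b ≡ a
          lem₄ = solve-∀
      cases (no none) = descend-face (suc (length (tights b s))) face T∈ tight ℕₚ.≤-refl
        where
        s : ℤ
        s = f * r - c * 1ℤ
        cut-b : ∀ T → cut G (lookup T) b ≡ f * cut G (lookup T) w - c * cut G (lookup T) (⟦_⟧ ∘ proj₁ M)
        cut-b T = cut-lincomb G (lookup T) f c w (⟦_⟧ ∘ proj₁ M)
        tight : Tight b s T
        tight = ℤₚ.i-j≡0⇒i≡j _ _ (trans (cong (_- s) (cut-b T)) (trans (lem f c (cut G (lookup T) w) (cut G (lookup T) (⟦_⟧ ∘ proj₁ M)) r)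
                  (trans (cong₂ (λ p q → f * p - c * q) (sym cT) (sym fT)) (trans (cong (λ z → z - c * f) (ℤₚ.*-comm f c)) (ℤₚ.+-inverseʳ (c * f))))))
          where
          lem : ∀ f c w M r → (f * w - c * M) - (f * r - c * 1ℤ) ≡ f * (w - r) - c * (M - 1ℤ)
          lem = solve-∀
        face : Face b s
        face = record
          { good-b = g
          ; full = λ e p → ℤₚ.≤∧≢⇒< (Good.nonneg g e) (λ q → none (e , p , sym q))
          ; zero-b = λ e q → trans (cong₂ (λ x y → f * x - c * y) q (M≡0 q)) (lem₀ f c)
          ; crossed = λ {T′} T′∈ q → crossed {T′} T′∈ q
          ; S = λ e → c * ⟦ proj₁ M e ⟧ ; dy-S = dy-* G (ℤₚ.<⇒≤ c>0) (dy-pm G M)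
          ; k = f ; k>0 = f>0 ; b+S = λ e → lem₁ (f * w e) (c * ⟦ proj₁ M e ⟧) }
          where
          lem₀ : ∀ f c → f * 0ℤ - c * 0ℤ ≡ 0ℤ
          lem₀ = solve-∀
          lem₁ : ∀ a b → a - b + b ≡ a
          lem₁ = solve-∀
          -- If T′ is tight at b, then c times the excess of M at T′ equals f times the slack of T′,
          -- which is positive.
          crossed : ∀ {T′} → T′ ∈ cuts G → Tight b s T′ → 1ℤ < cut G (lookup T′) (⟦_⟧ ∘ proj₁ M)
          crossed {T′} T′∈ q = subst (1ℤ <_) (lem₂ (cut G (lookup T′) (⟦_⟧ ∘ proj₁ M)))
            (0<+1 (*-pos⁻¹ c>0 (subst (0ℤ <_) (sym eq) (0<* f>0 (slack-pos T′∈)))))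
            where
            0<+1 : ∀ {a} → 0ℤ < a → 1ℤ < a + 1ℤ
            0<+1 p = ℤₚ.+-monoˡ-< 1ℤ p
            lem₂ : ∀ a → (a - 1ℤ) + 1ℤ ≡ a
            lem₂ = solve-∀
            lem₃ : ∀ f c w M r → c * (M - 1ℤ) ≡ f * (w - r) - ((f * w - c * M) - (f * r - c * 1ℤ))
            lem₃ = solve-∀
            eq : c * (cut G (lookup T′) (⟦_⟧ ∘ proj₁ M) - 1ℤ) ≡ f * slack T′
            eq = trans (lem₃ f c (cut G (lookup T′) w) (cut G (lookup T′) (⟦_⟧ ∘ proj₁ M)) r)
                 (trans (cong (λ z → f * slack T′ - (z - s)) (trans (sym (cut-b T′)) q)) (lem₄ (f * slack T′) s))
              where
              lem₄ : ∀ a s → a - (s - s) ≡ a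
              lem₄ = solve-∀

-- Existence of a perfect matching

opaque
  unfolding ∑

  ∑-suc : ∀ {n} (f : Fin (suc n) → ℤ) → ∑ f ≡ f zero + ∑ (f ∘ suc)
  ∑-suc f = refl

-- Gaussian elimination without fractions: a row with nonzero first entry eliminates the first
-- variable from the others. The remaining variables are finally scaled by that entry, so that the
-- first one is integral.
kernel : ∀ {m} (rows : List (Fin m → ℤ)) → length rows ℕ.< m →
         Σ (Fin m → ℤ) λ y → Σ (Fin m) (λ e → y e ≢ 0ℤ) × (∀ {ρ} → ρ ∈ rows → ∑ (λ e → ρ e * y e) ≡ 0ℤ)
kernel {suc m} rows len with Any.any? (λ ρ → ¬? (ρ zero ℤₚ.≟ 0ℤ)) rows
... | no none = (λ e → ⟦ e == zero ⟧) , (zero , λ ()) , λ {ρ} ρ∈ →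
  trans (∑-cong (λ e → ℤₚ.*-comm (ρ e) ⟦ e == zero ⟧)) (trans (∑-delta zero ρ)
    (decidable-stable (ρ zero ℤₚ.≟ 0ℤ) (λ q → none (lose ρ∈ q))))
... | yes some with find some
...   | ρ , ρ∈ , ρ₀≢0 with ∈-∃++ ρ∈
...     | xs , ys , refl = y , (suc (proj₁ nz) , y-nz) , killed
  where
  elim : (Fin (suc m) → ℤ) → Fin m → ℤ
  elim σ l = ρ zero * σ (suc l) - σ zero * ρ (suc l)
  shorter : length (map elim (xs ++ ys)) ℕ.< m
  shorter = ℕₚ.≤-pred (subst (ℕ._< suc m) (trans (Listₚ.length-++ xs) (trans (ℕₚ.+-suc (length xs) (length ys))
    (cong suc (trans (sym (Listₚ.length-++ xs)) (sym (Listₚ.length-map elim (xs ++ ys))))))) len)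
  ih = kernel (map elim (xs ++ ys)) shorter
  y′ : Fin m → ℤ
  y′ = proj₁ ih
  nz = proj₁ (proj₂ ih)
  A : ℤ
  A = ∑ (λ l → ρ (suc l) * y′ l)
  y : Fin (suc m) → ℤ
  y zero    = - A
  y (suc l) = ρ zero * y′ l
  y-nz : y (suc (proj₁ nz)) ≢ 0ℤ
  y-nz q = [ ρ₀≢0 , proj₂ nz ]′ (ℤₚ.i*j≡0⇒i≡0∨j≡0 (ρ zero) q)
  expand : ∀ σ → ∑ (λ e → σ e * y e) ≡ σ zero * - A + ρ zero * ∑ (λ l → σ (suc l) * y′ l)
  expand σ = trans (∑-suc (λ e → σ e * y e)) (cong (λ z → σ zero * - A + z)
    (trans (∑-cong (λ l → lem (σ (suc l)) (ρ zero) (y′ l))) (∑-* (ρ zero) (λ l → σ (suc l) * y′ l))))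
    where
    lem : ∀ a b c → a * (b * c) ≡ b * (a * c)
    lem = solve-∀
  killed-ρ : ∑ (λ e → ρ e * y e) ≡ 0ℤ
  killed-ρ = trans (expand ρ) (lem (ρ zero) A)
    where
    lem : ∀ a b → a * - b + a * b ≡ 0ℤ
    lem = solve-∀
  killed-σ : ∀ {σ} → σ ∈ xs ++ ys → ∑ (λ e → σ e * y e) ≡ 0ℤ
  killed-σ {σ} σ∈ = trans (expand σ) (trans (lem (σ zero) A (ρ zero) (∑ (λ l → σ (suc l) * y′ l)))
    (trans (sym (trans (∑-cong (λ l → lem′ (ρ zero) (σ (suc l)) (σ zero) (ρ (suc l)) (y′ l)))
                       (∑-lincomb (ρ zero) (σ zero) (λ l → σ (suc l) * y′ l) (λ l → ρ (suc l) * y′ l))))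
           (proj₂ (proj₂ ih) (∈-map⁺ elim σ∈))))
    where
    lem : ∀ a A b B → a * - A + b * B ≡ b * B - a * A
    lem = solve-∀
    lem′ : ∀ a b c d y → (a * b - c * d) * y ≡ a * (b * y) - c * (d * y)
    lem′ = solve-∀
  killed : ∀ {σ} → σ ∈ xs ++ ρ ∷ ys → ∑ (λ e → σ e * y e) ≡ 0ℤ
  killed σ∈ with ∈-++⁻ xs σ∈
  ... | inj₁ p           = killed-σ (∈-++⁺ˡ p)
  ... | inj₂ (here refl) = killed-ρ
  ... | inj₂ (there p)   = killed-σ (∈-++⁺ʳ xs p)

select : ∀ {n} → (Fin n → Bool) → List (Fin n)
select {zero}  p = []
select {suc n} p with p zero
... | true  = zero ∷ map suc (select (p ∘ suc))
... | false = map suc (select (p ∘ suc))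

length-select : ∀ {n} (p : Fin n → Bool) → length (select p) ≡ count p
length-select {zero}  p = refl
length-select {suc n} p with p zero
... | true  = cong suc (trans (Listₚ.length-map suc (select (p ∘ suc))) (length-select (p ∘ suc)))
... | false = trans (Listₚ.length-map suc (select (p ∘ suc))) (length-select (p ∘ suc))

∈-select : ∀ {n} (p : Fin n → Bool) i → p i ≡ true → i ∈ select p
∈-select {suc n} p zero q rewrite q = here refl
∈-select {suc n} p (suc i) q with p zero
... | true  = there (∈-map⁺ suc (∈-select (p ∘ suc) i q))
... | false = ∈-map⁺ suc (∈-select (p ∘ suc) i q)

count-∁ : ∀ {n} (p : Fin n → Bool) → count p ℕ.+ count (not ∘ p) ≡ n
count-∁ {zero}  p = refl
count-∁ {suc n} p with p zero
... | true  = cong suc (count-∁ (p ∘ suc))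
... | false = trans (ℕₚ.+-suc _ _) (cong suc (count-∁ (p ∘ suc)))

count-⊆ : ∀ {n} {p : Fin n → Bool} xs → (∀ i → p i ≡ true → i ∈ xs) → count p ℕ.≤ length xs
count-⊆ {p = p} xs h = ℤₚ.drop‿+≤+ (subst₂ _≤_ (∑-count p) (size xs) (∑-mono λ i → bound i (p i) refl))
  where
  times : ∀ {n} → List (Fin n) → Fin n → ℤ
  times []       i = 0ℤ
  times (x ∷ xs) i = ⟦ i == x ⟧ + times xs i
  size : ∀ {n} (xs : List (Fin n)) → ∑ (times xs) ≡ + length xs
  size []       = ∑-0 (λ _ → refl)
  size (x ∷ xs) = trans (∑-+ (λ i → ⟦ i == x ⟧) (times xs)) (cong₂ _+_ (∑-delta₁ x) (size xs))
  nn : ∀ {n} xs (i : Fin n) → 0ℤ ≤ times xs i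
  nn []       i = ℤₚ.≤-refl
  nn (x ∷ xs) i = 0≤+ (0≤⟦⟧ (i == x)) (nn xs i)
  hit∈ : ∀ {n} xs {i : Fin n} → i ∈ xs → 1ℤ ≤ times xs i
  hit∈ (x ∷ xs) {i} (here refl) = ℤₚ.≤-trans (ℤₚ.≤-reflexive (sym (ℤₚ.+-identityʳ 1ℤ)))
    (ℤₚ.+-mono-≤ (ℤₚ.≤-reflexive (cong ⟦_⟧ (sym (==-refl i)))) (nn xs i))
  hit∈ (x ∷ xs) {i} (there p) = ℤₚ.≤-trans (ℤₚ.≤-reflexive (sym (ℤₚ.+-identityˡ 1ℤ)))
    (ℤₚ.+-mono-≤ (0≤⟦⟧ (i == x)) (hit∈ xs p))
  bound : ∀ i b → p i ≡ b → ⟦ p i ⟧ ≤ times xs i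
  bound i true  q rewrite q = hit∈ xs (h i q)
  bound i false q rewrite q = nn xs i

fresh : ∀ {n} (p : Fin n → Bool) xs → length xs ℕ.< count p → Σ (Fin n) λ i → p i ≡ true × i ∉ xs
fresh p xs len with any? (λ i → (p i Boolₚ.≟ true) ×-dec ¬? (_∈?_ _≟_ i xs))
... | yes r = r
... | no none = ⊥-elim (ℕₚ.<⇒≱ len (count-⊆ xs λ i q → decidable-stable (_∈?_ _≟_ i xs) (λ r → none (i , q , r))))

count-⊇ : ∀ {n} {p : Fin n → Bool} {xs} → Unique xs → (∀ i → i ∈ xs → p i ≡ true) → length xs ℕ.≤ count p
count-⊇ {p = p} {xs} u h = subst (ℕ._≤ count p) (ℤₚ.+-injective (trans (sym (∑-count q)) (∑-list u q to from)))
    (count-mono λ i r → h i (to i r))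
  where
  q : _ → Bool
  q i = does (_∈?_ _≟_ i xs)
  to : ∀ i → q i ≡ true → i ∈ xs
  to i r with _∈?_ _≟_ i xs
  ... | yes p = p
  from : ∀ i → i ∈ xs → q i ≡ true
  from i r = dec-true (_∈?_ _≟_ i xs) r

module _ {n m : ℕ} (G : Net n m) where
  open Net G

  other-end : ∀ {e v} → inc G e v ≡ true → Σ (Fin n) λ u → u ≢ v × inc G e u ≡ true
  other-end {e} {v} i with inc⇒end G e v i
  ... | inj₁ refl = tgt e , (inc-noloop G e v i ∘ sym) , inc-tgt G e (inc-noloop G e v i)
  ... | inj₂ refl = src e , inc-noloop G e v i , inc-src G e (inc-noloop G e v i)

  third-end : ∀ {e u v z} → inc G e u ≡ true → inc G e v ≡ true → u ≢ v → z ≢ u → z ≢ v → inc G e z ≡ false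
  third-end {e} {u} {v} {z} i j u≢v z≢u z≢v = ¬-not λ k → by (inc⇒end G e u i) (inc⇒end G e v j) (inc⇒end G e z k)
    where
    by : src e ≡ u ⊎ tgt e ≡ u → src e ≡ v ⊎ tgt e ≡ v → src e ≡ z ⊎ tgt e ≡ z → ⊥
    by (inj₁ a) (inj₁ b) _        = u≢v (trans (sym a) b)
    by (inj₂ a) (inj₂ b) _        = u≢v (trans (sym a) b)
    by (inj₁ a) (inj₂ b) (inj₁ c) = z≢u (trans (sym c) a)
    by (inj₁ a) (inj₂ b) (inj₂ c) = z≢v (trans (sym c) b)
    by (inj₂ a) (inj₁ b) (inj₁ c) = z≢v (trans (sym c) b)
    by (inj₂ a) (inj₁ b) (inj₂ c) = z≢u (trans (sym c) a)

  -- The set {a,b,c} if the three vertices are distinct, as a sum modulo 2 along which cuts and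
  -- parities expand.
  triple : Fin n → Fin n → Fin n → Fin n → Bool
  triple a b c u = (u == a) xor ((u == b) xor (u == c))

  cross-triple : ∀ a b c e → cross G (triple a b c) e ≡ inc G e a xor (inc G e b xor inc G e c)
  cross-triple a b c e = trans (xor-interchange (src e == a) _ (tgt e == a) _)
    (cong (inc G e a xor_) (xor-interchange (src e == b) _ (tgt e == b) _))

  odd-triple : ∀ {a b c} → alive a ≡ true → alive b ≡ true → alive c ≡ true → Odd G (triple a b c)
  odd-triple {a} {b} {c} p q r = begin
    ⨁ (λ v → alive v ∧ triple a b c v)
      ≡⟨ ⨁-cong (λ v → lem (alive v) (v == a) (v == b) (v == c)) ⟩
    ⨁ (λ v → ((v == a) ∧ alive v) xor (((v == b) ∧ alive v) xor ((v == c) ∧ alive v)))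
      ≡⟨ ⨁-xor (λ v → (v == a) ∧ alive v) (λ v → ((v == b) ∧ alive v) xor ((v == c) ∧ alive v)) ⟩
    ⨁ (λ v → (v == a) ∧ alive v) xor ⨁ (λ v → ((v == b) ∧ alive v) xor ((v == c) ∧ alive v))
      ≡⟨ cong₂ _xor_ (trans (⨁-delta a alive) p)
           (trans (⨁-xor (λ v → (v == b) ∧ alive v) (λ v → (v == c) ∧ alive v))
             (cong₂ _xor_ (trans (⨁-delta b alive) q) (trans (⨁-delta c alive) r))) ⟩
    true ∎
    where
    open ≡-Reasoning
    lem : ∀ x a b c → x ∧ (a xor (b xor c)) ≡ (a ∧ x) xor ((b ∧ x) xor (c ∧ x))
    lem true  a b c rewrite Boolₚ.∧-identityʳ a | Boolₚ.∧-identityʳ b | Boolₚ.∧-identityʳ c = refl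
    lem false a b c rewrite Boolₚ.∧-zeroʳ a | Boolₚ.∧-zeroʳ b | Boolₚ.∧-zeroʳ c = refl

  deg-pos : ∀ {x v} → (∀ e → 0ℤ ≤ x e) → 0ℤ < deg G v x → Σ (Fin m) λ e → inc G e v ≡ true × 0ℤ < x e
  deg-pos {x} {v} nn p with ∑-pos (λ e → ⟦ inc G e v ⟧ * x e) p
  ... | e , q with inc G e v in i
  ...   | true  = e , i , subst (0ℤ <_) (ℤₚ.*-identityˡ (x e)) q
  ...   | false = ⊥-elim (ℤₚ.<-irrefl (sym (ℤₚ.*-zeroˡ (x e))) q)

  edge-vector : ∀ (M : Fin m → Bool) (x y : Fin m) v → (∀ e → ⟦ M e ⟧ ≡ ⟦ e == x ⟧ + ⟦ e == y ⟧) →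
                deg G v (⟦_⟧ ∘ M) ≡ ⟦ inc G x v ⟧ + ⟦ inc G y v ⟧
  edge-vector M x y v h = trans (∑-cong (λ e → trans (cong (⟦ inc G e v ⟧ *_) (h e))
      (lem ⟦ inc G e v ⟧ ⟦ e == x ⟧ ⟦ e == y ⟧)))
    (trans (∑-+ (λ e → ⟦ e == x ⟧ * ⟦ inc G e v ⟧) (λ e → ⟦ e == y ⟧ * ⟦ inc G e v ⟧))
           (cong₂ _+_ (∑-delta x (λ e → ⟦ inc G e v ⟧)) (∑-delta y (λ e → ⟦ inc G e v ⟧))))
    where
    lem : ∀ i a b → i * (a + b) ≡ a * i + b * i
    lem = solve-∀

  module _ {w : Fin m → ℤ} {r : ℤ} (gw : Good G w r) where
    open Good gw

    -- All the weight at b goes to a and c, so the cut of {a,b,c} weighs at most deg a + deg c - deg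
    -- b = r. The inequality is checked edge by edge.
    narrow : ∀ {a b c} → alive a ≡ true → alive b ≡ true → alive c ≡ true →
             (∀ e → inc G e b ≡ true → 0ℤ < w e → inc G e a ≡ true ⊎ inc G e c ≡ true) →
             cut G (triple a b c) w ≤ r
    narrow {a} {b} {c} al bl cl h = diff (subst (0ℤ ≤_) (lem (cut G (triple a b c) w) r) (undiff sums))
      where
      lem : ∀ x r → (r + (r + r)) - (x + (r + r)) ≡ r - x
      lem = solve-∀
      δ : Fin n → Fin m → ℤ
      δ v e = ⟦ inc G e v ⟧ * w e
      term : ∀ e → ⟦ cross G (triple a b c) e ⟧ * w e + (δ b e + δ b e) ≤ δ a e + (δ b e + δ c e)
      term e with 0ℤ ℤₚ.<? w e
      ... | no ¬p rewrite nonpos⇒0 (nonneg e) ¬p = ℤₚ.≤-reflexive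
        (lem₀ ⟦ cross G (triple a b c) e ⟧ ⟦ inc G e a ⟧ ⟦ inc G e b ⟧ ⟦ inc G e c ⟧)
        where
        lem₀ : ∀ t a b c → t * 0ℤ + (b * 0ℤ + b * 0ℤ) ≡ a * 0ℤ + (b * 0ℤ + c * 0ℤ)
        lem₀ = solve-∀
      ... | yes p = subst (λ t → ⟦ t ⟧ * w e + (δ b e + δ b e) ≤ δ a e + (δ b e + δ c e)) (sym (cross-triple a b c e))
          (diff (subst (0ℤ ≤_) (factor ⟦ inc G e a ⟧ ⟦ inc G e b ⟧ ⟦ inc G e c ⟧ ⟦ inc G e a xor (inc G e b xor inc G e c) ⟧ (w e))
            (0≤* (coefficient (inc G e a) (inc G e b) (inc G e c) (λ q → h e q p)) (nonneg e))))
        where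
        factor : ∀ a b c t w → (a + c - t - b) * w ≡ (a * w + (b * w + c * w)) - (t * w + (b * w + b * w))
        factor = solve-∀
        coefficient : ∀ x y z → (y ≡ true → x ≡ true ⊎ z ≡ true) → 0ℤ ≤ ⟦ x ⟧ + ⟦ z ⟧ - ⟦ x xor (y xor z) ⟧ - ⟦ y ⟧
        coefficient true  true  true  h = ℤₚ.≤-refl
        coefficient true  true  false h = ℤₚ.≤-refl
        coefficient true  false true  h = ℤ.+≤+ ℕ.z≤n
        coefficient true  false false h = ℤₚ.≤-refl
        coefficient false true  true  h = ℤₚ.≤-refl
        coefficient false true  false h = [ (λ ()) , (λ ()) ]′ (h refl)
        coefficient false false true  h = ℤₚ.≤-refl
        coefficient false false false h = ℤₚ.≤-refl
      sums : cut G (triple a b c) w + (r + r) ≤ r + (r + r)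
      sums = subst₂ _≤_
        (trans (∑-+ (λ e → ⟦ cross G (triple a b c) e ⟧ * w e) (λ e → δ b e + δ b e))
          (cong (λ z → cut G (triple a b c) w + z) (trans (∑-+ (δ b) (δ b)) (cong₂ _+_ (deg≡r b bl) (deg≡r b bl)))))
        (trans (∑-+ (δ a) (λ e → δ b e + δ c e))
          (cong₂ _+_ (deg≡r a al) (trans (∑-+ (δ b) (δ c)) (cong₂ _+_ (deg≡r b bl) (deg≡r c cl)))))
        (∑-mono term)

positive : ∀ {m} → (Fin m → ℤ) → Fin m → Bool
positive w e = does (0ℤ ℤₚ.<? w e)

module _ {n m : ℕ} (G : Net n m) (even : ⨁ (Net.alive G) ≡ false) {w : Fin m → ℤ} {r : ℤ} (gw : Good G w r) where
  open Net G
  open Good gw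

  SupportedPM : Set
  SupportedPM = Σ (PM G) λ M → (∀ e → proj₁ M e ≡ true → 0ℤ < w e) × Σ (Fin m) λ e → proj₁ M e ≡ true

  -- With two vertices `e₀` is a perfect matching; three are excluded by parity. With four, p, q, c,
  -- d, the pair c, d is joined in the support, since otherwise 2 r = w(δ{c,d}) = w(δ{p,q}) ≤ 2 r -
  -- 2 w(e₀). The triples used for larger graphs would not give nontrivial cuts here.
  small-pm : ∀ {e₀} → 0ℤ < w e₀ → count alive ℕ.≤ 4 → SupportedPM
  small-pm {e₀} we₀ few = third (any? λ c → (alive c Boolₚ.≟ true) ×-dec (¬? (c ≟ p) ×-dec ¬? (c ≟ q)))
    where
    p q : Fin n
    p = src e₀
    q = tgt e₀
    p≢q : p ≢ q
    p≢q h = ℤₚ.<-irrefl (sym (loop≡0 e₀ h)) we₀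
    ip : inc G e₀ p ≡ true
    ip = inc-src G e₀ p≢q
    iq : inc G e₀ q ≡ true
    iq = inc-tgt G e₀ p≢q
    only : ∀ {x e} → e == x ≡ true → 0ℤ < w x → 0ℤ < w e
    only {x} {e} h p = subst (λ e → 0ℤ < w e) (sym (==⇒≡ h)) p
    third : Dec (Σ (Fin n) λ c → alive c ≡ true × c ≢ p × c ≢ q) → SupportedPM
    third (no none) = ((λ e → e == e₀) , isPM (λ e h → subst (λ e → src e ≢ tgt e) (sym (==⇒≡ h)) p≢q) dg) ,
        (λ e h → only h we₀) , e₀ , ==-refl e₀
      where
      one : ∀ v → deg G v (λ e → ⟦ e == e₀ ⟧) ≡ ⟦ inc G e₀ v ⟧
      one v = trans (∑-cong (λ e → ℤₚ.*-comm ⟦ inc G e v ⟧ ⟦ e == e₀ ⟧)) (∑-delta e₀ (λ e → ⟦ inc G e v ⟧))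
      dg : ∀ v → alive v ≡ true → deg G v (λ e → ⟦ e == e₀ ⟧) ≡ 1ℤ
      dg v av with v ≟ p | v ≟ q
      ... | yes refl | _        = trans (one v) (cong ⟦_⟧ ip)
      ... | no _     | yes refl = trans (one v) (cong ⟦_⟧ iq)
      ... | no a     | no b     = ⊥-elim (none (v , av , a , b))
    third (yes (c , ac , c≢p , c≢q)) = fourth (any? λ d → (alive d Boolₚ.≟ true) ×-dec (¬? (d ≟ p) ×-dec (¬? (d ≟ q) ×-dec ¬? (d ≟ c))))
      where
      fourth : Dec (Σ (Fin n) λ d → alive d ≡ true × d ≢ p × d ≢ q × d ≢ c) → SupportedPM
      fourth (no none) = ⊥-elim (true≢false (trans (⨁-cong λ v → by v (bool-cases (alive v)))
                           (odd-triple G (src-alive e₀) (tgt-alive e₀) ac)) even)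
        where
        by : ∀ v → alive v ≡ true ⊎ alive v ≡ false → alive v ≡ alive v ∧ triple G p q c v
        by v (inj₂ d) rewrite d = refl
        by v (inj₁ a) = trans a (sym (cong₂ _∧_ a at))
          where
          at : triple G p q c v ≡ true
          at with v ≟ p | v ≟ q | v ≟ c
          ... | yes refl | yes h | _      = ⊥-elim (p≢q h)
          ... | yes refl | no _  | yes h  = ⊥-elim (c≢p (sym h))
          ... | yes _ | no _ | no _       = refl
          ... | no _ | yes refl | yes h   = ⊥-elim (c≢q (sym h))
          ... | no _ | yes _ | no _       = refl
          ... | no _ | no _ | yes _       = refl
          ... | no x | no y | no z        = ⊥-elim (none (v , a , x , y , z))
      fourth (yes (d , ad , d≢p , d≢q , d≢c)) = opposite (any? λ e → (0ℤ ℤₚ.<? w e) ×-dec ((inc G e c Boolₚ.≟ true) ×-dec (inc G e d Boolₚ.≟ true)))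
        where
        four : ∀ v → alive v ≡ true → v ≡ p ⊎ v ≡ q ⊎ v ≡ c ⊎ v ≡ d
        four v av with v ≟ p | v ≟ q | v ≟ c | v ≟ d
        ... | yes h | _ | _ | _ = inj₁ h
        ... | no _ | yes h | _ | _ = inj₂ (inj₁ h)
        ... | no _ | no _ | yes h | _ = inj₂ (inj₂ (inj₁ h))
        ... | no _ | no _ | no _ | yes h = inj₂ (inj₂ (inj₂ h))
        ... | no x | no y | no z | no t = ⊥-elim (ℕₚ.<⇒≱ (count-⊇ {p = alive} distinct all-alive) few)
          where
          distinct : Unique (v ∷ p ∷ q ∷ c ∷ d ∷ [])
          distinct = (x ∷ y ∷ z ∷ t ∷ []) ∷ (p≢q ∷ (c≢p ∘ sym) ∷ (d≢p ∘ sym) ∷ []) ∷ ((c≢q ∘ sym) ∷ (d≢q ∘ sym) ∷ []) ∷ ((d≢c ∘ sym) ∷ []) ∷ [] ∷ []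
          all-alive : ∀ i → i ∈ v ∷ p ∷ q ∷ c ∷ d ∷ [] → alive i ≡ true
          all-alive i = All.lookup {P = λ i → alive i ≡ true} (av ∷ src-alive e₀ ∷ tgt-alive e₀ ∷ ac ∷ ad ∷ [])
        pair : Fin n → Fin n → Fin n → Bool
        pair a b u = (u == a) xor (u == b)
        cross-pair : ∀ a b e → cross G (pair a b) e ≡ inc G e a xor inc G e b
        cross-pair a b e = xor-interchange (src e == a) _ (tgt e == a) _
        opposite : Dec (Σ (Fin m) λ e → 0ℤ < w e × inc G e c ≡ true × inc G e d ≡ true) → SupportedPM
        opposite (no none) = ⊥-elim (ℤₚ.<⇒≱ (0<+ we₀ (ℤₚ.<⇒≤ we₀)) (diff (subst (0ℤ ≤_) (lem r (w e₀)) (undiff bound))))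
          where
          lem : ∀ r x → (r + r) - ((r + r) + (x + x)) ≡ 0ℤ - (x + x)
          lem = solve-∀
          xor≤ : ∀ a b → 0ℤ ≤ ⟦ a ⟧ + ⟦ b ⟧ - ⟦ a xor b ⟧
          xor≤ true  true  = ℤ.+≤+ ℕ.z≤n
          xor≤ true  false = ℤₚ.≤-refl
          xor≤ false true  = ℤₚ.≤-refl
          xor≤ false false = ℤₚ.≤-refl
          near : ∀ e → ⟦ cross G (pair p q) e ⟧ * w e + (⟦ e == e₀ ⟧ * w e + ⟦ e == e₀ ⟧ * w e) ≤ ⟦ inc G e p ⟧ * w e + ⟦ inc G e q ⟧ * w e
          near e with e ≟ e₀
          ... | yes refl rewrite cross-pair p q e₀ | ip | iq = ℤₚ.≤-reflexive (lem₁ (w e₀))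
            where
            lem₁ : ∀ x → 0ℤ * x + (1ℤ * x + 1ℤ * x) ≡ 1ℤ * x + 1ℤ * x
            lem₁ = solve-∀
          ... | no _ rewrite cross-pair p q e = diff (subst (0ℤ ≤_) (lem₂ ⟦ inc G e p ⟧ ⟦ inc G e q ⟧ ⟦ inc G e p xor inc G e q ⟧ (w e))
                  (0≤* (xor≤ (inc G e p) (inc G e q)) (nonneg e)))
            where
            lem₂ : ∀ a b t x → (a + b - t) * x ≡ (a * x + b * x) - (t * x + (0ℤ * x + 0ℤ * x))
            lem₂ = solve-∀
          far : ∀ e → ⟦ inc G e c ⟧ * w e + ⟦ inc G e d ⟧ * w e ≡ ⟦ cross G (pair c d) e ⟧ * w e
          far e rewrite cross-pair c d e with inc G e c in ic | inc G e d in id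
          ... | true  | true  = trans (cong₂ (λ a b → 1ℤ * a + 1ℤ * b) we≡0 we≡0) (sym (trans (cong (0ℤ *_) we≡0) refl))
            where
            we≡0 : w e ≡ 0ℤ
            we≡0 = nonpos⇒0 (nonneg e) (λ h → none (e , h , ic , id))
          ... | true  | false = lem₃ (w e)
            where
            lem₃ : ∀ x → 1ℤ * x + 0ℤ * x ≡ 1ℤ * x
            lem₃ = solve-∀
          ... | false | true  = lem₃ (w e)
            where
            lem₃ : ∀ x → 0ℤ * x + 1ℤ * x ≡ 1ℤ * x
            lem₃ = solve-∀
          ... | false | false = lem₃ (w e)
            where
            lem₃ : ∀ x → 0ℤ * x + 0ℤ * x ≡ 0ℤ * x
            lem₃ = solve-∀
          complement : ∀ v → alive v ≡ true → pair c d v ≡ not (pair p q v)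
          complement v av with four v av
          ... | inj₁ refl rewrite ==-refl p | ≢⇒== p≢q | ≢⇒== (c≢p ∘ sym) | ≢⇒== (d≢p ∘ sym) = refl
          ... | inj₂ (inj₁ refl) rewrite ==-refl q | ≢⇒== (p≢q ∘ sym) | ≢⇒== (c≢q ∘ sym) | ≢⇒== (d≢q ∘ sym) = refl
          ... | inj₂ (inj₂ (inj₁ refl)) rewrite ==-refl c | ≢⇒== c≢p | ≢⇒== c≢q | ≢⇒== (d≢c ∘ sym) = refl
          ... | inj₂ (inj₂ (inj₂ refl)) rewrite ==-refl d | ≢⇒== d≢p | ≢⇒== d≢q | ≢⇒== d≢c = refl
          2r≡cut : r + r ≡ cut G (pair p q) w
          2r≡cut = trans (sym (cong₂ _+_ (deg≡r c ac) (deg≡r d ad)))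
            (trans (sym (∑-+ (λ e → ⟦ inc G e c ⟧ * w e) (λ e → ⟦ inc G e d ⟧ * w e)))
            (trans (∑-cong far) (trans (cut-cong G {pair c d} {not ∘ pair p q} complement (λ _ _ → refl)) (cut-∁ G (pair p q) w))))
          bound : (r + r) + (w e₀ + w e₀) ≤ r + r
          bound = subst₂ _≤_
            (trans (∑-+ (λ e → ⟦ cross G (pair p q) e ⟧ * w e) (λ e → ⟦ e == e₀ ⟧ * w e + ⟦ e == e₀ ⟧ * w e))
              (cong₂ _+_ (sym 2r≡cut) (trans (∑-+ (λ e → ⟦ e == e₀ ⟧ * w e) (λ e → ⟦ e == e₀ ⟧ * w e)) (cong₂ _+_ (∑-delta e₀ w) (∑-delta e₀ w)))))
            (trans (∑-+ (λ e → ⟦ inc G e p ⟧ * w e) (λ e → ⟦ inc G e q ⟧ * w e))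
              (cong₂ _+_ (deg≡r p (src-alive e₀)) (deg≡r q (tgt-alive e₀))))
            (∑-mono near)
        opposite (yes (e₁ , we₁ , jc , jd)) = (M , isPM nl dg) , sub , e₀ , cong (_∨ (e₀ == e₁)) (==-refl e₀)
          where
          M : Fin m → Bool
          M e = (e == e₀) ∨ (e == e₁)
          jp : inc G e₁ p ≡ false
          jp = third-end G jc jd (d≢c ∘ sym) (c≢p ∘ sym) (d≢p ∘ sym)
          jq : inc G e₁ q ≡ false
          jq = third-end G jc jd (d≢c ∘ sym) (c≢q ∘ sym) (d≢q ∘ sym)
          kc : inc G e₀ c ≡ false
          kc = third-end G ip iq p≢q c≢p c≢q
          kd : inc G e₀ d ≡ false
          kd = third-end G ip iq p≢q d≢p d≢q
          e₀≢e₁ : e₀ ≢ e₁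
          e₀≢e₁ h = true≢false ip (trans (cong (λ e → inc G e p) h) jp)
          split : ∀ e → ⟦ M e ⟧ ≡ ⟦ e == e₀ ⟧ + ⟦ e == e₁ ⟧
          split e with e ≟ e₀ | e ≟ e₁
          ... | yes refl | yes h = ⊥-elim (e₀≢e₁ h)
          ... | yes _ | no _ = refl
          ... | no _ | yes _ = refl
          ... | no _ | no _ = refl
          sub : ∀ e → M e ≡ true → 0ℤ < w e
          sub e h with e ≟ e₀ | e ≟ e₁
          ... | yes refl | _ = we₀
          ... | no _ | yes refl = we₁
          sub e () | no _ | no _
          nl : ∀ e → M e ≡ true → src e ≢ tgt e
          nl e h q = ℤₚ.<-irrefl (sym (loop≡0 e q)) (sub e h)
          dg : ∀ v → alive v ≡ true → deg G v (⟦_⟧ ∘ M) ≡ 1ℤ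
          dg v av = trans (edge-vector G M e₀ e₁ v split) (by (four v av))
            where
            by : v ≡ p ⊎ v ≡ q ⊎ v ≡ c ⊎ v ≡ d → ⟦ inc G e₀ v ⟧ + ⟦ inc G e₁ v ⟧ ≡ 1ℤ
            by (inj₁ refl) = cong₂ (λ a b → ⟦ a ⟧ + ⟦ b ⟧) ip jp
            by (inj₂ (inj₁ refl)) = cong₂ (λ a b → ⟦ a ⟧ + ⟦ b ⟧) iq jq
            by (inj₂ (inj₂ (inj₁ refl))) = cong₂ (λ a b → ⟦ a ⟧ + ⟦ b ⟧) kc jc
            by (inj₂ (inj₂ (inj₂ refl))) = cong₂ (λ a b → ⟦ a ⟧ + ⟦ b ⟧) kd jd

  supp : Fin m → Bool
  supp = positive w

  supp-true : ∀ {e} → 0ℤ < w e → supp e ≡ true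
  supp-true {e} = dec-true (0ℤ ℤₚ.<? w e)

  module _ (r>0 : 0ℤ < r) (strict : ∀ {T} → T ∈ cuts G → r < cut G (lookup T) w) (many : 5 ℕ.≤ count alive) where

    -- With at least five vertices, two lie outside {a,b,c}. This makes the triple a nontrivial odd
    -- cut, and `narrow` contradicts its strictness.
    not-narrow : ∀ {a b c} → alive a ≡ true → alive b ≡ true → alive c ≡ true → a ≢ b → a ≢ c → b ≢ c →
                 (∀ e → inc G e b ≡ true → 0ℤ < w e → inc G e a ≡ true ⊎ inc G e c ≡ true) → ⊥
    not-narrow {a} {b} {c} al bl cl ab ac bc h = outside (fresh alive (a ∷ b ∷ c ∷ []) (ℕₚ.≤-trans (ℕ.s≤s (ℕ.s≤s (ℕ.s≤s (ℕ.s≤s ℕ.z≤n)))) many))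
      where
      W : Fin n → Bool
      W = triple G a b c
      T-out : ∀ {u} → u ≢ a → u ≢ b → u ≢ c → W u ≡ false
      T-out p q r rewrite ≢⇒== p | ≢⇒== q | ≢⇒== r = refl
      T-a : W a ≡ true
      T-a rewrite ==-refl a | ≢⇒== ab | ≢⇒== ac = refl
      T-b : W b ≡ true
      T-b rewrite ==-refl b | ≢⇒== (ab ∘ sym) | ≢⇒== bc = refl
      absurd : OddCut G W → ⊥
      absurd o = by (cuts-complete G o)
        where
        by : Σ (Vec Bool n) (λ T′ → T′ ∈ cuts G × (∀ v → lookup T′ v ≡ W v)) → ⊥
        by (T′ , T′∈ , eq) = ℤₚ.<⇒≱ (strict T′∈) (subst (_≤ r) (cut-cong G {W} {lookup T′} (λ v _ → sym (eq v)) (λ _ _ → refl))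
          (narrow G gw al bl cl h))
      outside : Σ (Fin n) (λ p → alive p ≡ true × p ∉ (a ∷ b ∷ c ∷ [])) → ⊥
      outside (p , ap , p∉) = outside₂ (fresh alive (p ∷ a ∷ b ∷ c ∷ []) many)
        where
        outside₂ : Σ (Fin n) (λ q → alive q ≡ true × q ∉ (p ∷ a ∷ b ∷ c ∷ [])) → ⊥
        outside₂ (q , aq , q∉) = absurd (oddCut (odd-triple G al bl cl)
          (two a b al bl T-a T-b (ab ∘ sym))
          (two p q ap aq (cong not (T-out (p∉ ∘ here) (p∉ ∘ there ∘ here) (p∉ ∘ there ∘ there ∘ here)))
                         (cong not (T-out (q∉ ∘ there ∘ here) (q∉ ∘ there ∘ there ∘ here) (q∉ ∘ there ∘ there ∘ there ∘ here)))
                         (q∉ ∘ here)))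

    -- With one or two neighbours in the support, v is the middle vertex of a triple refuted by
    -- `not-narrow`; if there is only one neighbour, the third vertex is arbitrary.
    three-neighbours : ∀ v → alive v ≡ true → 1ℤ + (1ℤ + 1ℤ) ≤ deg G v (⟦_⟧ ∘ supp)
    three-neighbours v av = first (deg-pos G nonneg (subst (0ℤ <_) (sym (deg≡r v av)) r>0))
      where
      goal : Set
      goal = 1ℤ + (1ℤ + 1ℤ) ≤ deg G v (⟦_⟧ ∘ supp)
      first : Σ (Fin m) (λ e → inc G e v ≡ true × 0ℤ < w e) → goal
      first (e₁ , i₁ , p₁) = second (other-end G i₁)
        where
        second : Σ (Fin n) (λ u → u ≢ v × inc G e₁ u ≡ true) → goal
        second (a , a≢v , ia) = seek (any? λ e → ((inc G e v Boolₚ.≟ true) ×-dec (0ℤ ℤₚ.<? w e)) ×-dec (inc G e a Boolₚ.≟ false))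
          where
          aa : alive a ≡ true
          aa = inc-alive G e₁ a ia
          seek : Dec (Σ (Fin m) λ e → (inc G e v ≡ true × 0ℤ < w e) × inc G e a ≡ false) → goal
          seek (no none) = ⊥-elim (by (fresh alive (a ∷ v ∷ []) (ℕₚ.≤-trans (ℕ.s≤s (ℕ.s≤s (ℕ.s≤s ℕ.z≤n))) many)))
            where
            by : Σ (Fin n) (λ c → alive c ≡ true × c ∉ (a ∷ v ∷ [])) → ⊥
            by (c , ac , c∉) = not-narrow aa av ac a≢v (λ h → c∉ (here (sym h))) (λ h → c∉ (there (here (sym h))))
              λ e i p → inj₁ (¬-not′ (λ k → none (e , (i , p) , k)))
              where
              ¬-not′ : ∀ {b} → (b ≡ false → ⊥) → b ≡ true
              ¬-not′ {true}  _ = refl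
              ¬-not′ {false} k = ⊥-elim (k refl)
          seek (yes (e₂ , (i₂ , p₂) , k₂)) = other (other-end G i₂)
            where
            other : Σ (Fin n) (λ u → u ≢ v × inc G e₂ u ≡ true) → goal
            other (c , c≢v , ic) = last (any? λ e → ((inc G e v Boolₚ.≟ true) ×-dec (0ℤ ℤₚ.<? w e)) ×-dec
                                                    ((inc G e a Boolₚ.≟ false) ×-dec (inc G e c Boolₚ.≟ false)))
              where
              c≢a : c ≢ a
              c≢a h = true≢false ic (trans (cong (inc G e₂) h) k₂)
              last : Dec (Σ (Fin m) λ e → (inc G e v ≡ true × 0ℤ < w e) × inc G e a ≡ false × inc G e c ≡ false) → goal
              last (no none) = ⊥-elim (not-narrow aa av (inc-alive G e₂ c ic) a≢v (c≢a ∘ sym) (c≢v ∘ sym)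
                λ e i p → by e i p (bool-cases (inc G e a)) (bool-cases (inc G e c)))
                where
                by : ∀ e → inc G e v ≡ true → 0ℤ < w e → inc G e a ≡ true ⊎ inc G e a ≡ false → inc G e c ≡ true ⊎ inc G e c ≡ false →
                     inc G e a ≡ true ⊎ inc G e c ≡ true
                by e i p (inj₁ h) _        = inj₁ h
                by e i p (inj₂ _) (inj₁ h) = inj₂ h
                by e i p (inj₂ h) (inj₂ k) = ⊥-elim (none (e , (i , p) , h , k))
              last (yes (e₃ , (i₃ , p₃) , k₃ , l₃)) = subst₂ _≤_
                  (trans (∑-+ (λ e → ⟦ e == e₁ ⟧) (λ e → ⟦ e == e₂ ⟧ + ⟦ e == e₃ ⟧))
                    (cong₂ _+_ (∑-delta₁ e₁) (trans (∑-+ (λ e → ⟦ e == e₂ ⟧) (λ e → ⟦ e == e₃ ⟧)) (cong₂ _+_ (∑-delta₁ e₂) (∑-delta₁ e₃)))))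
                  refl (∑-mono term)
                where
                e₁≢e₂ : e₁ ≢ e₂
                e₁≢e₂ h = true≢false ia (trans (cong (λ e → inc G e a) h) k₂)
                e₁≢e₃ : e₁ ≢ e₃
                e₁≢e₃ h = true≢false ia (trans (cong (λ e → inc G e a) h) k₃)
                e₂≢e₃ : e₂ ≢ e₃
                e₂≢e₃ h = true≢false ic (trans (cong (λ e → inc G e c) h) l₃)
                one : ∀ {e} → inc G e v ≡ true → 0ℤ < w e → ⟦ inc G e v ⟧ * ⟦ supp e ⟧ ≡ 1ℤ
                one i p = cong₂ (λ a b → ⟦ a ⟧ * ⟦ b ⟧) i (supp-true p)
                term : ∀ e → ⟦ e == e₁ ⟧ + (⟦ e == e₂ ⟧ + ⟦ e == e₃ ⟧) ≤ ⟦ inc G e v ⟧ * ⟦ supp e ⟧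
                term e with e ≟ e₁ | e ≟ e₂ | e ≟ e₃
                ... | yes h | yes k | _ = ⊥-elim (e₁≢e₂ (trans (sym h) k))
                ... | yes h | no _ | yes k = ⊥-elim (e₁≢e₃ (trans (sym h) k))
                ... | no _ | yes h | yes k = ⊥-elim (e₂≢e₃ (trans (sym h) k))
                ... | yes refl | no _ | no _ = ℤₚ.≤-reflexive (sym (one i₁ p₁))
                ... | no _ | yes refl | no _ = ℤₚ.≤-reflexive (sym (one i₂ p₂))
                ... | no _ | no _ | yes refl = ℤₚ.≤-reflexive (sym (one i₃ p₃))
                ... | no _ | no _ | no _ = 0≤* (0≤⟦⟧ (inc G e v)) (0≤⟦⟧ (supp e))

    -- Counting incidences in the support gives 3 |V| ≤ 2 |E|, and V is not empty.
    fewer-vertices : count alive ℕ.< count supp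
    fewer-vertices = ℤₚ.drop‿+<+ (by (+ count supp ℤₚ.≤? + count alive))
      where
      A S : ℤ
      A = + count alive
      S = + count supp
      A>0 : 0ℤ < A
      A>0 = ℤ.+<+ (ℕₚ.≤-trans (ℕ.s≤s ℕ.z≤n) many)
      row : ∀ v → (1ℤ + (1ℤ + 1ℤ)) * ⟦ alive v ⟧ ≤ ∑ (λ e → ⟦ alive v ⟧ * (⟦ inc G e v ⟧ * ⟦ supp e ⟧))
      row v with alive v in av
      ... | true  = subst₂ _≤_ refl (sym (trans (∑-* 1ℤ (λ e → ⟦ inc G e v ⟧ * ⟦ supp e ⟧)) (ℤₚ.*-identityˡ _))) (three-neighbours v av)
      ... | false = ∑-nonneg (λ e → ℤₚ.≤-reflexive (sym (ℤₚ.*-zeroˡ (⟦ inc G e v ⟧ * ⟦ supp e ⟧))))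
      column : ∀ e → ∑ (λ v → ⟦ alive v ⟧ * (⟦ inc G e v ⟧ * ⟦ supp e ⟧)) ≤ (1ℤ + 1ℤ) * ⟦ supp e ⟧
      column e = ℤₚ.≤-trans (∑-mono entry) (ℤₚ.≤-reflexive
          (trans (∑-+ (λ v → ⟦ v == src e ⟧ * ⟦ supp e ⟧) (λ v → ⟦ v == tgt e ⟧ * ⟦ supp e ⟧))
            (trans (cong₂ _+_ (∑-delta (src e) (λ _ → ⟦ supp e ⟧)) (∑-delta (tgt e) (λ _ → ⟦ supp e ⟧))) (lem ⟦ supp e ⟧))))
        where
        lem : ∀ s → s + s ≡ (1ℤ + 1ℤ) * s
        lem = solve-∀
        ent : ∀ a x y s → ⟦ a ⟧ * (⟦ x xor y ⟧ * ⟦ s ⟧) ≤ ⟦ x ⟧ * ⟦ s ⟧ + ⟦ y ⟧ * ⟦ s ⟧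
        ent true  true  true  true  = ℤ.+≤+ ℕ.z≤n
        ent true  true  false true  = ℤₚ.≤-refl
        ent true  false true  true  = ℤₚ.≤-refl
        ent true  false false true  = ℤₚ.≤-refl
        ent true  true  true  false = ℤₚ.≤-refl
        ent true  true  false false = ℤₚ.≤-refl
        ent true  false true  false = ℤₚ.≤-refl
        ent true  false false false = ℤₚ.≤-refl
        ent false x     y     s     = subst (_≤ ⟦ x ⟧ * ⟦ s ⟧ + ⟦ y ⟧ * ⟦ s ⟧) (sym (ℤₚ.*-zeroˡ (⟦ x xor y ⟧ * ⟦ s ⟧)))
          (0≤+ (0≤* (0≤⟦⟧ x) (0≤⟦⟧ s)) (0≤* (0≤⟦⟧ y) (0≤⟦⟧ s)))
        entry : ∀ v → ⟦ alive v ⟧ * (⟦ inc G e v ⟧ * ⟦ supp e ⟧) ≤ ⟦ v == src e ⟧ * ⟦ supp e ⟧ + ⟦ v == tgt e ⟧ * ⟦ supp e ⟧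
        entry v rewrite ==-comm v (src e) | ==-comm v (tgt e) = ent (alive v) (src e == v) (tgt e == v) (supp e)
      double : (1ℤ + (1ℤ + 1ℤ)) * A ≤ (1ℤ + 1ℤ) * S
      double = subst₂ _≤_ (trans (∑-* (1ℤ + (1ℤ + 1ℤ)) (λ v → ⟦ alive v ⟧)) (cong ((1ℤ + (1ℤ + 1ℤ)) *_) (∑-count alive)))
                          (trans (∑-* (1ℤ + 1ℤ) (λ e → ⟦ supp e ⟧)) (cong ((1ℤ + 1ℤ) *_) (∑-count supp)))
        (ℤₚ.≤-trans (∑-mono row) (ℤₚ.≤-trans (ℤₚ.≤-reflexive (∑-swap (λ v e → ⟦ alive v ⟧ * (⟦ inc G e v ⟧ * ⟦ supp e ⟧)))) (∑-mono column)))
      by : Dec (S ≤ A) → A < S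
      by (no ¬p) = ℤₚ.≰⇒> ¬p
      by (yes p) = ⊥-elim (ℤₚ.<⇒≱ A>0 (diff (subst (0ℤ ≤_) (lem A S) (0≤+ (undiff double) (0≤+ (undiff p) (undiff p))))))
        where
        lem : ∀ a s → ((1ℤ + 1ℤ) * s - (1ℤ + (1ℤ + 1ℤ)) * a) + ((a - s) + (a - s)) ≡ 0ℤ - a
        lem = solve-∀

    -- Besides the degree equations there is a unit row for every edge outside the support, which
    -- forces y to vanish there; together these are fewer than m rows. A change of sign makes some
    -- entry of y positive, so that the ray in the direction -y leaves the cone.
    direction : Σ (Fin m → ℤ) λ y → Regular G y 0ℤ × (∀ e → w e ≡ 0ℤ → y e ≡ 0ℤ) × Σ (Fin m) λ e → 0ℤ < w e × 0ℤ < y e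
    direction = signed (kernel rows enough)
      where
      degree-row : Fin n → Fin m → ℤ
      degree-row v e = ⟦ inc G e v ⟧
      unit-row : Fin m → Fin m → ℤ
      unit-row e i = ⟦ i == e ⟧
      rows : List (Fin m → ℤ)
      rows = map degree-row (select alive) ++ map unit-row (select (not ∘ supp))
      enough : length rows ℕ.< m
      enough = subst₂ ℕ._<_
        (sym (trans (Listₚ.length-++ (map degree-row (select alive)))
          (cong₂ ℕ._+_ (trans (Listₚ.length-map degree-row (select alive)) (length-select alive))
                       (trans (Listₚ.length-map unit-row (select (not ∘ supp))) (length-select (not ∘ supp))))))
        (count-∁ supp) (ℕₚ.+-monoˡ-< (count (not ∘ supp)) fewer-vertices)
      Result : Set
      Result = Σ (Fin m → ℤ) λ y → Regular G y 0ℤ × (∀ e → w e ≡ 0ℤ → y e ≡ 0ℤ) × Σ (Fin m) λ e → 0ℤ < w e × 0ℤ < y e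
      signed : Σ (Fin m → ℤ) (λ y → Σ (Fin m) (λ e → y e ≢ 0ℤ) × (∀ {ρ} → ρ ∈ rows → ∑ (λ e → ρ e * y e) ≡ 0ℤ)) → Result
      signed (y , (e , ye≢0) , killed) = sign (ℤₚ.<-cmp 0ℤ (y e))
        where
        reg : Regular G y 0ℤ
        reg v av = killed (∈-++⁺ˡ (∈-map⁺ degree-row (∈-select alive v av)))
        off : ∀ i → w i ≡ 0ℤ → y i ≡ 0ℤ
        off i q = trans (sym (∑-delta i y)) (killed (∈-++⁺ʳ (map degree-row (select alive)) (∈-map⁺ unit-row
          (∈-select (not ∘ supp) i (cong not (dec-false (0ℤ ℤₚ.<? w i) (λ p → ℤₚ.<-irrefl (sym q) p)))))))
        we : 0ℤ < w e
        we = ℤₚ.≤∧≢⇒< (nonneg e) (λ q → ye≢0 (off e (sym q)))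
        neg-* : ∀ a b → a * - b ≡ - (1ℤ) * (a * b)
        neg-* = solve-∀
        sign : _ → Result
        sign (tri< p _ _) = y , reg , off , e , we , p
        sign (tri≈ _ p _) = ⊥-elim (ye≢0 (sym p))
        sign (tri> _ _ p) = (λ i → - y i) ,
          (λ v av → trans (∑-cong (λ i → neg-* ⟦ inc G i v ⟧ (y i))) (trans (∑-* (- 1ℤ) (λ i → ⟦ inc G i v ⟧ * y i)) (cong (- 1ℤ *_) (reg v av)))) ,
          (λ i q → cong -_ (off i q)) , e , we , ℤₚ.neg-mono-< p

    -- The exit point b has the positive degrees f r, so its decomposition is not empty. As b
    -- vanishes wherever w does, any matching in it is supported by w.
    large-pm : (∀ {b s U} → Good G b s → OddCut G U → cut G U b ≡ s → Dy G b) →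
               (∀ {b s e} → Good G b s → (∀ x → w x ≡ 0ℤ → b x ≡ 0ℤ) → 0ℤ < w e → b e ≡ 0ℤ → Dy G b) →
               SupportedPM
    large-pm solve-tight solve-zero = along direction
      where
      along : Σ (Fin m → ℤ) (λ y → Regular G y 0ℤ × (∀ e → w e ≡ 0ℤ → y e ≡ 0ℤ) × Σ (Fin m) λ e → 0ℤ < w e × 0ℤ < y e) → SupportedPM
      along (y , reg , off , e , we , ye) = exit (hit G even gw strict y 0ℤ reg off e we ye)
        where
        exit : Σ ℤ (λ f → Σ ℤ λ c → 0ℤ < f × 0ℤ < c × Hit G even gw strict y 0ℤ f c × Good G (λ x → f * w x - c * y x) (f * r - c * 0ℤ)) → SupportedPM
        exit (f , c , f>0 , c>0 , h , g) = pick (by h)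
          where
          b : Fin m → ℤ
          b x = f * w x - c * y x
          zero-b : ∀ x → w x ≡ 0ℤ → b x ≡ 0ℤ
          zero-b x q = trans (cong₂ (λ u v → f * u - c * v) q (off x q)) (lem f c)
            where
            lem : ∀ f c → f * 0ℤ - c * 0ℤ ≡ 0ℤ
            lem = solve-∀
          by : Hit G even gw strict y 0ℤ f c → Dy G b
          by (hit-edge e we fe ce) = solve-zero g zero-b we
            (trans (cong₂ (λ u v → u * w e - v * y e) fe ce) (lem (y e) (w e)))
            where
            lem : ∀ a b → a * b - b * a ≡ 0ℤ
            lem = solve-∀
          by (hit-cut {T} T∈ fT cT) = solve-tight g (∈-cuts G T∈) (trans (cut-lincomb G (lookup T) f c w y)
            (ℤₚ.i-j≡0⇒i≡j (f * cut G (lookup T) w - c * cut G (lookup T) y) (f * r - c * 0ℤ)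
              (trans (lem f c (cut G (lookup T) w) (cut G (lookup T) y) r)
              (trans (cong₂ (λ u v → f * u - c * v) (sym cT) (sym fT)) (lem′ f c)))))
            where
            lem : ∀ f c w y r → (f * w - c * y) - (f * r - c * 0ℤ) ≡ f * (w - r) - c * (y - 0ℤ)
            lem = solve-∀
            lem′ : ∀ f c → f * c - c * f ≡ 0ℤ
            lem′ = solve-∀
          pick : Dy G b → SupportedPM
          pick (k , L , p) = some (deg-pos G (Good.nonneg g) (subst (0ℤ <_) (sym (Good.deg≡r g (src e) (src-alive e))) s>0))
            where
            s>0 : 0ℤ < f * r - c * 0ℤ
            s>0 = subst (0ℤ <_) (lem (f * r) c) (0<* f>0 r>0)
              where
              lem : ∀ a c → a ≡ a - c * 0ℤ
              lem = solve-∀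
            some : Σ (Fin m) (λ x → inc G x (src e) ≡ true × 0ℤ < b x) → SupportedPM
            some (x , _ , bx) = found (total-pos G L {x} (subst (0ℤ <_) (p x) (0<* (2^-pos k) bx)))
              where
              found : Σ (PM G) (λ N → N ∈ L × proj₁ N x ≡ true) → SupportedPM
              found (N , N∈ , Nx) = N , sub , x , Nx
                where
                sub : ∀ z → proj₁ N z ≡ true → 0ℤ < w z
                sub z Nz = ℤₚ.≤∧≢⇒< (nonneg z) λ q → summand≢0 G {b} {k} {L} {N} p N∈ Nz (zero-b z (sym q))

-- The theorem

good⇒dy-step : ∀ {n m} (G : Net n m) → ⨁ (Net.alive G) ≡ false → ∀ {w r} → Good G w r →
  (∀ {b s U} → Good G b s → OddCut G U → cut G U b ≡ s → Dy G b) →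
  (∀ {b s e} → Good G b s → (∀ x → w x ≡ 0ℤ → b x ≡ 0ℤ) → 0ℤ < w e → b e ≡ 0ℤ → Dy G b) → Dy G w
good⇒dy-step {n} {m} G even {w} {r} gw solve-tight solve-zero = by-edge (any? λ e → 0ℤ ℤₚ.<? w e)
  where
  open Net G
  open Good gw
  module _ {e₀} (we₀ : 0ℤ < w e₀) (strict : ∀ {T} → T ∈ cuts G → r < cut G (lookup T) w) where
    r>0 : 0ℤ < r
    r>0 = ℤₚ.<-≤-trans we₀ (subst (w e₀ ≤_) (deg≡r (src e₀) (src-alive e₀))
      (edge≤cut G (_== src e₀) nonneg e₀ (inc-src G e₀ (λ q → ℤₚ.<-irrefl (sym (loop≡0 e₀ q)) we₀))))
    use : SupportedPM G even gw → Dy G w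
    use (M , M⊆w , _ , Me) = interior G even gw strict solve-tight M M⊆w solve-zero Me
    by-size : Dec (count alive ℕ.≤ 4) → Dy G w
    by-size (yes few) = use (small-pm G even gw we₀ few)
    by-size (no ¬few) = use (large-pm G even gw r>0 strict (ℕₚ.≰⇒> ¬few) solve-tight solve-zero)
  by-cut : Dec (Any (λ T → cut G (lookup T) w ≤ r) (cuts G)) → Σ (Fin m) (λ e → 0ℤ < w e) → Dy G w
  by-cut (yes some) _ = tight (find some)
    where
    tight : Σ (Vec Bool n) (λ T → T ∈ cuts G × cut G (lookup T) w ≤ r) → Dy G w
    tight (T , T∈ , p) = solve-tight gw (∈-cuts G T∈) (ℤₚ.≤-antisym p (r≤cut (OddCut.odd (∈-cuts G T∈))))
  by-cut (no none) (e₀ , we₀) = by-size we₀ (λ T∈ → ℤₚ.≰⇒> (λ p → none (lose T∈ p))) (count alive ℕₚ.≤? 4)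
  by-edge : Dec (Σ (Fin m) (λ e → 0ℤ < w e)) → Dy G w
  by-edge (no none) = dy-0 G (λ e → nonpos⇒0 (nonneg e) (λ p → none (e , p)))
  by-edge (yes e)   = by-cut (Any.any? (λ T → cut G (lookup T) w ℤₚ.≤? r) (cuts G)) e

tight⇒dy : ∀ {n m} (G : Net n m) → ⨁ (Net.alive G) ≡ false →
  (∀ (H : Net n m) → count (Net.alive H) ℕ.< count (Net.alive G) → ⨁ (Net.alive H) ≡ false → ∀ {w r} → Good H w r → Dy H w) →
  ∀ {b s U} → Good G b s → OddCut G U → cut G U b ≡ s → Dy G b
tight⇒dy G even ih {b} {s} {U} g (oddCut odd (two u₀ u₁ a₀ a₁ p₀ p₁ u≢) (two v₀ v₁ b₀ b₁ q₀ q₁ v≢)) tight =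
  dy-merge G U u₀ a₀ p₀ v₀ b₀ ¬Uv₀ {b}
    (ih (contract G U u₀ a₀ p₀) (contract-smaller G U u₀ a₀ p₀ a₁ p₁ u≢) (contract-even G U u₀ a₀ p₀ odd even)
        (contract-good G U u₀ a₀ p₀ odd g tight))
    (ih (contract G (not ∘ U) v₀ b₀ (cong not ¬Uv₀)) (contract-smaller G (not ∘ U) v₀ b₀ (cong not ¬Uv₀) b₁ q₁ v≢)
        (contract-even G (not ∘ U) v₀ b₀ (cong not ¬Uv₀) odd′ even)
        (contract-good G (not ∘ U) v₀ b₀ (cong not ¬Uv₀) odd′ g (trans (cut-∁ G U b) tight)))
  where
  ¬Uv₀ : U v₀ ≡ false
  ¬Uv₀ = trans (sym (Boolₚ.not-involutive (U v₀))) (cong not q₀)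
  odd′ : Odd G (not ∘ U)
  odd′ = odd-∁ G even odd

-- Lexicographic induction: N bounds the vertices and drops under contraction, where the bound on
-- the support starts afresh; K bounds the support within one graph.
good⇒dy : ∀ N {n m} (G : Net n m) → count (Net.alive G) ℕ.< N → ⨁ (Net.alive G) ≡ false →
          ∀ K {w r} → Good G w r → count (positive w) ℕ.< K → Dy G w
good⇒dy (suc N) G small even (suc K) {w} gw few = good⇒dy-step G even gw
  (tight⇒dy G even λ H smaller even′ {x} g → good⇒dy N H (ℕₚ.<-≤-trans smaller (ℕₚ.≤-pred small)) even′ (suc (count (positive x))) g ℕₚ.≤-refl)
  (λ {b} {s} {e} g off we be → good⇒dy (suc N) G small even K g (ℕₚ.<-≤-trans (fewer off we be) (ℕₚ.≤-pred few)))
  where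
  open Good gw
  fewer : ∀ {b e} → (∀ x → w x ≡ 0ℤ → b x ≡ 0ℤ) → 0ℤ < w e → b e ≡ 0ℤ → count (positive b) ℕ.< count (positive w)
  fewer {b} {e} off we be = count-strict sub e (dec-false (0ℤ ℤₚ.<? b e) (λ p → ℤₚ.<-irrefl (sym be) p)) (dec-true (0ℤ ℤₚ.<? w e) we)
    where
    sub : ∀ x → positive b x ≡ true → positive w x ≡ true
    sub x p = dec-true (0ℤ ℤₚ.<? w x) (ℤₚ.≤∧≢⇒< (nonneg x) λ q → true≢false p
      (dec-false (0ℤ ℤₚ.<? b x) (λ h → ℤₚ.<-irrefl (sym (off x (sym q))) h)))

-- From rational combinations to integral vectors and back

net : (G : Graph) → Net (n G) (m G)
net G = record { alive = λ _ → true ; src = end₁ G ; tgt = end₂ G ; src-alive = λ _ → refl ; tgt-alive = λ _ → refl }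

T⇒≡ : ∀ {b} → T b → b ≡ true
T⇒≡ {true} _ = refl

≡⇒T : ∀ {b} → b ≡ true → T b
≡⇒T refl = tt

incident⇒inc : ∀ G e v → Incident G e v → inc (net G) e v ≡ true
incident⇒inc G e v (inj₁ refl) = inc-src (net G) e (loopless G e)
incident⇒inc G e v (inj₂ refl) = inc-tgt (net G) e (loopless G e)

perfect⇒pm : (G : Graph) → PerfectMatching G → PM (net G)
perfect⇒pm G (M , perfect) = M , isPM (λ e _ → loopless G e) λ v _ →
  trans (cut-count (net G) (_== v) M) (unique⇒∑ (one v))
  where
  one : ∀ v → ExactlyOne (λ e → inc (net G) e v ∧ M e)
  one v = (e , ∧-intro (incident⇒inc G e v i) (T⇒≡ Me)) ,
    λ x y p q → proj₂ (perfect v) x y (≡⇒T (∧-elimʳ (inc (net G) x v) p)) (inc⇒end (net G) x v (∧-elimˡ p))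
                                      (≡⇒T (∧-elimʳ (inc (net G) y v) q)) (inc⇒end (net G) y v (∧-elimˡ q))
    where
    e = proj₁ (proj₁ (perfect v))
    Me = proj₁ (proj₂ (proj₁ (perfect v)))
    i = proj₂ (proj₂ (proj₁ (perfect v)))

pm⇒perfect : (G : Graph) → PM (net G) → PerfectMatching G
pm⇒perfect G (M , pm) = M , λ v → let (e , p) , u = one v in
    (e , ≡⇒T (∧-elimʳ (inc (net G) e v) p) , inc⇒end (net G) e v (∧-elimˡ p)) ,
    (λ x y Mx ix My iy → u x y (∧-intro (incident⇒inc G x v ix) (T⇒≡ Mx)) (∧-intro (incident⇒inc G y v iy) (T⇒≡ My)))
  where
  one : ∀ v → ExactlyOne (λ e → inc (net G) e v ∧ M e)
  one v = ∑⇒unique (trans (sym (cut-count (net G) (_== v) M)) (IsPM.deg≡1 pm v refl))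

χ-value : ∀ G (M : PerfectMatching G) e → toℚᵘ (χ G M e) ≃ mkℚᵘ ⟦ proj₁ M e ⟧ 0
χ-value G (M , _) e with M e
... | true  = *≡* refl
... | false = *≡* refl

-- q x + y = a / (D + 1) for q = c / (d + 1), x = z and y = t / (N + 1)
combine : ∀ {q x y} c d z t N a D → toℚᵘ q ≃ mkℚᵘ c d → toℚᵘ x ≃ mkℚᵘ z 0 → toℚᵘ y ≃ mkℚᵘ t N →
          (c * z * + suc N + t * + suc d) * + suc D ≡ a * (+ suc d * + suc N) → toℚᵘ (q ℚ.* x ℚ.+ y) ≃ mkℚᵘ a D
combine {q} {x} {y} c d z t N a D p r s h =
  ℚᵘₚ.≃-trans (ℚₚ.toℚᵘ-homo-+ (q ℚ.* x) y)
    (ℚᵘₚ.≃-trans (ℚᵘₚ.+-cong (ℚᵘₚ.≃-trans (ℚₚ.toℚᵘ-homo-* q x) (ℚᵘₚ.*-cong p r)) s) (*≡* eq))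
  where
  eq : (c * z * + suc N + t * + suc (d ℕ.* 1)) * + suc D ≡ a * + (suc (d ℕ.* 1) ℕ.* suc N)
  eq rewrite ℕₚ.*-identityʳ d = trans h (cong (a *_) (sym (ℤₚ.pos-* (suc d) (suc N))))

clear-denominators : ∀ G (cs : Combination G) → AllCoeffs G NonNeg cs →
  Σ ℕ λ N → Σ (List (PM (net G))) λ L → ∀ e → toℚᵘ (evalComb G cs e) ≃ mkℚᵘ (total (net G) L e) N
clear-denominators G [] _ = 0 , [] , λ e → *≡* refl
clear-denominators G ((M , mkℚ -[1+ _ ] _ _) ∷ cs) (ℚ.*≤* () , _)
clear-denominators G ((M , q@(mkℚ (+ c) d _)) ∷ cs) (_ , nn) with clear-denominators G cs nn
-- Unnormalised rationals store the predecessor of the denominator: `N + d * suc N` is one less than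
-- (d + 1) (N + 1).
... | N , L , p = N ℕ.+ d ℕ.* suc N , copies H (c ℕ.* suc N) (M′ ∷ []) ++ copies H (suc d) L , λ e →
    combine {q} {χ G M e} {evalComb G cs e} (+ c) d ⟦ proj₁ M e ⟧ (total H L e) N _ _ (*≡* refl) (χ-value G M e) (p e) (value e)
  where
  H = net G
  M′ = perfect⇒pm G M
  value : ∀ e → (+ c * ⟦ proj₁ M e ⟧ * + suc N + total H L e * + suc d) * + (suc d ℕ.* suc N)
              ≡ total H (copies H (c ℕ.* suc N) (M′ ∷ []) ++ copies H (suc d) L) e * (+ suc d * + suc N)
  value e = cong₂ _*_ (sym (begin
    total H (copies H (c ℕ.* suc N) (M′ ∷ []) ++ copies H (suc d) L) e
      ≡⟨ total-++ H (copies H (c ℕ.* suc N) (M′ ∷ [])) (copies H (suc d) L) e ⟩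
    total H (copies H (c ℕ.* suc N) (M′ ∷ [])) e + total H (copies H (suc d) L) e
      ≡⟨ cong₂ _+_ (total-copies H (c ℕ.* suc N) (M′ ∷ []) e) (total-copies H (suc d) L e) ⟩
    + (c ℕ.* suc N) * (⟦ proj₁ M e ⟧ + 0ℤ) + + suc d * total H L e
      ≡⟨ cong (λ z → z * (⟦ proj₁ M e ⟧ + 0ℤ) + + suc d * total H L e) (ℤₚ.pos-* c (suc N)) ⟩
    + c * + suc N * (⟦ proj₁ M e ⟧ + 0ℤ) + + suc d * total H L e
      ≡⟨ lem (+ c) (+ suc N) ⟦ proj₁ M e ⟧ (+ suc d) (total H L e) ⟩
    + c * ⟦ proj₁ M e ⟧ * + suc N + total H L e * + suc d ∎))
    (ℤₚ.pos-* (suc d) (suc N))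
    where
    open ≡-Reasoning
    lem : ∀ c N z d t → c * N * (z + 0ℤ) + d * t ≡ c * z * N + t * d
    lem = solve-∀

/-value : ∀ a d .{{_ : ℕ.NonZero d}} → toℚᵘ (a ℚ./ d) ≃ mkℚᵘ a (ℕ.pred d)
/-value a (suc d) = ℚₚ.toℚᵘ-fromℚᵘ (mkℚᵘ a d)

-- The sum of the rational coefficients is not visibly an integer, so r is read off as the degree of
-- a vertex. The inequalities are verified for the multiple K x, which is a sum of matchings, and K
-- is then cancelled.
hull⇒good : ∀ G (x : Fin (m G) → ℤ) → InConicHull G (Defs.toℚ G x) → Fin (n G) → Σ ℤ λ r → Good (net G) x r
hull⇒good G x (cs , nn , eval) v₀ with clear-denominators G cs nn
... | N , L , p = deg H v₀ x , good-÷ H {f = K} (ℤ.+<+ (ℕ.s≤s ℕ.z≤n)) (good nonneg (λ e q → ⊥-elim (loopless G e q)) degree odd-cut)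
  where
  H = net G
  K : ℤ
  K = + suc N
  scaled : ∀ e → K * x e ≡ total H L e
  scaled e with ℚᵘₚ.≃-trans (ℚᵘₚ.≃-sym (p e)) (ℚᵘₚ.≃-trans (ℚₚ.toℚᵘ-cong (eval e)) (/-value (x e) 1))
  ... | *≡* q = trans (ℤₚ.*-comm K (x e)) (trans (sym q) (ℤₚ.*-identityʳ _))
  nonneg : ∀ e → 0ℤ ≤ K * x e
  nonneg e = subst (0ℤ ≤_) (sym (scaled e)) (total-nonneg H L e)
  cut-scaled : ∀ U → cut H U (λ e → K * x e) ≡ lsum H (λ M → cut H U (⟦_⟧ ∘ proj₁ M)) L
  cut-scaled U = trans (cut-congʳ H {U} scaled) (cut-total H U L)
  ones : ∀ v L → lsum H (λ M → deg H v (⟦_⟧ ∘ proj₁ M)) L ≡ lsum H (λ _ → 1ℤ) L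
  ones v []             = refl
  ones v ((_ , pm) ∷ L) = cong₂ _+_ (IsPM.deg≡1 pm v refl) (ones v L)
  size : ∀ v → deg H v (λ e → K * x e) ≡ lsum H (λ _ → 1ℤ) L
  size v = trans (cut-scaled (_== v)) (ones v L)
  K*deg : K * deg H v₀ x ≡ lsum H (λ _ → 1ℤ) L
  K*deg = trans (sym (cut-* H (_== v₀) K x)) (size v₀)
  degree : ∀ v → true ≡ true → deg H v (λ e → K * x e) ≡ K * deg H v₀ x
  degree v _ = trans (size v) (sym K*deg)
  odd-cut : ∀ {U} → Odd H U → K * deg H v₀ x ≤ cut H U (λ e → K * x e)
  odd-cut {U} o = subst₂ _≤_ (sym K*deg) (sym (cut-scaled U)) (each L)
    where
    each : ∀ L → lsum H (λ _ → 1ℤ) L ≤ lsum H (λ M → cut H U (⟦_⟧ ∘ proj₁ M)) L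
    each []             = ℤₚ.≤-refl
    each ((_ , pm) ∷ L) = ℤₚ.+-mono-≤ (pm-odd-cut≥1 H pm {U} o) (each L)

dy⇒dyadic : ∀ G (x : Fin (m G) → ℤ) → Dy (net G) x → DyadicConicComb G (Defs.toℚ G x)
dy⇒dyadic G x (k , L , p) = map weighted L , coeffs L , λ e → ℚₚ.toℚᵘ-injective
    (ℚᵘₚ.≃-trans (value L e) (ℚᵘₚ.≃-trans (*≡* (eq e)) (ℚᵘₚ.≃-sym (/-value (x e) 1))))
  where
  H = net G
  instance
    2^k≢0 : ℕ.NonZero (2 ^ k)
    2^k≢0 = ℕₚ.m^n≢0 2 k
  q : ℚ
  q = (+ 1) ℚ./ (2 ^ k)
  D : ℕ
  D = ℕ.pred (2 ^ k)
  weighted : PM H → PerfectMatching G × ℚ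
  weighted M = pm⇒perfect G M , q
  q≥0 : 0ℚ ℚ.≤ q
  q≥0 = ℚₚ.nonNegative⁻¹ q {{ℚₚ.normalize-nonNeg 1 (2 ^ k)}}
  coeffs : ∀ L → AllCoeffs G (λ q → NonNeg q × Dyadic q) (map weighted L)
  coeffs []      = tt
  coeffs (M ∷ L) = (q≥0 , + 1 , k , refl) , coeffs L
  value : ∀ L e → toℚᵘ (evalComb G (map weighted L) e) ≃ mkℚᵘ (total H L e) D
  value []      e = *≡* refl
  value (M ∷ L) e = combine {q} {χ G (pm⇒perfect G M) e} {evalComb G (map weighted L) e} 1ℤ D ⟦ proj₁ M e ⟧ (total H L e) D _ D (/-value 1ℤ (2 ^ k)) (χ-value G (pm⇒perfect G M) e) (value L e)
    (lem ⟦ proj₁ M e ⟧ (total H L e) (+ suc D))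
    where
    lem : ∀ z t d → (1ℤ * z * d + t * d) * d ≡ (z + t) * (d * d)
    lem = solve-∀
  eq : ∀ e → total H L e * 1ℤ ≡ x e * + suc D
  eq e = trans (ℤₚ.*-identityʳ _) (trans (sym (p e)) (trans (ℤₚ.*-comm (+ (2 ^ k)) (x e))
    (cong (λ d → x e * + d) (sym (ℕₚ.suc-pred (2 ^ k))))))

parity-even : ∀ k → ⨁ {k ℕ.+ k} (λ _ → true) ≡ false
parity-even k = trans (parity (k ℕ.+ k)) (lem k)
  where
  odd? : ℕ → Bool
  odd? zero    = false
  odd? (suc k) = not (odd? k)
  opaque
    unfolding ⨁
    parity : ∀ k → ⨁ {k} (λ _ → true) ≡ odd? k
    parity zero    = refl
    parity (suc k) = cong not (parity k)
  lem : ∀ k → odd? (k ℕ.+ k) ≡ false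
  lem zero    = refl
  lem (suc k) rewrite ℕₚ.+-suc k k = trans (Boolₚ.not-involutive _) (lem k)

theorem1p10 : (G : Graph) → EvenOrder G → IsDyadicGeneratingSet G
theorem1p10 G (k , n≡k+k) x hull = dy⇒dyadic G x (by (any? {n = n G} (λ _ → yes tt)))
  where
  H = net G
  even : ⨁ (Net.alive H) ≡ false
  even = subst (λ n → ⨁ {n} (λ _ → true) ≡ false) (sym n≡k+k) (parity-even k)
  by : Dec (Σ (Fin (n G)) λ _ → ⊤) → Dy H x
  by (yes (v , _)) = good⇒dy (suc (count (Net.alive H))) H ℕₚ.≤-refl even (suc (count (positive x)))
    (proj₂ (hull⇒good G x hull v)) ℕₚ.≤-refl
  -- A graph without vertices has no edges.
  by (no empty) = dy-0 H (λ e → ⊥-elim (empty (end₁ G e , tt)))
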